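{- There exists a continuous and periodic function $\mathcal{H}:\mathbb{R}\to\mathbb{R}$ of period $1$ such that, for all integers $N\ge 1$, $$\sum_{j=0}^{N}\mathsf{s}(j)=3^{\log_2 N}\,\mathcal{H}(\log_2 N).$$
   Context: For $n\ge 1$, $\mathrm{rep}_2(n)\in\{0,1\}^*$ is the usual base-$2$ expansion of $n$ (most significant digit first, no leading zero), and $\mathrm{rep}_2(0)=\varepsilon$ (the empty word), so that $\mathrm{rep}_2(\mathbb{N})=1\{0,1\}^*\cup\{\varepsilon\}$. For finite words $u,v\in\{0,1\}^*$, $\binom{u}{v}$ denotes the number of times $v$ occurs as a subsequence (scattered subword) of $u$; in particular $\binom{u}{\varepsilon}=1$. The sequence $(\mathsf{s}(n))_{n\ge 0}$ is defined by $\mathsf{s}(0)=0$ and, for $n\ge 1$, $$\mathsf{s}(n)=\#\left\{v\in \mathrm{rep}_2(\mathbb{N}) \;\middle|\; \binom{\mathrm{rep}_2(n-1)}{v}>0\right\}.$$ -}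

module Defs where

open import Data.Nat.Base as ℕ using (ℕ; zero; suc)
import Data.Nat.Properties as ℕ
import Data.Nat.DivMod as ℕ
open import Data.Nat.Induction using (Acc; acc; <-wellFounded)
open import Data.Integer.Base as ℤ using (ℤ; +_; +[1+_])
import Data.Integer.Properties as ℤ
open import Data.Rational.Base as ℚ using (ℚ; 0ℚ; 1ℚ)
open import Data.Fin.Base using (toℕ)
import Data.Rational.Properties as ℚ
import Data.Fin.Properties as Fin
open import Data.Digit using (Bit)
open import Data.List.Base
  using (List; []; _∷_; _∷ʳ_; [_]; _++_; map; filter; length; foldl; deduplicate)
open import Data.List.Properties using (≡-dec; foldl-∷ʳ)
open import Data.Product.Base using (∃; ∃-syntax; _×_; _,_; proj₁; proj₂)
open import Data.Sum.Base using (inj₁; inj₂)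
open import Level using (0ℓ)
open import Relation.Binary.Bundles using (Setoid)
open import Relation.Binary.Definitions using (DecidableEquality)
open import Relation.Binary.PropositionalEquality
  using (_≡_; refl; sym; trans; cong; cong₂; subst; subst₂; module ≡-Reasoning)
open import Relation.Nullary.Decidable using (Dec; map′; _×-dec_)

Word : Set
Word = List Bit

_≟ʷ_ : DecidableEquality Word
_≟ʷ_ = ≡-dec Fin._≟_

-- Repeated division by 2; the most significant digit comes first.

digits : ∀ n → Acc ℕ._<_ n → Word
digits zero      _        = []
digits n@(suc _) (acc rs) =
  digits (n ℕ./ 2) (rs (ℕ.m/n<m n 2 (ℕ.s≤s (ℕ.s≤s ℕ.z≤n)))) ∷ʳ (n ℕ.mod 2)

rep₂ : ℕ → Word
rep₂ n = digits n (<-wellFounded n)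

value : Word → ℕ
value = foldl (λ a d → toℕ d ℕ.+ a ℕ.* 2) 0

value-digits : ∀ n (r : Acc ℕ._<_ n) → value (digits n r) ≡ n
value-digits zero      _        = refl
value-digits n@(suc _) (acc rs) = let r = rs (ℕ.m/n<m n 2 (ℕ.s≤s (ℕ.s≤s ℕ.z≤n))); w = digits (n ℕ./ 2) r in begin
  value (w ∷ʳ (n ℕ.mod 2))                ≡⟨ foldl-∷ʳ _ 0 (n ℕ.mod 2) w ⟩
  toℕ (n ℕ.mod 2) ℕ.+ value w ℕ.* 2       ≡⟨ cong₂ (λ a b → a ℕ.+ b ℕ.* 2) (Fin.toℕ-fromℕ< _) (value-digits (n ℕ./ 2) r) ⟩
  n ℕ.% 2 ℕ.+ n ℕ./ 2 ℕ.* 2               ≡⟨ ℕ.m≡m%n+[m/n]*n n 2 ⟨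
  n                                       ∎
  where
  open ≡-Reasoning

value-rep₂ : ∀ n → value (rep₂ n) ≡ n
value-rep₂ n = value-digits n (<-wellFounded n)

IsRep₂ : Word → Set
IsRep₂ v = ∃[ m ] rep₂ m ≡ v

isRep₂? : ∀ v → Dec (IsRep₂ v)
isRep₂? v = map′ (value v ,_) (λ { (m , refl) → cong rep₂ (value-rep₂ m) })
                 (rep₂ (value v) ≟ʷ v)

-- One entry for each set of positions, so repetitions are kept.

subwords : Word → List Word
subwords []      = [ [] ]
subwords (a ∷ u) = map (a ∷_) (subwords u) ++ subwords u

binom : Word → Word → ℕ
binom u v = length (filter (_≟ʷ v) (subwords u))

-- Every v with binom u v > 0 is listed in subwords u, so the set whose
-- cardinality is taken may be enumerated by filtering that list.

s : ℕ → ℕ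
s zero    = 0
s (suc n) = length (deduplicate _≟ʷ_ (filter
  (λ v → isRep₂? v ×-dec (0 ℕ.<? binom (rep₂ n) v))
  (subwords (rep₂ n))))

module Cauchy where

  open import Data.Rational.Base
  open import Data.Rational.Properties
  open import Data.Rational.Solver using (module +-*-Solver)
  import Data.Rational.Unnormalised.Base as ℚᵘ
  import Data.Rational.Unnormalised.Properties as ℚᵘ
  open +-*-Solver using (solve; _:+_; _:*_; _:-_; _:=_; :-_; con)

  IsCauchy : (ℕ → ℚ) → Set
  IsCauchy a = ∀ ε → 0ℚ < ε →
    ∃[ N ] (∀ m n → N ℕ.≤ m → N ℕ.≤ n → ∣ a m - a n ∣ < ε)

  -- Shifted by one so that the denominator is never zero.

  inv : ℕ → ℚ
  inv k = + 1 / suc k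

  0<1 : 0ℚ < 1ℚ
  0<1 = positive⁻¹ 1ℚ

  0<½ : 0ℚ < ½
  0<½ = positive⁻¹ ½

  +-pos : ∀ {p q} → 0ℚ < p → 0ℚ < q → 0ℚ < p + q
  +-pos 0<p 0<q = +-mono-< 0<p 0<q

  +-nonNeg : ∀ {p q} → 0ℚ ≤ p → 0ℚ ≤ q → 0ℚ ≤ p + q
  +-nonNeg 0≤p 0≤q = +-mono-≤ 0≤p 0≤q

  *-pos : ∀ {p q} → 0ℚ < p → 0ℚ < q → 0ℚ < p * q
  *-pos {p} {q} 0<p 0<q =
    positive⁻¹ (p * q) {{pos*pos⇒pos p {{positive 0<p}} q {{positive 0<q}}}}

  *-nonNeg : ∀ {p q} → 0ℚ ≤ p → 0ℚ ≤ q → 0ℚ ≤ p * q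
  *-nonNeg {p} {q} 0≤p 0≤q =
    nonNegative⁻¹ (p * q)
      {{nonNeg*nonNeg⇒nonNeg p {{nonNegative 0≤p}} q {{nonNegative 0≤q}}}}

  *-monoˡ : ∀ r {p q} → 0ℚ ≤ r → p ≤ q → r * p ≤ r * q
  *-monoˡ r 0≤r = *-monoˡ-≤-nonNeg r {{nonNegative 0≤r}}

  *-monoʳ : ∀ r {p q} → 0ℚ ≤ r → p ≤ q → p * r ≤ q * r
  *-monoʳ r 0≤r = *-monoʳ-≤-nonNeg r {{nonNegative 0≤r}}

  *-mono : ∀ {p q r t} → 0ℚ ≤ q → 0ℚ ≤ r → p ≤ q → r ≤ t → p * r ≤ q * t
  *-mono {q = q} {r} 0≤q 0≤r p≤q r≤t =
    ≤-trans (*-monoʳ r 0≤r p≤q) (*-monoˡ q 0≤q r≤t)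

  p≤p+q : ∀ p {q} → 0ℚ ≤ q → p ≤ p + q
  p≤p+q p {q} 0≤q = subst (_≤ p + q) (+-identityʳ p) (+-monoʳ-≤ p 0≤q)

  p≤q+p : ∀ p {q} → 0ℚ ≤ q → p ≤ q + p
  p≤q+p p {q} 0≤q = subst (_≤ q + p) (+-identityˡ p) (+-monoˡ-≤ p 0≤q)

  p≤q⇒0≤q-p : ∀ p q → p ≤ q → 0ℚ ≤ q - p
  p≤q⇒0≤q-p p q p≤q = subst (_≤ q - p) (+-inverseʳ p) (+-monoˡ-≤ (- p) p≤q)

  p≤q+r⇒p-q≤r : ∀ p q {r} → p ≤ q + r → p - q ≤ r
  p≤q+r⇒p-q≤r p q {r} h =
    subst (p - q ≤_) (solve 2 (λ q r → q :+ r :- q := r) refl q r)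
      (+-monoˡ-≤ (- q) h)

  p≤∣p∣ : ∀ p → p ≤ ∣ p ∣
  p≤∣p∣ p with ≤-total 0ℚ p
  ... | inj₁ 0≤p = ≤-reflexive (sym (0≤p⇒∣p∣≡p 0≤p))
  ... | inj₂ p≤0 = ≤-trans p≤0 (0≤∣p∣ p)

  ∣p∣≤ : ∀ {p b} → p ≤ b → - p ≤ b → ∣ p ∣ ≤ b
  ∣p∣≤ {p} {b} h₁ h₂ with ∣p∣≡p∨∣p∣≡-p p
  ... | inj₁ eq = subst (_≤ b) (sym eq) h₁
  ... | inj₂ eq = subst (_≤ b) (sym eq) h₂

  ∣-∣-comm : ∀ p q → ∣ p - q ∣ ≡ ∣ q - p ∣
  ∣-∣-comm p q = trans (sym (∣-p∣≡∣p∣ (p - q)))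
    (cong ∣_∣ (solve 2 (λ p q → :- (p :- q) := q :- p) refl p q))

  ∣-∣-triangle : ∀ p q r → ∣ p - r ∣ ≤ ∣ p - q ∣ + ∣ q - r ∣
  ∣-∣-triangle p q r = subst (λ t → ∣ t ∣ ≤ ∣ p - q ∣ + ∣ q - r ∣)
    (solve 3 (λ p q r → (p :- q) :+ (q :- r) := p :- r) refl p q r)
    (∣p+q∣≤∣p∣+∣q∣ (p - q) (q - r))

  ∣p∣≤∣q∣+∣p-q∣ : ∀ p q → ∣ p ∣ ≤ ∣ q ∣ + ∣ p - q ∣
  ∣p∣≤∣q∣+∣p-q∣ p q = subst (λ t → ∣ t ∣ ≤ ∣ q ∣ + ∣ p - q ∣)
    (solve 2 (λ p q → q :+ (p :- q) := p) refl p q)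
    (∣p+q∣≤∣p∣+∣q∣ q (p - q))

  recipℚ : ∀ p → 0ℚ < p → ℚ
  recipℚ p 0<p = (1/ p) {{>-nonZero 0<p}}

  recipℚ-pos : ∀ p (0<p : 0ℚ < p) → 0ℚ < recipℚ p 0<p
  recipℚ-pos p 0<p =
    positive⁻¹ (recipℚ p 0<p) {{1/pos⇒pos p {{positive 0<p}}}}

  *-recipℚ : ∀ p (0<p : 0ℚ < p) → p * recipℚ p 0<p ≡ 1ℚ
  *-recipℚ p 0<p = *-inverseʳ p {{>-nonZero 0<p}}

  recipℚ-anti : ∀ {p q} (0<p : 0ℚ < p) (0<q : 0ℚ < q) →
                p ≤ q → recipℚ q 0<q ≤ recipℚ p 0<p
  recipℚ-anti {p} {q} 0<p 0<q p≤q = begin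
    q′              ≡⟨ *-identityʳ q′ ⟨
    q′ * 1ℚ         ≡⟨ cong (q′ *_) (*-recipℚ p 0<p) ⟨
    q′ * (p * p′)   ≤⟨ *-monoˡ q′ (<⇒≤ (recipℚ-pos q 0<q))
                         (*-monoʳ p′ (<⇒≤ (recipℚ-pos p 0<p)) p≤q) ⟩
    q′ * (q * p′)   ≡⟨ solve 3 (λ a b c → a :* (b :* c) := (b :* a) :* c) refl q′ q p′ ⟩
    (q * q′) * p′   ≡⟨ cong (_* p′) (*-recipℚ q 0<q) ⟩
    1ℚ * p′         ≡⟨ *-identityˡ p′ ⟩
    p′              ∎
    where
    open ≤-Reasoning
    p′ = recipℚ p 0<p
    q′ = recipℚ q 0<q

  divide : ∀ C ε → 0ℚ < C → 0ℚ < ε → ∃[ δ ] (0ℚ < δ × C * δ ≡ ε)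
  divide C ε 0<C 0<ε =
    recipℚ C 0<C * ε , *-pos (recipℚ-pos C 0<C) 0<ε ,
    trans (sym (*-assoc C _ ε))
      (trans (cong (_* ε) (*-recipℚ C 0<C)) (*-identityˡ ε))

  halve : ∀ ε → 0ℚ < ε → ∃[ δ ] (0ℚ < δ × δ + δ ≡ ε)
  halve ε 0<ε = ½ * ε , *-pos 0<½ 0<ε ,
    trans (sym (*-distribʳ-+ ε ½ ½)) (*-identityˡ ε)

  /-mono-≤ : ∀ i j c d → i ℤ.* + suc d ℤ.≤ j ℤ.* + suc c →
             i / suc c ≤ j / suc d
  /-mono-≤ i j c d h = toℚᵘ-cancel-≤
    (ℚᵘ.≤-respˡ-≃ (ℚᵘ.≃-sym (toℚᵘ-fromℚᵘ (ℚᵘ.mkℚᵘ i c)))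
    (ℚᵘ.≤-respʳ-≃ (ℚᵘ.≃-sym (toℚᵘ-fromℚᵘ (ℚᵘ.mkℚᵘ j d)))
    (ℚᵘ.*≤* h)))

  inv-pos : ∀ k → 0ℚ < inv k
  inv-pos k = positive⁻¹ (inv k) {{normalize-pos 1 (suc k)}}

  inv-nonNeg : ∀ k → 0ℚ ≤ inv k
  inv-nonNeg k = <⇒≤ (inv-pos k)

  inv-anti : ∀ {m n} → m ℕ.≤ n → inv n ≤ inv m
  inv-anti {m} {n} m≤n = /-mono-≤ (+ 1) (+ 1) n m
    (ℤ.*-monoˡ-≤-nonNeg (+ 1) (ℤ.+≤+ (ℕ.s≤s m≤n)))

  fromℕℚ : ℕ → ℚ
  fromℕℚ n = + n / 1

  fromℕℚ-suc : ∀ n → fromℕℚ (suc n) ≡ 1ℚ + fromℕℚ n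
  fromℕℚ-suc n = toℚᵘ-injective (begin
    toℚᵘ (fromℕℚ (suc n))               ≈⟨ toℚᵘ-fromℚᵘ (ℚᵘ.mkℚᵘ (+ suc n) 0) ⟩
    ℚᵘ.mkℚᵘ (+ suc n) 0                 ≈⟨ ℚᵘ.*≡* (cong (ℤ._* + 1) (cong (ℤ._+_ (+ 1)) (sym (ℤ.*-identityʳ (+ n))))) ⟩
    ℚᵘ.1ℚᵘ ℚᵘ.+ ℚᵘ.mkℚᵘ (+ n) 0         ≈⟨ ℚᵘ.+-congʳ ℚᵘ.1ℚᵘ (ℚᵘ.≃-sym (toℚᵘ-fromℚᵘ (ℚᵘ.mkℚᵘ (+ n) 0))) ⟩
    toℚᵘ 1ℚ ℚᵘ.+ toℚᵘ (fromℕℚ n)        ≈⟨ ℚᵘ.≃-sym (toℚᵘ-homo-+ 1ℚ (fromℕℚ n)) ⟩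
    toℚᵘ (1ℚ + fromℕℚ n)                ∎)
    where open ℚᵘ.≃-Reasoning

  fromℕℚ-*-inv : ∀ k → fromℕℚ (suc k) * inv k ≡ 1ℚ
  fromℕℚ-*-inv k = toℚᵘ-injective (begin
    toℚᵘ (fromℕℚ (suc k) * inv k)                ≈⟨ toℚᵘ-homo-* (fromℕℚ (suc k)) (inv k) ⟩
    toℚᵘ (fromℕℚ (suc k)) ℚᵘ.* toℚᵘ (inv k)      ≈⟨ ℚᵘ.*-cong (toℚᵘ-fromℚᵘ (ℚᵘ.mkℚᵘ (+ suc k) 0)) (toℚᵘ-fromℚᵘ (ℚᵘ.mkℚᵘ (+ 1) k)) ⟩
    ℚᵘ.mkℚᵘ (+ suc k) 0 ℚᵘ.* ℚᵘ.mkℚᵘ (+ 1) k     ≈⟨ ℚᵘ.*≡* lem ⟩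
    ℚᵘ.1ℚᵘ                                       ∎)
    where
    open ℚᵘ.≃-Reasoning
    lem : (+ suc k ℤ.* + 1) ℤ.* + 1 ≡ + 1 ℤ.* + (1 ℕ.* suc k)
    lem = trans (ℤ.*-identityʳ _) (trans (ℤ.*-identityʳ (+ suc k))
      (sym (trans (ℤ.*-identityˡ _) (cong +_ (ℕ.*-identityˡ (suc k))))))

  fromℕℚ-nonNeg : ∀ n → 0ℚ ≤ fromℕℚ n
  fromℕℚ-nonNeg n = nonNegative⁻¹ (fromℕℚ n) {{normalize-nonNeg n 1}}

  archimedean : ∀ ε → 0ℚ < ε → ∃[ N ] (inv N < ε)
  archimedean ε@(mkℚ (+ zero) d _) (*<* (ℤ.+<+ ()))
  archimedean ε@(mkℚ +[1+ a ] d c) 0<ε = suc d , toℚᵘ-cancel-<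
    (ℚᵘ.<-respˡ-≃ (ℚᵘ.≃-sym (toℚᵘ-fromℚᵘ (ℚᵘ.mkℚᵘ (+ 1) (suc d))))
      (ℚᵘ.*<* (ℤ.<-≤-trans
        (subst (ℤ._< + suc (suc d)) (sym (ℤ.*-identityˡ (+ suc d)))
          (ℤ.+<+ (ℕ.n<1+n (suc d))))
        (ℤ.+≤+ (ℕ.m≤n*m (suc (suc d)) (suc a))))))
  archimedean (mkℚ ℤ.-[1+ _ ] d _) (*<* ())

  archimedean-* : ∀ C ε → 0ℚ ≤ C → 0ℚ < ε →
                  ∃[ N ] (∀ n → N ℕ.≤ n → C * inv n < ε)
  archimedean-* C ε 0≤C 0<ε =
    let 0<C+1 = +-mono-≤-< 0≤C 0<1
        (δ , 0<δ , eq) = divide (C + 1ℚ) ε 0<C+1 0<ε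
        (N , inv<δ) = archimedean δ 0<δ
    in N , λ n N≤n → begin-strict
      C * inv n           ≤⟨ *-monoʳ (inv n) (inv-nonNeg n) (p≤p+q C (<⇒≤ 0<1)) ⟩
      (C + 1ℚ) * inv n    ≤⟨ *-monoˡ (C + 1ℚ) (<⇒≤ 0<C+1) (inv-anti N≤n) ⟩
      (C + 1ℚ) * inv N    <⟨ *-monoʳ-<-pos (C + 1ℚ) {{positive 0<C+1}} inv<δ ⟩
      (C + 1ℚ) * δ        ≡⟨ eq ⟩
      ε                   ∎
    where open ≤-Reasoning

  const-cauchy : ∀ p → IsCauchy (λ _ → p)
  const-cauchy p ε 0<ε =
    0 , λ _ _ _ _ → subst (λ t → ∣ t ∣ < ε) (sym (+-inverseʳ p)) 0<ε

  tail⇒cauchy : ∀ a →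
    (∀ ε → 0ℚ < ε → ∃[ N ] (∀ m n → N ℕ.≤ n → n ℕ.≤ m → ∣ a m - a n ∣ < ε)) →
    IsCauchy a
  tail⇒cauchy a h ε 0<ε with h ε 0<ε
  ... | N , close = N , go
    where
    go : ∀ m n → N ℕ.≤ m → N ℕ.≤ n → ∣ a m - a n ∣ < ε
    go m n N≤m N≤n with ℕ.≤-total n m
    ... | inj₁ n≤m = close m n N≤n n≤m
    ... | inj₂ m≤n = subst (_< ε) (∣-∣-comm (a n) (a m)) (close n m N≤m m≤n)

  combine : ∀ a b c C → 0ℚ < C → IsCauchy a → IsCauchy b →
    (∀ m n → ∣ c m - c n ∣ ≤ C * (∣ a m - a n ∣ + ∣ b m - b n ∣)) → IsCauchy c
  combine a b c C 0<C ca cb h ε 0<ε =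
    let (δ , 0<δ , Cδ≡ε) = divide C ε 0<C 0<ε
        (η , 0<η , η+η≡δ) = halve δ 0<δ
        (M , closeA) = ca η 0<η
        (N , closeB) = cb η 0<η
    in M ℕ.⊔ N , λ m n ≤m ≤n → begin-strict
      ∣ c m - c n ∣                          ≤⟨ h m n ⟩
      C * (∣ a m - a n ∣ + ∣ b m - b n ∣)    <⟨ *-monoʳ-<-pos C {{positive 0<C}}
         (+-mono-< (closeA m n (ℕ.m⊔n≤o⇒m≤o M N ≤m) (ℕ.m⊔n≤o⇒m≤o M N ≤n))
                   (closeB m n (ℕ.m⊔n≤o⇒n≤o M N ≤m) (ℕ.m⊔n≤o⇒n≤o M N ≤n))) ⟩
      C * (η + η)                            ≡⟨ cong (C *_) η+η≡δ ⟩
      C * δ                                  ≡⟨ Cδ≡ε ⟩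
      ε                                      ∎
    where open ≤-Reasoning

  lipschitz : ∀ a c C → 0ℚ < C → IsCauchy a →
    (∀ m n → ∣ c m - c n ∣ ≤ C * ∣ a m - a n ∣) → IsCauchy c
  lipschitz a c C 0<C ca h = combine a a c C 0<C ca ca λ m n →
    ≤-trans (h m n) (*-monoˡ C (<⇒≤ 0<C) (p≤p+q ∣ a m - a n ∣ (0≤∣p∣ (a m - a n))))

  maximum : (ℕ → ℚ) → ℕ → ℚ
  maximum a zero    = ∣ a 0 ∣
  maximum a (suc k) = maximum a k ⊔ ∣ a (suc k) ∣

  ≤-maximum : ∀ a {n k} → n ℕ.≤′ k → ∣ a n ∣ ≤ maximum a k
  ≤-maximum a {k = zero}  ℕ.≤′-refl     = ≤-refl
  ≤-maximum a {k = suc k} ℕ.≤′-refl     = p≤q⊔p (maximum a k) _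
  ≤-maximum a {k = suc k} (ℕ.≤′-step h) = ≤-trans (≤-maximum a h) (p≤p⊔q (maximum a k) _)

  bounded : ∀ a → IsCauchy a → ∃[ B ] (0ℚ < B × ∀ n → ∣ a n ∣ ≤ B)
  bounded a ca with ca 1ℚ 0<1
  ... | N , close =
    maximum a N + 1ℚ , +-mono-≤-< (≤-trans (0≤∣p∣ (a N)) aN≤) 0<1 , go
    where
    aN≤ : ∣ a N ∣ ≤ maximum a N
    aN≤ = ≤-maximum a ℕ.≤′-refl
    go : ∀ n → ∣ a n ∣ ≤ maximum a N + 1ℚ
    go n with ℕ.≤-total n N
    ... | inj₁ n≤N = ≤-trans (≤-maximum a (ℕ.≤⇒≤′ n≤N)) (p≤p+q (maximum a N) (<⇒≤ 0<1))
    ... | inj₂ N≤n = ≤-trans (∣p∣≤∣q∣+∣p-q∣ (a n) (a N))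
                       (+-mono-≤ aN≤ (<⇒≤ (close n N N≤n ℕ.≤-refl)))

  +-cauchy : ∀ a b → IsCauchy a → IsCauchy b → IsCauchy (λ n → a n + b n)
  +-cauchy a b ca cb = combine a b (λ n → a n + b n) 1ℚ 0<1 ca cb λ m n →
    subst₂ _≤_
      (cong ∣_∣ (solve 4 (λ p q r t → (p :- q) :+ (r :- t) := (p :+ r) :- (q :+ t))
                   refl (a m) (a n) (b m) (b n)))
      (sym (*-identityˡ _))
      (∣p+q∣≤∣p∣+∣q∣ (a m - a n) (b m - b n))

  neg-cauchy : ∀ a → IsCauchy a → IsCauchy (λ n → - a n)
  neg-cauchy a ca = lipschitz a (λ n → - a n) 1ℚ 0<1 ca λ m n →
    ≤-reflexive (trans
      (cong ∣_∣ (solve 2 (λ p q → :- p :- :- q := :- (p :- q)) refl (a m) (a n)))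
      (trans (∣-p∣≡∣p∣ (a m - a n)) (sym (*-identityˡ _))))

  abs-cauchy : ∀ a → IsCauchy a → IsCauchy (λ n → ∣ a n ∣)
  abs-cauchy a ca = lipschitz a (λ n → ∣ a n ∣) 1ℚ 0<1 ca λ m n →
    subst (∣ ∣ a m ∣ - ∣ a n ∣ ∣ ≤_) (sym (*-identityˡ _))
      (∣p∣≤ (p≤q+r⇒p-q≤r (∣ a m ∣) (∣ a n ∣) (∣p∣≤∣q∣+∣p-q∣ (a m) (a n)))
        (subst (_≤ ∣ a m - a n ∣)
          (solve 2 (λ p q → q :- p := :- (p :- q)) refl (∣ a m ∣) (∣ a n ∣))
          (p≤q+r⇒p-q≤r (∣ a n ∣) (∣ a m ∣) (subst (λ t → ∣ a n ∣ ≤ ∣ a m ∣ + t) (∣-∣-comm (a n) (a m))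
            (∣p∣≤∣q∣+∣p-q∣ (a n) (a m))))))

  *-cauchy : ∀ a b → IsCauchy a → IsCauchy b → IsCauchy (λ n → a n * b n)
  *-cauchy a b ca cb with bounded a ca | bounded b cb
  ... | A , 0<A , a≤A | B , 0<B , b≤B =
    combine a b (λ n → a n * b n) (A + B) (+-pos 0<A 0<B) ca cb λ m n → begin
      ∣ a m * b m - a n * b n ∣
        ≡⟨ cong ∣_∣ (solve 4 (λ p q r t → p :* r :- q :* t := (p :- q) :* r :+ q :* (r :- t))
                       refl (a m) (a n) (b m) (b n)) ⟩
      ∣ (a m - a n) * b m + a n * (b m - b n) ∣
        ≤⟨ ∣p+q∣≤∣p∣+∣q∣ ((a m - a n) * b m) (a n * (b m - b n)) ⟩
      ∣ (a m - a n) * b m ∣ + ∣ a n * (b m - b n) ∣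
        ≡⟨ cong₂ _+_ (∣p*q∣≡∣p∣*∣q∣ (a m - a n) (b m)) (∣p*q∣≡∣p∣*∣q∣ (a n) (b m - b n)) ⟩
      ∣ a m - a n ∣ * ∣ b m ∣ + ∣ a n ∣ * ∣ b m - b n ∣
        ≤⟨ +-mono-≤
             (*-monoˡ ∣ a m - a n ∣ (0≤∣p∣ (a m - a n)) (≤-trans (b≤B m) (p≤q+p B (<⇒≤ 0<A))))
             (*-monoʳ ∣ b m - b n ∣ (0≤∣p∣ (b m - b n)) (≤-trans (a≤A n) (p≤p+q A (<⇒≤ 0<B)))) ⟩
      ∣ a m - a n ∣ * (A + B) + (A + B) * ∣ b m - b n ∣
        ≡⟨ solve 3 (λ p c q → p :* c :+ c :* q := c :* (p :+ q)) refl (∣ a m - a n ∣) (A + B) (∣ b m - b n ∣) ⟩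
      (A + B) * (∣ a m - a n ∣ + ∣ b m - b n ∣) ∎
    where open ≤-Reasoning

  -- The reciprocal of a sequence that is eventually at least c > 0; the
  -- maximum with c only affects the finitely many earlier terms.

  module Reciprocal (c : ℚ) (0<c : 0ℚ < c) where

    c⊔-pos : ∀ p → 0ℚ < c ⊔ p
    c⊔-pos p = <-≤-trans 0<c (p≤p⊔q c p)

    recip⊔ : ℚ → ℚ
    recip⊔ p = recipℚ (c ⊔ p) (c⊔-pos p)

    c⊔-≤ : ∀ p q → c ⊔ p ≤ c ⊔ q + ∣ p - q ∣
    c⊔-≤ p q = ⊔-lub (≤-trans (p≤p⊔q c q) (p≤p+q (c ⊔ q) (0≤∣p∣ (p - q)))) (begin
      p                 ≡⟨ solve 2 (λ p q → q :+ (p :- q) := p) refl p q ⟨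
      q + (p - q)       ≤⟨ +-mono-≤ (p≤q⊔p c q) (p≤∣p∣ (p - q)) ⟩
      c ⊔ q + ∣ p - q ∣ ∎)
      where open ≤-Reasoning

    c⊔-lip : ∀ p q → ∣ (c ⊔ p) - (c ⊔ q) ∣ ≤ ∣ p - q ∣
    c⊔-lip p q = ∣p∣≤ (p≤q+r⇒p-q≤r (c ⊔ p) (c ⊔ q) (c⊔-≤ p q))
      (subst (_≤ ∣ p - q ∣)
        (solve 2 (λ u v → v :- u := :- (u :- v)) refl (c ⊔ p) (c ⊔ q))
        (p≤q+r⇒p-q≤r (c ⊔ q) (c ⊔ p) (subst (λ t → c ⊔ q ≤ c ⊔ p + t) (∣-∣-comm q p) (c⊔-≤ q p))))

    c′ : ℚ
    c′ = recipℚ c 0<c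

    0<c′ : 0ℚ < c′
    0<c′ = recipℚ-pos c 0<c

    recip⊔-nonNeg : ∀ p → 0ℚ ≤ recip⊔ p
    recip⊔-nonNeg p = <⇒≤ (recipℚ-pos (c ⊔ p) (c⊔-pos p))

    recip⊔-≤ : ∀ p → recip⊔ p ≤ c′
    recip⊔-≤ p = recipℚ-anti 0<c (c⊔-pos p) (p≤p⊔q c p)

    recip⊔-lip : ∀ p q → ∣ recip⊔ p - recip⊔ q ∣ ≤ c′ * c′ * ∣ p - q ∣
    recip⊔-lip p q = begin
      ∣ u′ - v′ ∣                     ≡⟨ cong₂ (λ s t → ∣ s - t ∣) (*-identityʳ u′) (*-identityʳ v′) ⟨
      ∣ u′ * 1ℚ - v′ * 1ℚ ∣           ≡⟨ cong₂ (λ s t → ∣ u′ * s - v′ * t ∣)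
                                           (*-recipℚ v (c⊔-pos q)) (*-recipℚ u (c⊔-pos p)) ⟨
      ∣ u′ * (v * v′) - v′ * (u * u′) ∣
        ≡⟨ cong ∣_∣ (solve 4 (λ u u′ v v′ → u′ :* (v :* v′) :- v′ :* (u :* u′)
                                          := (u′ :* v′) :* (v :- u)) refl u u′ v v′) ⟩
      ∣ (u′ * v′) * (v - u) ∣         ≡⟨ ∣p*q∣≡∣p∣*∣q∣ (u′ * v′) (v - u) ⟩
      ∣ u′ * v′ ∣ * ∣ v - u ∣         ≡⟨ cong₂ _*_ (0≤p⇒∣p∣≡p 0≤u′v′) (∣-∣-comm v u) ⟩
      u′ * v′ * ∣ u - v ∣             ≤⟨ *-mono (<⇒≤ (*-pos 0<c′ 0<c′)) (0≤∣p∣ (u - v))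
                                           (*-mono (<⇒≤ 0<c′) (recip⊔-nonNeg q) (recip⊔-≤ p) (recip⊔-≤ q))
                                           (c⊔-lip p q) ⟩
      c′ * c′ * ∣ p - q ∣             ∎
      where
      open ≤-Reasoning
      u  = c ⊔ p
      v  = c ⊔ q
      u′ = recip⊔ p
      v′ = recip⊔ q
      0≤u′v′ : 0ℚ ≤ u′ * v′
      0≤u′v′ = *-nonNeg (recip⊔-nonNeg p) (recip⊔-nonNeg q)

    recip⊔-cauchy : ∀ a → IsCauchy a → IsCauchy (λ n → recip⊔ (a n))
    recip⊔-cauchy a ca =
      lipschitz a (λ n → recip⊔ (a n)) (c′ * c′) (*-pos 0<c′ 0<c′) ca λ m n → recip⊔-lip (a m) (a n)

  open Reciprocal public using (recip⊔; recip⊔-cauchy)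

  -- expTerm x k = xᵏ / k!

  expTerm : ℚ → ℕ → ℚ
  expTerm x zero    = 1ℚ
  expTerm x (suc k) = expTerm x k * (x * inv k)

  expSum : ℚ → ℕ → ℚ
  expSum x zero    = 0ℚ
  expSum x (suc n) = expSum x n + expTerm x n

  module ExpBound (B : ℚ) (0≤B : 0ℚ ≤ B) where

    open ≤-Reasoning

    t E : ℕ → ℚ
    t = expTerm B
    E = expSum B

    t-nonNeg : ∀ k → 0ℚ ≤ t k
    t-nonNeg zero    = <⇒≤ 0<1
    t-nonNeg (suc k) = *-nonNeg (t-nonNeg k) (*-nonNeg 0≤B (inv-nonNeg k))

    t-≤ : ∀ {x} → ∣ x ∣ ≤ B → ∀ k → ∣ expTerm x k ∣ ≤ t k
    t-≤ {x} x≤B zero    = ≤-refl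
    t-≤ {x} x≤B (suc k) = begin
      ∣ expTerm x k * (x * inv k) ∣          ≡⟨ ∣p*q∣≡∣p∣*∣q∣ (expTerm x k) (x * inv k) ⟩
      ∣ expTerm x k ∣ * ∣ x * inv k ∣        ≡⟨ cong (∣ expTerm x k ∣ *_) (∣p*q∣≡∣p∣*∣q∣ x (inv k)) ⟩
      ∣ expTerm x k ∣ * (∣ x ∣ * ∣ inv k ∣)  ≡⟨ cong (λ r → ∣ expTerm x k ∣ * (∣ x ∣ * r)) (0≤p⇒∣p∣≡p (inv-nonNeg k)) ⟩
      ∣ expTerm x k ∣ * (∣ x ∣ * inv k)      ≤⟨ *-mono (t-nonNeg k) (*-nonNeg (0≤∣p∣ x) (inv-nonNeg k)) (t-≤ x≤B k)
                                                  (*-monoʳ (inv k) (inv-nonNeg k) x≤B) ⟩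
      t k * (B * inv k)                      ∎

    E-mono : ∀ {n m} → n ℕ.≤′ m → E n ≤ E m
    E-mono ℕ.≤′-refl             = ≤-refl
    E-mono (ℕ.≤′-step {m} h) = ≤-trans (E-mono h) (p≤p+q (E m) (t-nonNeg m))

    expSum-tail : ∀ {x} → ∣ x ∣ ≤ B → ∀ {n m} → n ℕ.≤′ m →
                  ∣ expSum x m - expSum x n ∣ ≤ E m - E n
    expSum-tail {x} x≤B {n} ℕ.≤′-refl = ≤-reflexive
      (trans (cong ∣_∣ (+-inverseʳ (expSum x n))) (sym (+-inverseʳ (E n))))
    expSum-tail {x} x≤B {n} (ℕ.≤′-step {m} h) = begin
      ∣ expSum x m + expTerm x m - expSum x n ∣         ≡⟨ cong ∣_∣ (solve 3 (λ a b c → a :+ b :- c := (a :- c) :+ b) refl (expSum x m) (expTerm x m) (expSum x n)) ⟩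
      ∣ expSum x m - expSum x n + expTerm x m ∣         ≤⟨ ∣p+q∣≤∣p∣+∣q∣ (expSum x m - expSum x n) (expTerm x m) ⟩
      ∣ expSum x m - expSum x n ∣ + ∣ expTerm x m ∣     ≤⟨ +-mono-≤ (expSum-tail x≤B h) (t-≤ x≤B m) ⟩
      E m - E n + t m                                   ≡⟨ solve 3 (λ a b c → (a :- c) :+ b := a :+ b :- c) refl (E m) (t m) (E n) ⟩
      E m + t m - E n                                   ∎

    expSum-tail′ : ∀ {x} → ∣ x ∣ ≤ B → ∀ m n →
                   ∣ expSum x m - expSum x n ∣ ≤ ∣ E m - E n ∣
    expSum-tail′ {x} x≤B m n with ℕ.≤-total n m
    ... | inj₁ n≤m = ≤-trans (expSum-tail x≤B (ℕ.≤⇒≤′ n≤m)) (p≤∣p∣ (E m - E n))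
    ... | inj₂ m≤n = subst₂ _≤_ (∣-∣-comm (expSum x n) (expSum x m)) (∣-∣-comm (E n) (E m))
                       (≤-trans (expSum-tail x≤B (ℕ.≤⇒≤′ m≤n)) (p≤∣p∣ (E n - E m)))

    K : ℕ
    K = proj₁ (archimedean-* B ½ 0≤B 0<½)

    t-halves : ∀ k → K ℕ.≤ k → t (suc k) ≤ t k * ½
    t-halves k K≤k = *-monoˡ (t k) (t-nonNeg k)
      (<⇒≤ (proj₂ (archimedean-* B ½ 0≤B 0<½) k K≤k))

    E-tail : ∀ {n m} → K ℕ.≤ n → n ℕ.≤′ m → E m + (t m + t m) ≤ E n + (t n + t n)
    E-tail K≤n ℕ.≤′-refl = ≤-refl
    E-tail {n} K≤n (ℕ.≤′-step {m} h) = begin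
      E m + t m + (t (suc m) + t (suc m))   ≤⟨ +-monoʳ-≤ (E m + t m) (+-mono-≤ ½t ½t) ⟩
      E m + t m + (t m * ½ + t m * ½)       ≡⟨ cong (λ r → E m + t m + r) (trans (sym (*-distribˡ-+ (t m) ½ ½)) (*-identityʳ (t m))) ⟩
      E m + t m + t m                       ≡⟨ +-assoc (E m) (t m) (t m) ⟩
      E m + (t m + t m)                     ≤⟨ E-tail K≤n h ⟩
      E n + (t n + t n)                     ∎
      where
      ½t = t-halves m (ℕ.≤-trans K≤n (ℕ.≤′⇒≤ h))

    E-tail′ : ∀ {n m} → K ℕ.≤ n → n ℕ.≤′ m → ∣ E m - E n ∣ ≤ t n + t n
    E-tail′ {n} {m} K≤n h = subst (_≤ t n + t n)
      (sym (0≤p⇒∣p∣≡p (p≤q⇒0≤q-p (E n) (E m) (E-mono h))))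
      (p≤q+r⇒p-q≤r (E m) (E n) (≤-trans (p≤p+q (E m) (+-nonNeg (t-nonNeg m) (t-nonNeg m))) (E-tail K≤n h)))

    inv-half : ∀ j → inv j * ½ ≤ inv (suc j)
    inv-half j = *-cancelʳ-≤-pos (fromℕℚ (2 ℕ.+ j)) {{normalize-pos (2 ℕ.+ j) 1}} (begin
      inv j * ½ * fromℕℚ (2 ℕ.+ j)              ≡⟨ cong ((inv j * ½) *_) (fromℕℚ-suc (suc j)) ⟩
      inv j * ½ * (1ℚ + fromℕℚ (suc j))         ≤⟨ *-monoˡ (inv j * ½) (*-nonNeg (inv-nonNeg j) (<⇒≤ 0<½))
                                                     (+-monoˡ-≤ (fromℕℚ (suc j)) 1≤) ⟩
      inv j * ½ * (fromℕℚ (suc j) + fromℕℚ (suc j))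
                                                ≡⟨ solve 3 (λ i h f → i :* h :* (f :+ f) := (f :* i) :* (h :+ h)) refl (inv j) ½ (fromℕℚ (suc j)) ⟩
      fromℕℚ (suc j) * inv j * (½ + ½)          ≡⟨ *-identityʳ _ ⟩
      fromℕℚ (suc j) * inv j                    ≡⟨ fromℕℚ-*-inv j ⟩
      1ℚ                                        ≡⟨ fromℕℚ-*-inv (suc j) ⟨
      fromℕℚ (2 ℕ.+ j) * inv (suc j)            ≡⟨ *-comm (fromℕℚ (2 ℕ.+ j)) (inv (suc j)) ⟩
      inv (suc j) * fromℕℚ (2 ℕ.+ j)            ∎)
      where
      1≤ : 1ℚ ≤ fromℕℚ (suc j)
      1≤ = subst (1ℚ ≤_) (sym (fromℕℚ-suc j)) (p≤p+q 1ℚ (fromℕℚ-nonNeg j))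

    t-decay : ∀ j → t (j ℕ.+ K) ≤ t K * inv j
    t-decay zero    = ≤-reflexive (sym (*-identityʳ (t K)))
    t-decay (suc j) = begin
      t (suc (j ℕ.+ K))    ≤⟨ t-halves (j ℕ.+ K) (ℕ.m≤n+m K j) ⟩
      t (j ℕ.+ K) * ½      ≤⟨ *-monoʳ ½ (<⇒≤ 0<½) (t-decay j) ⟩
      t K * inv j * ½      ≡⟨ *-assoc (t K) (inv j) ½ ⟩
      t K * (inv j * ½)    ≤⟨ *-monoˡ (t K) (t-nonNeg K) (inv-half j) ⟩
      t K * inv (suc j)    ∎

    E-cauchy : IsCauchy E
    E-cauchy = tail⇒cauchy E λ ε 0<ε →
      let (δ , 0<δ , δ+δ≡ε) = halve ε 0<ε
          (N , small) = archimedean-* (t K) δ (t-nonNeg K) 0<δ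
      in N ℕ.+ K , λ m n N+K≤n n≤m →
        let K≤n = ℕ.≤-trans (ℕ.m≤n+m K N) N+K≤n
            t<δ : t n < δ
            t<δ = subst (λ k → t k < δ) (ℕ.m∸n+n≡m K≤n)
                    (≤-<-trans (t-decay (n ℕ.∸ K)) (small (n ℕ.∸ K) (ℕ.m+n≤o⇒m≤o∸n N N+K≤n)))
        in begin-strict
          ∣ E m - E n ∣   ≤⟨ E-tail′ K≤n (ℕ.≤⇒≤′ n≤m) ⟩
          t n + t n       <⟨ +-mono-< t<δ t<δ ⟩
          δ + δ           ≡⟨ δ+δ≡ε ⟩
          ε               ∎

    -- t⁻ k = k · Bᵏ⁻¹ / k!

    t⁻ : ℕ → ℚ
    t⁻ zero    = 0ℚ
    t⁻ (suc k) = t k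

    t⁻-suc : ∀ k → t⁻ k * B ≡ fromℕℚ k * t k
    t⁻-suc zero    = *-zeroˡ B
    t⁻-suc (suc k) = sym (trans
      (solve 4 (λ f t b i → f :* (t :* (b :* i)) := (f :* i) :* (t :* b)) refl (fromℕℚ (suc k)) (t k) B (inv k))
      (trans (cong (_* (t k * B)) (fromℕℚ-*-inv k)) (*-identityˡ (t k * B))))

    expTerm-lip : ∀ {x y} → ∣ x ∣ ≤ B → ∣ y ∣ ≤ B → ∀ k →
                  ∣ expTerm x k - expTerm y k ∣ ≤ ∣ x - y ∣ * t⁻ k
    expTerm-lip {x} {y} x≤B y≤B zero    = ≤-reflexive (sym (*-zeroʳ ∣ x - y ∣))
    expTerm-lip {x} {y} x≤B y≤B (suc k) = begin
      ∣ X * (x * i) - Y * (y * i) ∣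
        ≡⟨ cong ∣_∣ (solve 5 (λ X x i Y y → X :* (x :* i) :- Y :* (y :* i)
              := ((X :- Y) :* x :+ Y :* (x :- y)) :* i) refl X x i Y y) ⟩
      ∣ ((X - Y) * x + Y * (x - y)) * i ∣
        ≡⟨ ∣p*q∣≡∣p∣*∣q∣ ((X - Y) * x + Y * (x - y)) i ⟩
      ∣ (X - Y) * x + Y * (x - y) ∣ * ∣ i ∣
        ≡⟨ cong (∣ (X - Y) * x + Y * (x - y) ∣ *_) (0≤p⇒∣p∣≡p (inv-nonNeg k)) ⟩
      ∣ (X - Y) * x + Y * (x - y) ∣ * i
        ≤⟨ *-monoʳ i (inv-nonNeg k) (∣p+q∣≤∣p∣+∣q∣ ((X - Y) * x) (Y * (x - y))) ⟩
      (∣ (X - Y) * x ∣ + ∣ Y * (x - y) ∣) * i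
        ≡⟨ cong (_* i) (cong₂ _+_ (∣p*q∣≡∣p∣*∣q∣ (X - Y) x) (∣p*q∣≡∣p∣*∣q∣ Y (x - y))) ⟩
      (∣ X - Y ∣ * ∣ x ∣ + ∣ Y ∣ * d) * i
        ≤⟨ *-monoʳ i (inv-nonNeg k) (+-mono-≤
             (*-mono (≤-trans (0≤∣p∣ (X - Y)) IH) (0≤∣p∣ x) IH x≤B)
             (*-monoʳ d (0≤∣p∣ (x - y)) (t-≤ y≤B k))) ⟩
      (d * t⁻ k * B + t k * d) * i
        ≡⟨ solve 5 (λ d u b t i → (d :* u :* b :+ t :* d) :* i := d :* (u :* b :+ t) :* i)
             refl d (t⁻ k) B (t k) i ⟩
      d * (t⁻ k * B + t k) * i
        ≡⟨ cong (λ r → d * (r + t k) * i) (t⁻-suc k) ⟩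
      d * (fromℕℚ k * t k + t k) * i
        ≡⟨ solve 4 (λ d f t i → d :* (f :* t :+ t) :* i := d :* t :* ((con 1ℚ :+ f) :* i))
             refl d (fromℕℚ k) (t k) i ⟩
      d * t k * ((1ℚ + fromℕℚ k) * i)
        ≡⟨ cong (λ r → d * t k * (r * i)) (fromℕℚ-suc k) ⟨
      d * t k * (fromℕℚ (suc k) * i)
        ≡⟨ cong ((d * t k) *_) (fromℕℚ-*-inv k) ⟩
      d * t k * 1ℚ
        ≡⟨ *-identityʳ (d * t k) ⟩
      d * t k ∎
      where
      X = expTerm x k
      Y = expTerm y k
      i = inv k
      d = ∣ x - y ∣
      IH = expTerm-lip x≤B y≤B k

    t⁻-sum : ℕ → ℚ
    t⁻-sum zero    = 0ℚ
    t⁻-sum (suc n) = t⁻-sum n + t⁻ n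

    t⁻-sum-suc : ∀ n → t⁻-sum (suc n) ≡ E n
    t⁻-sum-suc zero    = refl
    t⁻-sum-suc (suc n) = cong (_+ t n) (t⁻-sum-suc n)

    expSum-lip⁻ : ∀ {x y} → ∣ x ∣ ≤ B → ∣ y ∣ ≤ B → ∀ n →
                  ∣ expSum x n - expSum y n ∣ ≤ ∣ x - y ∣ * t⁻-sum n
    expSum-lip⁻ {x} {y} x≤B y≤B zero    = ≤-reflexive (sym (*-zeroʳ ∣ x - y ∣))
    expSum-lip⁻ {x} {y} x≤B y≤B (suc n) = begin
      ∣ (X + a) - (Y + b) ∣           ≡⟨ cong ∣_∣ (solve 4 (λ X a Y b → (X :+ a) :- (Y :+ b) := (X :- Y) :+ (a :- b)) refl X a Y b) ⟩
      ∣ (X - Y) + (a - b) ∣           ≤⟨ ∣p+q∣≤∣p∣+∣q∣ (X - Y) (a - b) ⟩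
      ∣ X - Y ∣ + ∣ a - b ∣           ≤⟨ +-mono-≤ (expSum-lip⁻ x≤B y≤B n) (expTerm-lip x≤B y≤B n) ⟩
      d * t⁻-sum n + d * t⁻ n         ≡⟨ *-distribˡ-+ d (t⁻-sum n) (t⁻ n) ⟨
      d * (t⁻-sum n + t⁻ n)           ∎
      where
      X = expSum x n
      Y = expSum y n
      a = expTerm x n
      b = expTerm y n
      d = ∣ x - y ∣

    expSum-lip : ∀ {x y} → ∣ x ∣ ≤ B → ∣ y ∣ ≤ B → ∀ n →
                 ∣ expSum x n - expSum y n ∣ ≤ ∣ x - y ∣ * E n
    expSum-lip {x} {y} x≤B y≤B n = ≤-trans (expSum-lip⁻ x≤B y≤B n)
      (*-monoˡ ∣ x - y ∣ (0≤∣p∣ (x - y)) (t⁻-sum≤E n))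
      where
      t⁻-sum≤E : ∀ n → t⁻-sum n ≤ E n
      t⁻-sum≤E zero    = ≤-refl
      t⁻-sum≤E (suc n) = subst (_≤ E (suc n)) (sym (t⁻-sum-suc n)) (p≤p+q (E n) (t-nonNeg n))

    expSum-cauchy : ∀ a → IsCauchy a → (∀ n → ∣ a n ∣ ≤ B) →
                    IsCauchy (λ n → expSum (a n) n)
    expSum-cauchy a ca a≤B =
      combine a E (λ n → expSum (a n) n) (1ℚ + D) (+-pos 0<1 0<D) ca E-cauchy λ m n → begin
        ∣ expSum (a m) m - expSum (a n) n ∣
          ≤⟨ ∣-∣-triangle (expSum (a m) m) (expSum (a m) n) (expSum (a n) n) ⟩
        ∣ expSum (a m) m - expSum (a m) n ∣ + ∣ expSum (a m) n - expSum (a n) n ∣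
          ≤⟨ +-mono-≤ (expSum-tail′ (a≤B m) m n) (expSum-lip (a≤B m) (a≤B n) n) ⟩
        ∣ E m - E n ∣ + ∣ a m - a n ∣ * E n
          ≤⟨ +-mono-≤ (left m n) (*-monoˡ ∣ a m - a n ∣ (0≤∣p∣ (a m - a n)) (E≤1+D n)) ⟩
        (1ℚ + D) * ∣ E m - E n ∣ + ∣ a m - a n ∣ * (1ℚ + D)
          ≡⟨ solve 3 (λ p c q → c :* p :+ q :* c := c :* (q :+ p)) refl (∣ E m - E n ∣) (1ℚ + D) (∣ a m - a n ∣) ⟩
        (1ℚ + D) * (∣ a m - a n ∣ + ∣ E m - E n ∣) ∎
      where
      E-bounded = bounded E E-cauchy
      D   = proj₁ E-bounded
      0<D = proj₁ (proj₂ E-bounded)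
      E≤1+D : ∀ n → E n ≤ 1ℚ + D
      E≤1+D n = ≤-trans (p≤∣p∣ (E n))
        (≤-trans (proj₂ (proj₂ E-bounded) n) (p≤q+p D (<⇒≤ 0<1)))
      left : ∀ m n → ∣ E m - E n ∣ ≤ (1ℚ + D) * ∣ E m - E n ∣
      left m n = subst (_≤ (1ℚ + D) * ∣ E m - E n ∣) (*-identityˡ ∣ E m - E n ∣)
        (*-monoʳ ∣ E m - E n ∣ (0≤∣p∣ (E m - E n)) (p≤p+q 1ℚ (<⇒≤ 0<D)))

  exp-cauchy : ∀ a → IsCauchy a → IsCauchy (λ n → expSum (a n) n)
  exp-cauchy a ca =
    let (B , 0<B , a≤B) = bounded a ca
    in ExpBound.expSum-cauchy B (<⇒≤ 0<B) a ca a≤B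

  -- With m = n+1, lnSum N n is the sum of 1/k over m < k ≤ m·N, which is the
  -- right Riemann sum of mesh 1/m for the integral of dt/t from 1 to N.

  harmonic : ℕ → ℚ
  harmonic zero    = 0ℚ
  harmonic (suc k) = harmonic k + inv k

  lnSum : ℕ → ℕ → ℚ
  lnSum N n = harmonic (suc n ℕ.* N) - harmonic (suc n)

  *-inv : ∀ k m → fromℕℚ (suc k) * inv (k ℕ.+ m ℕ.* suc k) ≡ inv m
  *-inv k m = toℚᵘ-injective (begin-equality
    toℚᵘ (fromℕℚ (suc k) * inv l)                ≃⟨ toℚᵘ-homo-* (fromℕℚ (suc k)) (inv l) ⟩
    toℚᵘ (fromℕℚ (suc k)) ℚᵘ.* toℚᵘ (inv l)      ≃⟨ ℚᵘ.*-cong (toℚᵘ-fromℚᵘ (ℚᵘ.mkℚᵘ (+ suc k) 0)) (toℚᵘ-fromℚᵘ (ℚᵘ.mkℚᵘ (+ 1) l)) ⟩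
    ℚᵘ.mkℚᵘ (+ suc k) 0 ℚᵘ.* ℚᵘ.mkℚᵘ (+ 1) l     ≃⟨ ℚᵘ.*≡* lem ⟩
    ℚᵘ.mkℚᵘ (+ 1) m                              ≃⟨ toℚᵘ-fromℚᵘ (ℚᵘ.mkℚᵘ (+ 1) m) ⟨
    toℚᵘ (inv m)                                 ∎)
    where
    open ℚᵘ.≤-Reasoning
    l = k ℕ.+ m ℕ.* suc k
    lem : (+ suc k ℤ.* + 1) ℤ.* + suc m ≡ + 1 ℤ.* + (1 ℕ.* suc l)
    lem = trans (cong (ℤ._* + suc m) (ℤ.*-identityʳ (+ suc k)))
      (sym (trans (ℤ.*-identityˡ _) (trans (cong +_ (trans (ℕ.*-identityˡ (suc l))
        (ℕ.*-comm (suc m) (suc k)))) (ℤ.pos-* (suc k) (suc m)))))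

  harmonic-lower : ∀ a k c → (∀ j → j ℕ.< k ℕ.+ a → c ≤ inv j) →
                   fromℕℚ k * c ≤ harmonic (k ℕ.+ a) - harmonic a
  harmonic-lower a zero    c _   =
    ≤-reflexive (trans (*-zeroˡ c) (sym (+-inverseʳ (harmonic a))))
  harmonic-lower a (suc k) c c≤ = begin
    fromℕℚ (suc k) * c                            ≡⟨ cong (_* c) (fromℕℚ-suc k) ⟩
    (1ℚ + fromℕℚ k) * c                           ≡⟨ solve 2 (λ f i → (con 1ℚ :+ f) :* i := f :* i :+ i) refl (fromℕℚ k) c ⟩
    fromℕℚ k * c + c                              ≤⟨ +-mono-≤ (harmonic-lower a k c (λ j j< → c≤ j (ℕ.m<n⇒m<1+n j<)))
                                                       (c≤ (k ℕ.+ a) (ℕ.n<1+n (k ℕ.+ a))) ⟩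
    harmonic (k ℕ.+ a) - harmonic a + i           ≡⟨ solve 3 (λ p q r → (p :- q) :+ r := p :+ r :- q) refl (harmonic (k ℕ.+ a)) (harmonic a) i ⟩
    harmonic (k ℕ.+ a) + i - harmonic a           ∎
    where
    open ≤-Reasoning
    i = inv (k ℕ.+ a)

  harmonic-upper : ∀ a k → harmonic (k ℕ.+ a) - harmonic a ≤ fromℕℚ k * inv a
  harmonic-upper a zero    = ≤-reflexive (trans (+-inverseʳ (harmonic a)) (sym (*-zeroˡ (inv a))))
  harmonic-upper a (suc k) = begin
    harmonic (k ℕ.+ a) + i - harmonic a           ≡⟨ solve 3 (λ p q r → p :+ r :- q := (p :- q) :+ r) refl (harmonic (k ℕ.+ a)) (harmonic a) i ⟩
    harmonic (k ℕ.+ a) - harmonic a + i           ≤⟨ +-mono-≤ (harmonic-upper a k) (inv-anti (ℕ.m≤n+m a k)) ⟩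
    fromℕℚ k * inv a + inv a                      ≡⟨ solve 2 (λ f i → (con 1ℚ :+ f) :* i := f :* i :+ i) refl (fromℕℚ k) (inv a) ⟨
    (1ℚ + fromℕℚ k) * inv a                       ≡⟨ cong (_* inv a) (fromℕℚ-suc k) ⟨
    fromℕℚ (suc k) * inv a                        ∎
    where
    open ≤-Reasoning
    i = inv (k ℕ.+ a)

  lnSum-step : ∀ N n → lnSum N (suc n) ≡
    lnSum N n + ((harmonic (N ℕ.+ suc n ℕ.* N) - harmonic (suc n ℕ.* N)) - inv (suc n))
  lnSum-step N n =
    solve 4 (λ p q r i → p :- (q :+ i) := (r :- q) :+ ((p :- r) :- i)) refl
      (harmonic (N ℕ.+ suc n ℕ.* N)) (harmonic (suc n)) (harmonic (suc n ℕ.* N)) (inv (suc n))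

  lnSum-mono : ∀ k {n m} → n ℕ.≤′ m → lnSum (suc k) n ≤ lnSum (suc k) m
  lnSum-mono k         ℕ.≤′-refl         = ≤-refl
  lnSum-mono k {n} (ℕ.≤′-step {m} h) = begin
    lnSum N n                         ≤⟨ lnSum-mono k h ⟩
    lnSum N m                         ≤⟨ p≤p+q (lnSum N m) (p≤q⇒0≤q-p (inv (suc m)) δ inv≤) ⟩
    lnSum N m + (δ - inv (suc m))     ≡⟨ lnSum-step N m ⟨
    lnSum N (suc m)                   ∎
    where
    open ≤-Reasoning
    N = suc k
    δ = harmonic (N ℕ.+ suc m ℕ.* N) - harmonic (suc m ℕ.* N)
    inv≤ : inv (suc m) ≤ δ
    inv≤ = subst (_≤ δ) (*-inv k (suc m))
      (harmonic-lower (suc m ℕ.* N) N (inv (k ℕ.+ suc m ℕ.* N)) λ j j< → inv-anti (ℕ.≤-pred j<))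

  lnSum+inv-anti : ∀ k {n m} → n ℕ.≤′ m →
                   lnSum (suc k) m + inv m ≤ lnSum (suc k) n + inv n
  lnSum+inv-anti k     ℕ.≤′-refl         = ≤-refl
  lnSum+inv-anti k {n} (ℕ.≤′-step {m} h) = begin
    lnSum N (suc m) + inv (suc m)                     ≡⟨ cong (_+ inv (suc m)) (lnSum-step N m) ⟩
    lnSum N m + (δ - inv (suc m)) + inv (suc m)       ≡⟨ solve 3 (λ l d i → l :+ (d :- i) :+ i := l :+ d) refl (lnSum N m) δ (inv (suc m)) ⟩
    lnSum N m + δ                                     ≤⟨ +-monoʳ-≤ (lnSum N m) δ≤ ⟩
    lnSum N m + inv m                                 ≤⟨ lnSum+inv-anti k h ⟩
    lnSum N n + inv n                                 ∎
    where
    open ≤-Reasoning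
    N = suc k
    δ = harmonic (N ℕ.+ suc m ℕ.* N) - harmonic (suc m ℕ.* N)
    δ≤ : δ ≤ inv m
    δ≤ = begin
      δ                                       ≤⟨ harmonic-upper (suc m ℕ.* N) N ⟩
      fromℕℚ N * inv (suc m ℕ.* N)            ≤⟨ *-monoˡ (fromℕℚ N) (fromℕℚ-nonNeg N) (inv-anti (ℕ.n≤1+n (k ℕ.+ m ℕ.* N))) ⟩
      fromℕℚ N * inv (k ℕ.+ m ℕ.* N)          ≡⟨ *-inv k m ⟩
      inv m                                   ∎

  lnSum-cauchy : ∀ N .{{_ : ℕ.NonZero N}} → IsCauchy (lnSum N)
  lnSum-cauchy (suc k) = tail⇒cauchy (lnSum N) λ ε 0<ε →
    let (M , inv<ε) = archimedean ε 0<ε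
    in M , λ m n M≤n n≤m → begin-strict
      ∣ lnSum N m - lnSum N n ∣   ≡⟨ 0≤p⇒∣p∣≡p (p≤q⇒0≤q-p (lnSum N n) (lnSum N m) (lnSum-mono k (ℕ.≤⇒≤′ n≤m))) ⟩
      lnSum N m - lnSum N n       ≤⟨ p≤q+r⇒p-q≤r (lnSum N m) (lnSum N n) (≤-trans (p≤p+q (lnSum N m) (inv-nonNeg m)) (lnSum+inv-anti k (ℕ.≤⇒≤′ n≤m))) ⟩
      inv n                       ≤⟨ inv-anti M≤n ⟩
      inv M                       <⟨ inv<ε ⟩
      ε                           ∎
    where
    open ≤-Reasoning
    N = suc k

  ½≤lnSum2 : ∀ n → ½ ≤ lnSum 2 n
  ½≤lnSum2 n = lnSum-mono 1 (ℕ.≤⇒≤′ (ℕ.z≤n {n}))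

open Cauchy public using (IsCauchy; expTerm; expSum; harmonic; lnSum; recip⊔)

-- Cauchy sequences of rationals with their moduli of convergence; equality of
-- reals is the relation _≈_ below, not _≡_.

record ℝ : Set where
  constructor mkℝ
  field
    seq    : ℕ → ℚ
    cauchy : IsCauchy seq

open ℝ public

infix  4 _≈_ _<_
infixl 6 _+_ _-_
infixl 7 _*_ _÷_[_]
infix  8 -_
infixr 8 _^_

_≈_ : ℝ → ℝ → Set
x ≈ y = ∀ ε → 0ℚ ℚ.< ε →
  ∃[ N ] (∀ n → N ℕ.≤ n → ℚ.∣ seq x n ℚ.- seq y n ∣ ℚ.< ε)

_<_ : ℝ → ℝ → Set
x < y = ∃[ ε ] (0ℚ ℚ.< ε × ∃[ N ] (∀ n → N ℕ.≤ n → seq x n ℚ.+ ε ℚ.≤ seq y n))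

≈-refl : ∀ {x} → x ≈ x
≈-refl {x} ε 0<ε = 0 , λ n _ →
  subst (λ t → ℚ.∣ t ∣ ℚ.< ε) (sym (ℚ.+-inverseʳ (seq x n))) 0<ε

≈-sym : ∀ {x y} → x ≈ y → y ≈ x
≈-sym {x} {y} x≈y ε 0<ε with x≈y ε 0<ε
... | N , close = N , λ n N≤n →
  subst (ℚ._< ε) (Cauchy.∣-∣-comm (seq x n) (seq y n)) (close n N≤n)

≈-trans : ∀ {x y z} → x ≈ y → y ≈ z → x ≈ z
≈-trans {x} {y} {z} x≈y y≈z ε 0<ε with Cauchy.halve ε 0<ε
... | δ , 0<δ , δ+δ≡ε with x≈y δ 0<δ | y≈z δ 0<δ
... | M , closeM | N , closeN = M ℕ.⊔ N , λ n ≤n →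
  ℚ.≤-<-trans (Cauchy.∣-∣-triangle (seq x n) (seq y n) (seq z n))
    (subst (_ ℚ.<_) δ+δ≡ε (ℚ.+-mono-<
      (closeM n (ℕ.m⊔n≤o⇒m≤o M N ≤n)) (closeN n (ℕ.m⊔n≤o⇒n≤o M N ≤n))))

ℝ-setoid : Setoid 0ℓ 0ℓ
ℝ-setoid = record
  { Carrier       = ℝ
  ; _≈_           = _≈_
  ; isEquivalence = record
    { refl  = λ {x} → ≈-refl {x}
    ; sym   = λ {x} {y} → ≈-sym {x} {y}
    ; trans = λ {x} {y} {z} → ≈-trans {x} {y} {z}
    }
  }

fromℚ : ℚ → ℝ
fromℚ p = mkℝ (λ _ → p) (Cauchy.const-cauchy p)

fromℕ : ℕ → ℝ
fromℕ n = fromℚ (+ n ℚ./ 1)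

0ℝ 1ℝ : ℝ
0ℝ = fromℕ 0
1ℝ = fromℕ 1

_+_ : ℝ → ℝ → ℝ
x + y = mkℝ (λ n → seq x n ℚ.+ seq y n) (Cauchy.+-cauchy (seq x) (seq y) (cauchy x) (cauchy y))

-_ : ℝ → ℝ
- x = mkℝ (λ n → ℚ.- seq x n) (Cauchy.neg-cauchy (seq x) (cauchy x))

_-_ : ℝ → ℝ → ℝ
x - y = x + (- y)

_*_ : ℝ → ℝ → ℝ
x * y = mkℝ (λ n → seq x n ℚ.* seq y n) (Cauchy.*-cauchy (seq x) (seq y) (cauchy x) (cauchy y))

∣_∣ : ℝ → ℝ
∣ x ∣ = mkℝ (λ n → ℚ.∣ seq x n ∣) (Cauchy.abs-cauchy (seq x) (cauchy x))

recip : ∀ x → 0ℝ < x → ℝ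
recip x (c , 0<c , _) =
  mkℝ (λ n → recip⊔ c 0<c (seq x n)) (Cauchy.recip⊔-cauchy c 0<c (seq x) (cauchy x))

_÷_[_] : ∀ (x y : ℝ) → 0ℝ < y → ℝ
x ÷ y [ 0<y ] = x * recip y 0<y

-- The n-th approximation of exp x is the partial sum with n terms of the
-- exponential series at the n-th approximation of x.

exp : ℝ → ℝ
exp x = mkℝ (λ n → expSum (seq x n) n) (Cauchy.exp-cauchy (seq x) (cauchy x))

-- The integral of dt/t from 1 to N.

ln : ∀ N → .{{ℕ.NonZero N}} → ℝ
ln N = mkℝ (lnSum N) (Cauchy.lnSum-cauchy N)

0<ln2 : 0ℝ < ln 2
0<ln2 = ℚ.½ , Cauchy.0<½ , 0 , λ n _ →
  subst (ℚ._≤ lnSum 2 n) (sym (ℚ.+-identityˡ ℚ.½)) (Cauchy.½≤lnSum2 n)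

log₂ : ∀ N → .{{ℕ.NonZero N}} → ℝ
log₂ N = ln N ÷ ln 2 [ 0<ln2 ]

_^_ : ∀ b → .{{ℕ.NonZero b}} → ℝ → ℝ
b ^ x = exp (x * ln b)

Continuous : (ℝ → ℝ) → Set
Continuous f = ∀ x ε → 0ℝ < ε →
  ∃[ δ ] (0ℝ < δ × ∀ y → ∣ y - x ∣ < δ → ∣ f y - f x ∣ < ε)

Periodic : (ℝ → ℝ) → ℝ → Set
Periodic f p = ∀ x → f (x + p) ≈ f x

{-# OPTIONS --safe #-}

-- Split the admissible subwords of w (those in rep₂(ℕ)) into the empty word, those
-- ending in 0 and those ending in 1.  Appending a letter c to w replaces the class of
-- c by {vc : v admissible in w} (without the word 0) and leaves the other class alone,
-- so w0 and w1 together have three times as many admissible subwords as w.  Hence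
-- A(N) = s(0) + ... + s(N) satisfies A(2N) = 3 A(N), and also s(n) ≤ n.  It follows
-- that A(⌊2ⁿ y⌋) / 3ⁿ converges, locally uniformly in y, to a continuous F with
-- F(2y) = 3 F(y) and F(N) = A(N), and 𝓗(x) = F(2ˣ) 3⁻ˣ.

module Submission where

-- Each approximation A(⌊2ⁿ p⌋) / 3ⁿ is a discontinuous step function of the rational `p`; only the
-- whole family defines a function of Cauchy reals. `Regular` captures this by one estimate in two
-- indices and two arguments, from which the Cauchy property, compatibility with `_≈_` and
-- continuity all follow. For `limit` it rests on two facts: the value A(c) / 3ⁿ at a dyadic point c
-- / 2ⁿ is unchanged at every finer level, and on a bounded range the values at neighbouring dyadic
-- points of level `n` differ by O((2/3)ⁿ), since the terms added to A are O(2ⁿ).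
--
-- `exp` is a series cut off at the index of the approximation, and `ln` a difference of harmonic
-- sums. So exp (x + y) = exp x · exp y and exp (ln N) = N have to come from inequalities between
-- finite sums of rationals: the former compares a square of products with triangles, the latter
-- telescopes 1 + h ≤ exp h ≤ 1 / (1 - h) along the harmonic sum.

module Counting where

  open import Defs using (Word; _≟ʷ_; digits; rep₂; IsRep₂; isRep₂?; subwords; binom; s)
  open import Data.Digit using (Bit)
  open import Data.Fin.Base using (toℕ)
  open import Data.Fin.Patterns using (0F; 1F)
  open import Data.Fin.Properties using (toℕ-injective; toℕ-fromℕ<; toℕ<n)
  open import Data.List.Base
    using (List; []; _∷_; [_]; _∷ʳ_; _++_; map; filter; length; deduplicate; upTo)
  open import Data.List.Properties
    using (∷ʳ-injective; ∷ʳ-injectiveˡ; ∷ʳ-injectiveʳ; length-++; length-map; map-++; upTo-∷ʳ)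
  open import Data.List.Reverse using (reverseView; Reverse; _∶_∶ʳ_)
  open import Data.List.Membership.Propositional using (_∈_)
  open import Data.List.Membership.Propositional.Properties
  open import Data.List.Membership.Propositional.Properties.WithK using (unique∧set⇒bag)
  open import Data.List.Relation.Binary.BagAndSetEquality using (∼bag⇒↭)
  open import Data.List.Relation.Binary.Permutation.Propositional.Properties using (↭-length)
  open import Data.List.Relation.Unary.All using ([])
  open import Data.List.Relation.Unary.Any using (here; there)
  open import Data.List.Relation.Unary.AllPairs using ([]; _∷_)
  open import Data.List.Relation.Unary.Unique.Propositional using (Unique)
  open import Data.List.Relation.Unary.Unique.DecPropositional.Properties _≟ʷ_ using (deduplicate-!)
  open import Data.List.Relation.Unary.Unique.Propositional.Properties using (map⁺; ++⁺)
  open import Data.Nat.Base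
  open import Data.Nat.DivMod using (_mod_; _/_; _%_; m%n<n; m≡m%n+[m/n]*n; m/n<m; [m+kn]%n≡m%n; m<n⇒m%n≡m)
  open import Data.Nat.Induction using (Acc; acc; <-wellFounded; <-rec)
  open import Data.Nat.ListAction using (sum)
  open import Data.Nat.ListAction.Properties using (sum-++)
  open import Data.Nat.Properties
  open import Data.Nat.Tactic.RingSolver using (solve-∀)
  open import Data.Product.Base using (∃-syntax; _×_; _,_; proj₁; proj₂)
  open import Data.Sum.Base using (_⊎_; inj₁; inj₂)
  open import Function.Base using (_∘_)
  open import Function.Bundles using (mk⇔)
  open import Relation.Nullary.Decidable using (_×-dec_)
  open import Relation.Nullary.Negation using (¬_; contradiction)
  open import Relation.Unary using (Pred; _∪_)
  open import Level using (0ℓ)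
  open import Relation.Binary.PropositionalEquality
    using (_≡_; _≢_; refl; sym; trans; cong; cong₂; subst; module ≡-Reasoning)

  -- Cardinalities through repetition-free enumerations

  HasSize : ∀ {A : Set} → Pred A 0ℓ → ℕ → Set
  HasSize P n = ∃[ xs ] (Unique xs × length xs ≡ n × (∀ {x} → (x ∈ xs → P x) × (P x → x ∈ xs)))

  size-unique : ∀ {A : Set} {P : Pred A 0ℓ} {m n} → HasSize P m → HasSize P n → m ≡ n
  size-unique (xs , xs! , refl , ∈xs) (ys , ys! , refl , ∈ys) = ↭-length
    (∼bag⇒↭ (unique∧set⇒bag xs! ys! (mk⇔ (proj₂ ∈ys ∘ proj₁ ∈xs) (proj₂ ∈xs ∘ proj₁ ∈ys))))

  size-resp : ∀ {A : Set} {P Q : Pred A 0ℓ} {n} → (∀ {x} → P x → Q x) → (∀ {x} → Q x → P x) →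
              HasSize P n → HasSize Q n
  size-resp P⊆Q Q⊆P (xs , xs! , len , ∈xs) = xs , xs! , len , P⊆Q ∘ proj₁ ∈xs , proj₂ ∈xs ∘ Q⊆P

  size-≡ : ∀ {A : Set} (a : A) → HasSize (_≡ a) 1
  size-≡ a = [ a ] , [] ∷ [] , refl , (λ { (here eq) → eq }) , here

  size-∪ : ∀ {A : Set} {P Q : Pred A 0ℓ} {m n} → (∀ {x} → P x → ¬ Q x) →
           HasSize P m → HasSize Q n → HasSize (P ∪ Q) (m + n)
  size-∪ P∩Q≡∅ (xs , xs! , refl , ∈xs) (ys , ys! , refl , ∈ys) =
    xs ++ ys , ++⁺ xs! ys! (λ (∈₁ , ∈₂) → P∩Q≡∅ (proj₁ ∈xs ∈₁) (proj₁ ∈ys ∈₂)) , length-++ xs , to , from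
    where
    to : ∀ {x} → x ∈ xs ++ ys → _ ⊎ _
    to x∈ with ∈-++⁻ xs x∈
    ... | inj₁ x∈xs = inj₁ (proj₁ ∈xs x∈xs)
    ... | inj₂ x∈ys = inj₂ (proj₁ ∈ys x∈ys)
    from : ∀ {x} → _ ⊎ _ → x ∈ xs ++ ys
    from (inj₁ Px) = ∈-++⁺ˡ (proj₂ ∈xs Px)
    from (inj₂ Qx) = ∈-++⁺ʳ xs (proj₂ ∈ys Qx)

  size-image : ∀ {A B : Set} {P : Pred A 0ℓ} {n} (f : A → B) → (∀ {x y} → f x ≡ f y → x ≡ y) →
               HasSize P n → HasSize (λ y → ∃[ x ] (P x × y ≡ f x)) n
  size-image f f-inj (xs , xs! , len , ∈xs) =
    map f xs , map⁺ f-inj xs! , trans (length-map f xs) len , to , λ { (x , Px , refl) → ∈-map⁺ f (proj₂ ∈xs Px) }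
    where
    to : ∀ {y} → y ∈ map f xs → _
    to y∈ = let (x , x∈ , eq) = ∈-map⁻ f y∈ in x , proj₁ ∈xs x∈ , eq

  -- `subwords` recurses on the first letter, whereas binary expansions grow at the last one. This
  -- lemma and the next few restate membership in terms of the last letter.
  ∈-subwords-∷ʳ⁻ : ∀ w {c v} → v ∈ subwords (w ∷ʳ c) →
                   v ∈ subwords w ⊎ ∃[ u ] (u ∈ subwords w × v ≡ u ∷ʳ c)
  ∈-subwords-∷ʳ⁻ [] {c} (here refl) = inj₂ ([] , here refl , refl)
  ∈-subwords-∷ʳ⁻ [] {c} (there v∈) = inj₁ v∈
  ∈-subwords-∷ʳ⁻ (a ∷ w) {c} v∈ with ∈-++⁻ (map (a ∷_) (subwords (w ∷ʳ c))) v∈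
  ... | inj₁ v∈′ with ∈-map⁻ (a ∷_) v∈′
  ...   | v′ , v′∈ , refl with ∈-subwords-∷ʳ⁻ w v′∈
  ...     | inj₁ v′∈w               = inj₁ (∈-++⁺ˡ (∈-map⁺ (a ∷_) v′∈w))
  ...     | inj₂ (u , u∈w , refl)   = inj₂ (a ∷ u , ∈-++⁺ˡ (∈-map⁺ (a ∷_) u∈w) , refl)
  ∈-subwords-∷ʳ⁻ (a ∷ w) {c} v∈ | inj₂ v∈′ with ∈-subwords-∷ʳ⁻ w v∈′
  ... | inj₁ v∈w               = inj₁ (∈-++⁺ʳ _ v∈w)
  ... | inj₂ (u , u∈w , refl)  = inj₂ (u , ∈-++⁺ʳ (map (a ∷_) (subwords w)) u∈w , refl)

  []∈subwords : ∀ w → [] ∈ subwords w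
  []∈subwords []      = here refl
  []∈subwords (a ∷ w) = ∈-++⁺ʳ (map (a ∷_) (subwords w)) ([]∈subwords w)

  ∈-subwords-∷ʳ⁺ : ∀ w {c v} → v ∈ subwords w → v ∷ʳ c ∈ subwords (w ∷ʳ c)
  ∈-subwords-∷ʳ⁺ []      (here refl) = here refl
  ∈-subwords-∷ʳ⁺ (a ∷ w) v∈ with ∈-++⁻ (map (a ∷_) (subwords w)) v∈
  ... | inj₂ v∈w = ∈-++⁺ʳ _ (∈-subwords-∷ʳ⁺ w v∈w)
  ... | inj₁ v∈′ with ∈-map⁻ (a ∷_) v∈′
  ...   | v′ , v′∈w , refl = ∈-++⁺ˡ (∈-map⁺ (a ∷_) (∈-subwords-∷ʳ⁺ w v′∈w))

  ∈-subwords-weaken : ∀ w {c v} → v ∈ subwords w → v ∈ subwords (w ∷ʳ c)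
  ∈-subwords-weaken []  {c} (here refl) = []∈subwords [ c ]
  ∈-subwords-weaken (a ∷ w) v∈ with ∈-++⁻ (map (a ∷_) (subwords w)) v∈
  ... | inj₂ v∈w = ∈-++⁺ʳ _ (∈-subwords-weaken w v∈w)
  ... | inj₁ v∈′ with ∈-map⁻ (a ∷_) v∈′
  ...   | v′ , v′∈w , refl = ∈-++⁺ˡ (∈-map⁺ (a ∷_) (∈-subwords-weaken w v′∈w))

  ∈-subwords-init : ∀ w {c v} → v ∷ʳ c ∈ subwords w → v ∈ subwords w
  ∈-subwords-init [] {v = []}    (here ())
  ∈-subwords-init [] {v = _ ∷ _} (here ())
  ∈-subwords-init (a ∷ w) {v = []} v∈ = []∈subwords (a ∷ w)
  ∈-subwords-init (a ∷ w) {v = b ∷ v} v∈ with ∈-++⁻ (map (a ∷_) (subwords w)) v∈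
  ... | inj₂ v∈w = ∈-++⁺ʳ _ (∈-subwords-init w v∈w)
  ... | inj₁ v∈′ with ∈-map⁻ (a ∷_) v∈′
  ...   | _ , v′∈w , refl = ∈-++⁺ˡ (∈-map⁺ (a ∷_) (∈-subwords-init w v′∈w))

  -- Binary expansions under appending a digit

  digits-irrelevant : ∀ n (p q : Acc _<_ n) → digits n p ≡ digits n q
  digits-irrelevant zero      _        _        = refl
  digits-irrelevant n@(suc _) (acc p) (acc q) =
    cong (_∷ʳ (n mod 2)) (digits-irrelevant (n / 2) (p _) (q _))

  -- The recursive call inside `digits` carries an accessibility proof other than the one chosen by
  -- `rep₂`; irrelevance of that proof identifies the two.
  rep₂-suc : ∀ n → rep₂ (suc n) ≡ rep₂ (suc n / 2) ∷ʳ (suc n mod 2)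
  rep₂-suc n with <-wellFounded (suc n)
  ... | acc rs = cong (_∷ʳ (suc n mod 2)) (digits-irrelevant (suc n / 2) _ _)

  divMod₂-unique : ∀ {m n} {c d : Bit} → toℕ c + m * 2 ≡ toℕ d + n * 2 → m ≡ n × c ≡ d
  divMod₂-unique {m} {n} {c} {d} eq = m≡n , toℕ-injective c≡d
    where
    c≡d : toℕ c ≡ toℕ d
    c≡d = begin
      toℕ c                   ≡⟨ m<n⇒m%n≡m (toℕ<n c) ⟨
      toℕ c % 2               ≡⟨ [m+kn]%n≡m%n (toℕ c) m 2 ⟨
      (toℕ c + m * 2) % 2     ≡⟨ cong (_% 2) eq ⟩
      (toℕ d + n * 2) % 2     ≡⟨ [m+kn]%n≡m%n (toℕ d) n 2 ⟩
      toℕ d % 2               ≡⟨ m<n⇒m%n≡m (toℕ<n d) ⟩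
      toℕ d                   ∎
      where open ≡-Reasoning
    m≡n : m ≡ n
    m≡n = *-cancelʳ-≡ m n 2 (+-cancelˡ-≡ (toℕ d) (m * 2) (n * 2)
      (trans (cong (_+ m * 2) (sym c≡d)) eq))

  suc≡mod₂+/₂ : ∀ n → suc n ≡ toℕ (suc n mod 2) + suc n / 2 * 2
  suc≡mod₂+/₂ n = trans (m≡m%n+[m/n]*n (suc n) 2)
    (cong (_+ suc n / 2 * 2) (sym (toℕ-fromℕ< (m%n<n (suc n) 2))))

  rep₂-∷ʳ : ∀ {n} m c → suc n ≡ toℕ c + m * 2 → rep₂ (suc n) ≡ rep₂ m ∷ʳ c
  rep₂-∷ʳ {n} m c eq with divMod₂-unique {suc n / 2} {m} {suc n mod 2} {c} (trans (sym (suc≡mod₂+/₂ n)) eq)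
  ... | q≡m , r≡c = trans (rep₂-suc n) (cong₂ (λ a b → rep₂ a ∷ʳ b) q≡m r≡c)

  ∷ʳ≢[] : ∀ {A : Set} (xs : List A) {x} → xs ∷ʳ x ≢ []
  ∷ʳ≢[] []      ()
  ∷ʳ≢[] (_ ∷ _) ()

  rep₂≡[]⇒≡0 : ∀ n → rep₂ n ≡ [] → n ≡ 0
  rep₂≡[]⇒≡0 zero    _  = refl
  rep₂≡[]⇒≡0 (suc n) eq with () ← ∷ʳ≢[] (rep₂ (suc n / 2)) (trans (sym (rep₂-suc n)) eq)
  IsRep₂-init : ∀ {v c} → IsRep₂ (v ∷ʳ c) → IsRep₂ v
  IsRep₂-init {[]}    (zero , ())
  IsRep₂-init {_ ∷ _} (zero , ())
  IsRep₂-init {v} (suc n , eq) =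
    suc n / 2 , ∷ʳ-injectiveˡ _ v (trans (sym (rep₂-suc n)) eq)

  ¬IsRep₂-0 : ¬ IsRep₂ (0F ∷ [])
  ¬IsRep₂-0 (suc n , eq) with ∷ʳ-injective (rep₂ (suc n / 2)) [] (trans (sym (rep₂-suc n)) eq)
  ... | rep≡[] , mod≡0 with () ← trans (suc≡mod₂+/₂ n)
      (cong₂ (λ a b → toℕ a + b * 2) mod≡0 (rep₂≡[]⇒≡0 (suc n / 2) rep≡[]))

  IsRep₂-∷ʳ1 : ∀ {v} → IsRep₂ v → IsRep₂ (v ∷ʳ 1F)
  IsRep₂-∷ʳ1 (m , refl) = suc (m * 2) , rep₂-∷ʳ m 1F refl

  IsRep₂-∷ʳ0 : ∀ {v} → IsRep₂ v → v ≢ [] → IsRep₂ (v ∷ʳ 0F)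
  IsRep₂-∷ʳ0 (zero  , refl) v≢[] = contradiction refl v≢[]
  IsRep₂-∷ʳ0 (suc m , refl) _    = suc m * 2 , rep₂-∷ʳ (suc m) 0F refl

  -- Admissible subwords counted by last letter

  Admissible : Word → Pred Word 0ℓ
  Admissible w v = v ∈ subwords w × IsRep₂ v

  -- Words are recorded without their last letter. Appending `c` to `w` then turns this predicate
  -- into `Admissible w` itself for the letter 1, and into its nonempty part for the letter 0.
  Ending : Bit → Word → Pred Word 0ℓ
  Ending c w u = Admissible w (u ∷ʳ c)

  Ending-≢ : ∀ {c d w} → c ≢ d → ∀ {u} → Ending c (w ∷ʳ d) u → Ending c w u
  Ending-≢ {w = w} c≢d {u} (u∈ , r) with ∈-subwords-∷ʳ⁻ w u∈
  ... | inj₁ u∈w            = u∈w , r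
  ... | inj₂ (u′ , _ , eq)  = contradiction (∷ʳ-injectiveʳ u u′ eq) c≢d

  Ending-weaken : ∀ {c d w u} → Ending c w u → Ending c (w ∷ʳ d) u
  Ending-weaken {w = w} (u∈ , r) = ∈-subwords-weaken w u∈ , r

  -- Whether `u ∷ʳ c` was already a subword of `w` or uses the new letter, its prefix lies in `w`;
  -- so old and new words ending in `c` are counted together, without overlap.
  Ending-≡ : ∀ {c} w {u} → u ∷ʳ c ∈ subwords (w ∷ʳ c) → u ∈ subwords w
  Ending-≡ w {u} u∈ with ∈-subwords-∷ʳ⁻ w u∈
  ... | inj₁ u∈w = ∈-subwords-init w u∈w
  ... | inj₂ (u′ , u′∈w , eq) with refl ← ∷ʳ-injectiveˡ u u′ eq = u′∈w

  EndsIn : Word → Pred Word 0ℓ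
  EndsIn w v = (∃[ u ] (Ending 0F w u × v ≡ u ∷ʳ 0F)) ⊎ (∃[ u ] (Ending 1F w u × v ≡ u ∷ʳ 1F))

  EndsIn⇒Admissible : ∀ {w v} → EndsIn w v → Admissible w v
  EndsIn⇒Admissible (inj₁ (_ , e , refl)) = e
  EndsIn⇒Admissible (inj₂ (_ , e , refl)) = e

  EndsIn⇒≢[] : ∀ {w v} → EndsIn w v → v ≢ []
  EndsIn⇒≢[] (inj₁ (u , _ , refl)) = ∷ʳ≢[] u
  EndsIn⇒≢[] (inj₂ (u , _ , refl)) = ∷ʳ≢[] u

  Admissible⇒EndsIn : ∀ {w v} → Admissible w v → v ≡ [] ⊎ EndsIn w v
  Admissible⇒EndsIn {w} {v} a with reverseView v
  ... | Reverse.[]      = inj₁ refl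
  ... | u ∶ _ ∶ʳ 0F     = inj₂ (inj₁ (u , a , refl))
  ... | u ∶ _ ∶ʳ 1F     = inj₂ (inj₂ (u , a , refl))

  Sizes : Word → ℕ → ℕ → Set
  Sizes w a b = HasSize (Ending 0F w) a × HasSize (Ending 1F w) b

  size-EndsIn : ∀ {w a b} → Sizes w a b → HasSize (EndsIn w) (a + b)
  size-EndsIn (h₀ , h₁) = size-∪
    (λ { (u , _ , refl) (u′ , _ , eq) → 0≢1 (∷ʳ-injectiveʳ u u′ eq) })
    (size-image (_∷ʳ 0F) (∷ʳ-injectiveˡ _ _) h₀)
    (size-image (_∷ʳ 1F) (∷ʳ-injectiveˡ _ _) h₁)
    where
    0≢1 : _≢_ {A = Bit} 0F 1F
    0≢1 ()

  size-Admissible : ∀ {w a b} → Sizes w a b → HasSize (Admissible w) (1 + (a + b))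
  size-Admissible {w} h = size-resp to (Admissible⇒EndsIn {w})
    (size-∪ (λ v≡[] e → EndsIn⇒≢[] {w} e v≡[]) (size-≡ []) (size-EndsIn {w} h))
    where
    to : ∀ {v} → v ≡ [] ⊎ EndsIn w v → Admissible w v
    to (inj₁ refl) = []∈subwords w , 0 , refl
    to (inj₂ e)    = EndsIn⇒Admissible {w} e

  Sizes-∷ʳ1 : ∀ {w a b} → Sizes w a b → Sizes (w ∷ʳ 1F) a (1 + (a + b))
  Sizes-∷ʳ1 {w} h@(h₀ , h₁) =
    size-resp (Ending-weaken {w = w}) (Ending-≢ {w = w} λ ()) h₀ ,
    size-resp (λ (v∈ , r) → ∈-subwords-∷ʳ⁺ w v∈ , IsRep₂-∷ʳ1 r)
              (λ {u} (u∈ , r) → Ending-≡ w u∈ , IsRep₂-init {u} r)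
              (size-Admissible {w} h)

  -- In contrast to the letter 1, the empty prefix drops out: the word 0 is no binary expansion,
  -- while every nonempty expansion remains one when 0 is appended.
  Sizes-∷ʳ0 : ∀ {w a b} → Sizes w a b → Sizes (w ∷ʳ 0F) (a + b) b
  Sizes-∷ʳ0 {w} h@(h₀ , h₁) =
    size-resp to from (size-EndsIn {w} h) ,
    size-resp (Ending-weaken {w = w}) (Ending-≢ {w = w} λ ()) h₁
    where
    to : ∀ {v} → EndsIn w v → Ending 0F (w ∷ʳ 0F) v
    to e with EndsIn⇒Admissible {w} e
    ... | v∈ , r = ∈-subwords-∷ʳ⁺ w v∈ , IsRep₂-∷ʳ0 r (EndsIn⇒≢[] {w} e)
    from : ∀ {v} → Ending 0F (w ∷ʳ 0F) v → EndsIn w v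
    from {v} (v∈ , r) with Admissible⇒EndsIn {w} (Ending-≡ w v∈ , IsRep₂-init {v} r)
    ... | inj₂ e    = e
    ... | inj₁ refl = contradiction r ¬IsRep₂-0

  Sizes-[] : Sizes [] 0 0
  Sizes-[] = none , none
    where
    absurd : ∀ {c v} → ¬ Ending c [] v
    absurd {v = []}    (here () , _)
    absurd {v = _ ∷ _} (here () , _)
    none : ∀ {c} → HasSize (Ending c []) 0
    none = [] , [] , refl , (λ ()) , λ e → contradiction e absurd

  0<binom : ∀ {w v} → v ∈ subwords w → 0 < binom w v
  0<binom {w} {v} v∈ with filter (_≟ʷ v) (subwords w) | ∈-filter⁺ (_≟ʷ v) v∈ refl
  ... | _ ∷ _ | _ = z<s

  -- Positivity of `binom` is automatic for the words listed by `subwords`, so the filter in `s`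
  -- keeps exactly the admissible ones.
  size-s : ∀ n → HasSize (Admissible (rep₂ n)) (s (suc n))
  size-s n = deduplicate _≟ʷ_ (filter P? (subwords w)) , deduplicate-! _ , refl , to , from
    where
    w  = rep₂ n
    P? = λ v → isRep₂? v ×-dec (0 <? binom w v)
    to : ∀ {v} → v ∈ deduplicate _≟ʷ_ (filter P? (subwords w)) → Admissible w v
    to v∈ with ∈-filter⁻ P? {xs = subwords w} (∈-deduplicate⁻ _≟ʷ_ (filter P? (subwords w)) v∈)
    ... | v∈w , r , _ = v∈w , r
    from : ∀ {v} → Admissible w v → v ∈ deduplicate _≟ʷ_ (filter P? (subwords w))
    from (v∈ , r) = ∈-deduplicate⁺ _≟ʷ_ (∈-filter⁺ P? v∈ (r , 0<binom {w} v∈))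

  s-Sizes : ∀ n {a b} → Sizes (rep₂ n) a b → s (suc n) ≡ 1 + (a + b)
  s-Sizes n h = size-unique (size-s n) (size-Admissible {rep₂ n} h)

  -- The bound serves twice: it yields `s (suc n) ≤ suc n`, and at `n = 0` it forces both counts to
  -- be 0.
  SmallSizes : ℕ → Set
  SmallSizes n = ∃[ a ] ∃[ b ] (Sizes (rep₂ n) a b × a + b ≤ n)

  Sizes-2n : ∀ n {a b} → Sizes (rep₂ n) a b → a + b ≤ n → Sizes (rep₂ (n * 2)) (a + b) b
  -- Doubling 0 appends no letter, since `rep₂ 0` is empty; the counts 0 and 0 left by the bound are
  -- fixed by (a, b) ↦ (a + b, b).
  Sizes-2n zero    {zero} {zero} h _ = h
  Sizes-2n (suc n) h _ = subst (λ w → Sizes w _ _) (sym (rep₂-∷ʳ (suc n) 0F refl)) (Sizes-∷ʳ0 {rep₂ (suc n)} h)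

  Sizes-2n+1 : ∀ n {a b} → Sizes (rep₂ n) a b → Sizes (rep₂ (1 + n * 2)) a (1 + (a + b))
  Sizes-2n+1 n h = subst (λ w → Sizes w _ _) (sym (rep₂-∷ʳ n 1F refl)) (Sizes-∷ʳ1 {rep₂ n} h)

  smallSizes : ∀ n → SmallSizes n
  smallSizes = <-rec SmallSizes step
    where
    n+n≡n*2 : ∀ n → n + n ≡ n * 2
    n+n≡n*2 = solve-∀
    bound₀ : ∀ {a b n} → a + b ≤ n → (a + b) + b ≤ n * 2
    bound₀ {a} {b} {n} h = begin
      (a + b) + b   ≤⟨ +-mono-≤ h (≤-trans (m≤n+m b a) h) ⟩
      n + n         ≡⟨ n+n≡n*2 n ⟩
      n * 2         ∎
      where open ≤-Reasoning
    bound₁ : ∀ {a b n} → a + b ≤ n → a + (1 + (a + b)) ≤ 1 + n * 2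
    bound₁ {a} {b} {n} h = begin
      a + (1 + (a + b))   ≤⟨ +-mono-≤ (≤-trans (m≤m+n a b) h) (s≤s h) ⟩
      n + suc n           ≡⟨ +-suc n n ⟩
      1 + (n + n)         ≡⟨ cong suc (n+n≡n*2 n) ⟩
      1 + n * 2           ∎
      where open ≤-Reasoning
    extend : ∀ {n m} (c : Bit) → n ≡ toℕ c + m * 2 → SmallSizes m → SmallSizes n
    extend {m = m} 0F refl (a , b , h , le) = a + b , b , Sizes-2n m h le , bound₀ {a} le
    extend {m = m} 1F refl (a , b , h , le) = a , 1 + (a + b) , Sizes-2n+1 m h , bound₁ {a} le
    step : ∀ n → (∀ {m} → m < n → SmallSizes m) → SmallSizes n
    step zero    _   = 0 , 0 , Sizes-[] , z≤n
    step (suc n) rec =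
      extend (suc n mod 2) (suc≡mod₂+/₂ n) (rec (m/n<m (suc n) 2 (s≤s (s≤s z≤n))))

  -- Because of the shift in `s`, the two summands belong to the expansions of 2n and 2n + 1, and (1
  -- + a + 2b) + (2 + 2a + b) = 3 (1 + a + b).
  s-triple : ∀ n → s (1 + n * 2) + s (2 + n * 2) ≡ 3 * s (1 + n)
  s-triple n with smallSizes n
  ... | a , b , h , le = trans
    (cong₂ _+_ (s-Sizes (n * 2) (Sizes-2n n h le)) (s-Sizes (1 + n * 2) (Sizes-2n+1 n h)))
    (trans (lemma a b) (cong (3 *_) (sym (s-Sizes n h))))
    where
    lemma : ∀ a b → (1 + ((a + b) + b)) + (1 + (a + (1 + (a + b)))) ≡ 3 * (1 + (a + b))
    lemma = solve-∀

  s≤ : ∀ n → s n ≤ n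
  s≤ zero    = z≤n
  s≤ (suc n) with smallSizes n
  ... | a , b , h , le = subst (_≤ suc n) (sym (s-Sizes n h)) (s≤s le)

  -- The summatory function

  summatory : ℕ → ℕ
  summatory n = sum (map s (upTo (suc n)))

  summatory-suc : ∀ n → summatory (suc n) ≡ summatory n + s (suc n)
  summatory-suc n = begin
    sum (map s (upTo (2 + n)))                       ≡⟨ cong (sum ∘ map s) (upTo-∷ʳ (suc n)) ⟨
    sum (map s (upTo (suc n) ∷ʳ suc n))              ≡⟨ cong sum (map-++ s (upTo (suc n)) [ suc n ]) ⟩
    sum (map s (upTo (suc n)) ++ [ s (suc n) ])      ≡⟨ sum-++ (map s (upTo (suc n))) [ s (suc n) ] ⟩
    summatory n + (s (suc n) + 0)                    ≡⟨ cong (summatory n +_) (+-identityʳ (s (suc n))) ⟩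
    summatory n + s (suc n)                          ∎
    where open ≡-Reasoning

  -- The terms of index 2j + 1 and 2j + 2 pair off into `3 * s (1 + j)`, and `s 0 = 0` stands alone.
  summatory-double : ∀ n → summatory (n * 2) ≡ 3 * summatory n
  summatory-double zero    = refl
  summatory-double (suc n) = begin
    summatory (2 + n * 2)                                      ≡⟨ summatory-suc (1 + n * 2) ⟩
    summatory (1 + n * 2) + s (2 + n * 2)                      ≡⟨ cong (_+ s (2 + n * 2)) (summatory-suc (n * 2)) ⟩
    summatory (n * 2) + s (1 + n * 2) + s (2 + n * 2)          ≡⟨ +-assoc (summatory (n * 2)) _ _ ⟩
    summatory (n * 2) + (s (1 + n * 2) + s (2 + n * 2))        ≡⟨ cong₂ _+_ (summatory-double n) (s-triple n) ⟩
    3 * summatory n + 3 * s (1 + n)                            ≡⟨ *-distribˡ-+ 3 (summatory n) _ ⟨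
    3 * (summatory n + s (1 + n))                              ≡⟨ cong (3 *_) (summatory-suc n) ⟨
    3 * summatory (suc n)                                      ∎
    where open ≡-Reasoning

  summatory-scale : ∀ k n → summatory (n * 2 ^ k) ≡ summatory n * 3 ^ k
  summatory-scale zero    n = trans (cong summatory (*-identityʳ n)) (sym (*-identityʳ _))
  summatory-scale (suc k) n = begin
    summatory (n * (2 * 2 ^ k))      ≡⟨ cong summatory (lemma n (2 ^ k)) ⟩
    summatory (n * 2 ^ k * 2)        ≡⟨ summatory-double (n * 2 ^ k) ⟩
    3 * summatory (n * 2 ^ k)        ≡⟨ cong (3 *_) (summatory-scale k n) ⟩
    3 * (summatory n * 3 ^ k)        ≡⟨ lemma′ (summatory n) (3 ^ k) ⟩
    summatory n * (3 * 3 ^ k)        ∎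
    where
    open ≡-Reasoning
    lemma : ∀ n p → n * (2 * p) ≡ n * p * 2
    lemma = solve-∀
    lemma′ : ∀ n p → 3 * (n * p) ≡ n * (3 * p)
    lemma′ = solve-∀

  -- Each of the `j` new terms is at most its index by `s≤`, hence at most `j + n`. This growth
  -- bound is what makes `limit` converge.
  summatory-+ : ∀ n j → summatory (j + n) ≤ summatory n + j * (j + n)
  summatory-+ n zero    = ≤-reflexive (sym (+-identityʳ _))
  summatory-+ n (suc j) = begin
    summatory (suc (j + n))                             ≡⟨ summatory-suc (j + n) ⟩
    summatory (j + n) + s (suc (j + n))                 ≤⟨ +-mono-≤ (summatory-+ n j) (s≤ (suc (j + n))) ⟩
    summatory n + j * (j + n) + suc (j + n)             ≤⟨ +-monoˡ-≤ (suc (j + n)) (+-monoʳ-≤ (summatory n) (*-monoʳ-≤ j (n≤1+n (j + n)))) ⟩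
    summatory n + j * suc (j + n) + suc (j + n)         ≡⟨ lemma (summatory n) j (suc (j + n)) ⟩
    summatory n + suc j * suc (j + n)                   ∎
    where
    open ≤-Reasoning
    lemma : ∀ a b c → a + b * c + c ≡ a + suc b * c
    lemma = solve-∀

  summatory-mono : ∀ {m n} → m ≤ n → summatory m ≤ summatory n
  summatory-mono m≤n = go (≤⇒≤′ m≤n)
    where
    go : ∀ {m n} → m ≤′ n → summatory m ≤ summatory n
    go ≤′-refl           = ≤-refl
    go (≤′-step {n} m≤n) = ≤-trans (go m≤n) (subst (summatory n ≤_) (sym (summatory-suc n)) (m≤m+n _ _))

-- Partial sums of the exponential and the logarithm

module Exponential where

  open import Defs using (module Cauchy)
  open import Data.Nat.Base as ℕ using (ℕ; zero; suc)
  import Data.Nat.Properties as ℕ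
  open import Data.Product.Base using (∃-syntax; _,_; proj₁; proj₂)
  open import Data.Rational.Base
  open import Data.Rational.Properties
  open import Data.Rational.Solver using (module +-*-Solver)
  open import Function.Base using (_∘_)
  open import Relation.Binary.PropositionalEquality
    using (_≡_; refl; sym; trans; cong; cong₂; subst; subst₂; module ≡-Reasoning)
  open Cauchy
  open +-*-Solver using (solve; _:+_; _:*_; _:-_; _:=_; :-_; con)

  fromℕℚ-+ : ∀ m n → fromℕℚ (m ℕ.+ n) ≡ fromℕℚ m + fromℕℚ n
  fromℕℚ-+ zero    n = sym (+-identityˡ (fromℕℚ n))
  fromℕℚ-+ (suc m) n = begin
    fromℕℚ (suc (m ℕ.+ n))            ≡⟨ fromℕℚ-suc (m ℕ.+ n) ⟩
    1ℚ + fromℕℚ (m ℕ.+ n)             ≡⟨ cong (1ℚ +_) (fromℕℚ-+ m n) ⟩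
    1ℚ + (fromℕℚ m + fromℕℚ n)        ≡⟨ +-assoc 1ℚ (fromℕℚ m) (fromℕℚ n) ⟨
    1ℚ + fromℕℚ m + fromℕℚ n          ≡⟨ cong (_+ fromℕℚ n) (fromℕℚ-suc m) ⟨
    fromℕℚ (suc m) + fromℕℚ n         ∎
    where open ≡-Reasoning

  fromℕℚ-* : ∀ m n → fromℕℚ (m ℕ.* n) ≡ fromℕℚ m * fromℕℚ n
  fromℕℚ-* zero    n = sym (*-zeroˡ (fromℕℚ n))
  fromℕℚ-* (suc m) n = begin
    fromℕℚ (n ℕ.+ m ℕ.* n)                ≡⟨ fromℕℚ-+ n (m ℕ.* n) ⟩
    fromℕℚ n + fromℕℚ (m ℕ.* n)           ≡⟨ cong (fromℕℚ n +_) (fromℕℚ-* m n) ⟩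
    fromℕℚ n + fromℕℚ m * fromℕℚ n        ≡⟨ solve 2 (λ a b → b :+ a :* b := (con 1ℚ :+ a) :* b) refl (fromℕℚ m) (fromℕℚ n) ⟩
    (1ℚ + fromℕℚ m) * fromℕℚ n            ≡⟨ cong (_* fromℕℚ n) (fromℕℚ-suc m) ⟨
    fromℕℚ (suc m) * fromℕℚ n             ∎
    where open ≡-Reasoning

  fromℕℚ-mono : ∀ {m n} → m ℕ.≤ n → fromℕℚ m ≤ fromℕℚ n
  fromℕℚ-mono {m} {n} m≤n = begin
    fromℕℚ m                            ≤⟨ p≤p+q (fromℕℚ m) (fromℕℚ-nonNeg (n ℕ.∸ m)) ⟩
    fromℕℚ m + fromℕℚ (n ℕ.∸ m)         ≡⟨ fromℕℚ-+ m (n ℕ.∸ m) ⟨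
    fromℕℚ (m ℕ.+ (n ℕ.∸ m))            ≡⟨ cong fromℕℚ (ℕ.m+[n∸m]≡n m≤n) ⟩
    fromℕℚ n                            ∎
    where open ≤-Reasoning

  fromℕℚ-pos : ∀ n → 0ℚ < fromℕℚ (suc n)
  fromℕℚ-pos n = positive⁻¹ (fromℕℚ (suc n)) {{normalize-pos (suc n) 1}}

  -- conv f g n is the sum of f i * g j over all i + j = n - 1.

  conv : (ℕ → ℚ) → (ℕ → ℚ) → ℕ → ℚ
  conv f g zero    = 0ℚ
  conv f g (suc n) = f 0 * g n + conv (f ∘ suc) g n

  conv-congˡ : ∀ {f f′} g → (∀ i → f i ≡ f′ i) → ∀ n → conv f g n ≡ conv f′ g n
  conv-congˡ g f≡f′ zero    = refl
  conv-congˡ g f≡f′ (suc n) = cong₂ _+_ (cong (_* g n) (f≡f′ 0)) (conv-congˡ g (f≡f′ ∘ suc) n)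

  conv-congʳ : ∀ f {g g′} → (∀ i → g i ≡ g′ i) → ∀ n → conv f g n ≡ conv f g′ n
  conv-congʳ f g≡g′ zero    = refl
  conv-congʳ f g≡g′ (suc n) = cong₂ _+_ (cong (f 0 *_) (g≡g′ n)) (conv-congʳ (f ∘ suc) g≡g′ n)

  conv-scaleˡ : ∀ c f g n → conv (λ i → c * f i) g n ≡ c * conv f g n
  conv-scaleˡ c f g zero    = sym (*-zeroʳ c)
  conv-scaleˡ c f g (suc n) = trans (cong (c * f 0 * g n +_) (conv-scaleˡ c (f ∘ suc) g n))
    (solve 4 (λ c f g r → c :* f :* g :+ c :* r := c :* (f :* g :+ r)) refl c (f 0) (g n) _)

  conv-scaleʳ : ∀ c f g n → conv f (λ i → c * g i) n ≡ c * conv f g n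
  conv-scaleʳ c f g zero    = sym (*-zeroʳ c)
  conv-scaleʳ c f g (suc n) = trans (cong (f 0 * (c * g n) +_) (conv-scaleʳ c (f ∘ suc) g n))
    (solve 4 (λ c f g r → f :* (c :* g) :+ c :* r := c :* (f :* g :+ r)) refl c (f 0) (g n) _)

  conv-subʳ : ∀ f g h n → conv f (λ i → g i - h i) n ≡ conv f g n - conv f h n
  conv-subʳ f g h zero    = refl
  conv-subʳ f g h (suc n) = trans (cong (f 0 * (g n - h n) +_) (conv-subʳ (f ∘ suc) g h n))
    (solve 5 (λ f g h r t → f :* (g :- h) :+ (r :- t) := (f :* g :+ r) :- (f :* h :+ t))
      refl (f 0) (g n) (h n) _ _)

  conv-last : ∀ f g n → conv f g (suc n) ≡ conv f (g ∘ suc) n + f n * g 0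
  conv-last f g zero    = +-comm (f 0 * g 0) 0ℚ
  conv-last f g (suc n) = trans (cong (f 0 * g (suc n) +_) (conv-last (f ∘ suc) g n))
    (sym (+-assoc (f 0 * g (suc n)) _ _))

  -- A discrete product rule: the two weights add up to the constant `c` on the antidiagonal over
  -- which the convolution runs.
  conv-weighted : ∀ (φ ψ : ℕ → ℚ) c f g n → (∀ i j → suc (i ℕ.+ j) ≡ n → φ i + ψ j ≡ c) →
    conv (λ i → φ i * f i) g n + conv f (λ j → ψ j * g j) n ≡ c * conv f g n
  conv-weighted φ ψ c f g zero    _ = sym (*-zeroʳ c)
  conv-weighted φ ψ c f g (suc n) h = begin
    φ 0 * f 0 * g n + a + (f 0 * (ψ n * g n) + b)
      ≡⟨ solve 6 (λ p q f g a b → p :* f :* g :+ a :+ (f :* (q :* g) :+ b)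
                                := (p :+ q) :* (f :* g) :+ (a :+ b)) refl (φ 0) (ψ n) (f 0) (g n) a b ⟩
    (φ 0 + ψ n) * (f 0 * g n) + (a + b)
      ≡⟨ cong₂ _+_ (cong (_* (f 0 * g n)) (h 0 n refl))
           (conv-weighted (φ ∘ suc) ψ c (f ∘ suc) g n λ i j eq → h (suc i) j (cong suc eq)) ⟩
    c * (f 0 * g n) + c * conv (f ∘ suc) g n
      ≡⟨ *-distribˡ-+ c (f 0 * g n) (conv (f ∘ suc) g n) ⟨
    c * (f 0 * g n + conv (f ∘ suc) g n) ∎
    where
    open ≡-Reasoning
    a = conv (λ i → φ (suc i) * f (suc i)) g n
    b = conv (f ∘ suc) (λ j → ψ j * g j) n

  conv-nonNeg : ∀ f g n → (∀ i → 0ℚ ≤ f i) → (∀ i → 0ℚ ≤ g i) → 0ℚ ≤ conv f g n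
  conv-nonNeg f g zero    0≤f 0≤g = ≤-refl
  conv-nonNeg f g (suc n) 0≤f 0≤g =
    +-nonNeg (*-nonNeg (0≤f 0) (0≤g n)) (conv-nonNeg (f ∘ suc) g n (0≤f ∘ suc) 0≤g)

  -- Only `g i` with `i < n` enters the convolution. The restriction matters because the tails to
  -- which this is applied are controlled just for those `i`.
  conv-abs : ∀ f g F G n → (∀ i → ∣ f i ∣ ≤ F i) → (∀ i → i ℕ.< n → ∣ g i ∣ ≤ G i) →
             ∣ conv f g n ∣ ≤ conv F G n
  conv-abs f g F G zero    f≤F g≤G = ≤-refl
  conv-abs f g F G (suc n) f≤F g≤G = begin
    ∣ f 0 * g n + conv (f ∘ suc) g n ∣            ≤⟨ ∣p+q∣≤∣p∣+∣q∣ (f 0 * g n) _ ⟩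
    ∣ f 0 * g n ∣ + ∣ conv (f ∘ suc) g n ∣        ≡⟨ cong (_+ ∣ conv (f ∘ suc) g n ∣) (∣p*q∣≡∣p∣*∣q∣ (f 0) (g n)) ⟩
    ∣ f 0 ∣ * ∣ g n ∣ + ∣ conv (f ∘ suc) g n ∣    ≤⟨ +-mono-≤
       (*-mono (≤-trans (0≤∣p∣ (f 0)) (f≤F 0)) (0≤∣p∣ (g n)) (f≤F 0) (g≤G n (ℕ.n<1+n n)))
       (conv-abs (f ∘ suc) g (F ∘ suc) G n (f≤F ∘ suc) λ i i<n → g≤G i (ℕ.m<n⇒m<1+n i<n)) ⟩
    F 0 * G n + conv (F ∘ suc) G n                ∎
    where open ≤-Reasoning

  -- Dropping the k summands whose second index is smallest.

  conv-const≤ : ∀ c f g k n → (∀ i → 0ℚ ≤ f i) → (∀ i → 0ℚ ≤ g i) → (∀ i → k ℕ.≤ i → c ≤ g i) →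
                conv f (λ _ → c) n ≤ conv f g (n ℕ.+ k)
  conv-const≤ c f g k zero    0≤f 0≤g c≤g = conv-nonNeg f g k 0≤f 0≤g
  conv-const≤ c f g k (suc n) 0≤f 0≤g c≤g =
    +-mono-≤ (*-monoˡ (f 0) (0≤f 0) (c≤g (n ℕ.+ k) (ℕ.m≤n+m k n)))
             (conv-const≤ c (f ∘ suc) g k n (0≤f ∘ suc) 0≤g c≤g)

  conv-expTerm-const : ∀ x c n → conv (expTerm x) (λ _ → c) n ≡ expSum x n * c
  conv-expTerm-const x c zero    = sym (*-zeroˡ c)
  conv-expTerm-const x c (suc n) = begin
    conv (expTerm x) (λ _ → c) (suc n)                  ≡⟨ conv-last (expTerm x) (λ _ → c) n ⟩
    conv (expTerm x) (λ _ → c) n + expTerm x n * c      ≡⟨ cong (_+ expTerm x n * c) (conv-expTerm-const x c n) ⟩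
    expSum x n * c + expTerm x n * c                    ≡⟨ *-distribʳ-+ c (expSum x n) (expTerm x n) ⟨
    (expSum x n + expTerm x n) * c                      ∎
    where open ≡-Reasoning

  expTerm-suc : ∀ x i → fromℕℚ (suc i) * expTerm x (suc i) ≡ x * expTerm x i
  expTerm-suc x i = begin
    fromℕℚ (suc i) * (expTerm x i * (x * inv i))    ≡⟨ solve 4 (λ n t x i → n :* (t :* (x :* i)) := n :* i :* (x :* t)) refl (fromℕℚ (suc i)) (expTerm x i) x (inv i) ⟩
    fromℕℚ (suc i) * inv i * (x * expTerm x i)      ≡⟨ cong (_* (x * expTerm x i)) (fromℕℚ-*-inv i) ⟩
    1ℚ * (x * expTerm x i)                          ≡⟨ *-identityˡ (x * expTerm x i) ⟩
    x * expTerm x i                                 ∎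
    where open ≡-Reasoning

  -- Multiplying by k turns each term of the convolution into a sum of two terms
  -- of the convolution of order k - 1, by k = i + j and expTerm-suc.

  conv-expTerm : ∀ x y k → conv (expTerm x) (expTerm y) (suc k) ≡ expTerm (x + y) k
  conv-expTerm x y zero    = refl
  conv-expTerm x y (suc k) = begin
    C                                         ≡⟨ *-identityˡ C ⟨
    1ℚ * C                                    ≡⟨ cong (_* C) (fromℕℚ-*-inv k) ⟨
    n * inv k * C                             ≡⟨ solve 3 (λ n i C → n :* i :* C := i :* (n :* C)) refl n (inv k) C ⟩
    inv k * (n * C)                           ≡⟨ cong (inv k *_) (conv-weighted fromℕℚ fromℕℚ n X Y (2 ℕ.+ k)
                                                   λ i j eq → trans (sym (fromℕℚ-+ i j)) (cong fromℕℚ (ℕ.suc-injective eq))) ⟨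
    inv k * (conv (λ i → fromℕℚ i * X i) Y (2 ℕ.+ k) + conv X (λ j → fromℕℚ j * Y j) (2 ℕ.+ k))
                                              ≡⟨ cong (inv k *_) (cong₂ _+_ left right) ⟩
    inv k * (x * C⁻ + y * C⁻)                 ≡⟨ solve 4 (λ i x y c → i :* (x :* c :+ y :* c) := c :* ((x :+ y) :* i)) refl (inv k) x y C⁻ ⟩
    C⁻ * ((x + y) * inv k)                    ≡⟨ cong (_* ((x + y) * inv k)) (conv-expTerm x y k) ⟩
    expTerm (x + y) (suc k)                   ∎
    where
    open ≡-Reasoning
    X = expTerm x
    Y = expTerm y
    n = fromℕℚ (suc k)
    C = conv X Y (2 ℕ.+ k)
    C⁻ = conv X Y (suc k)
    left : conv (λ i → fromℕℚ i * X i) Y (2 ℕ.+ k) ≡ x * C⁻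
    left = begin
      fromℕℚ 0 * X 0 * Y (suc k) + conv (λ i → fromℕℚ (suc i) * X (suc i)) Y (suc k)
        ≡⟨ cong₂ _+_ (*-zeroˡ (Y (suc k))) (conv-congˡ Y (expTerm-suc x) (suc k)) ⟩
      0ℚ + conv (λ i → x * X i) Y (suc k)   ≡⟨ +-identityˡ _ ⟩
      conv (λ i → x * X i) Y (suc k)        ≡⟨ conv-scaleˡ x X Y (suc k) ⟩
      x * C⁻                                ∎
    right : conv X (λ j → fromℕℚ j * Y j) (2 ℕ.+ k) ≡ y * C⁻
    right = begin
      conv X (λ j → fromℕℚ j * Y j) (2 ℕ.+ k)
        ≡⟨ conv-last X (λ j → fromℕℚ j * Y j) (suc k) ⟩
      conv X (λ j → fromℕℚ (suc j) * Y (suc j)) (suc k) + X (suc k) * 0ℚ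
        ≡⟨ cong₂ _+_ (conv-congʳ X (expTerm-suc y) (suc k)) (*-zeroʳ (X (suc k))) ⟩
      conv X (λ j → y * Y j) (suc k) + 0ℚ   ≡⟨ +-identityʳ _ ⟩
      conv X (λ j → y * Y j) (suc k)        ≡⟨ conv-scaleʳ y X Y (suc k) ⟩
      y * C⁻                                ∎

  conv-expSum-suc : ∀ f y n → conv f (expSum y ∘ suc) (suc n) ≡
                    conv f (expSum y ∘ suc) n + conv f (expTerm y) (suc n)
  conv-expSum-suc f y zero    =
    solve 2 (λ f t → f :* (con 0ℚ :+ t) :+ con 0ℚ := con 0ℚ :+ (f :* t :+ con 0ℚ)) refl (f 0) (expTerm y 0)
  conv-expSum-suc f y (suc n) =
    trans (cong (f 0 * expSum y (suc (suc n)) +_) (conv-expSum-suc (f ∘ suc) y n))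
      (solve 5 (λ f e t a b → f :* (e :+ t) :+ (a :+ b) := f :* e :+ a :+ (f :* t :+ b)) refl
        (f 0) (expSum y (suc n)) (expTerm y (suc n)) _ _)

  -- As `expSum y (suc j)` ends with the term of index `j`, the left side is the sum of products
  -- over the triangle i + j < n. Each antidiagonal of the triangle contributes one term of the
  -- series at `x + y`.
  conv-expSum : ∀ x y n → conv (expTerm x) (expSum y ∘ suc) n ≡ expSum (x + y) n
  conv-expSum x y zero    = refl
  conv-expSum x y (suc n) = trans (conv-expSum-suc (expTerm x) y n)
    (cong₂ _+_ (conv-expSum x y n) (conv-expTerm x y n))

  -- Square minus triangle: what remains are the products with i, j < n and i + j ≥ n, arranged by
  -- rows as tails of the series in `y`.
  expSum-*-expSum : ∀ x y n → expSum x n * expSum y n - expSum (x + y) n ≡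
                    conv (expTerm x) (λ i → expSum y n - expSum y (suc i)) n
  expSum-*-expSum x y n = sym (trans (conv-subʳ (expTerm x) (λ _ → expSum y n) (expSum y ∘ suc) n)
    (cong₂ _-_ (conv-expTerm-const x (expSum y n) n) (conv-expSum x y n)))

  expTerm-nonNeg : ∀ {x} → 0ℚ ≤ x → ∀ n → 0ℚ ≤ expTerm x n
  expTerm-nonNeg {x} 0≤x = ExpBound.t-nonNeg x 0≤x

  expSum-mono : ∀ x {m n} → 0ℚ ≤ x → m ℕ.≤ n → expSum x m ≤ expSum x n
  expSum-mono x 0≤x m≤n = ExpBound.E-mono x 0≤x (ℕ.≤⇒≤′ m≤n)

  expSum-nonNeg : ∀ x → 0ℚ ≤ x → ∀ n → 0ℚ ≤ expSum x n
  expSum-nonNeg x 0≤x n = expSum-mono x {0} {n} 0≤x ℕ.z≤n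

  expSum-monoˡ : ∀ x y → 0ℚ ≤ x → x ≤ y → ∀ n → expSum x n ≤ expSum y n
  expSum-monoˡ x y 0≤x x≤y zero    = ≤-refl
  expSum-monoˡ x y 0≤x x≤y (suc n) = +-mono-≤ (expSum-monoˡ x y 0≤x x≤y n)
    (≤-trans (p≤∣p∣ (expTerm x n)) (ExpBound.t-≤ y (≤-trans 0≤x x≤y) {x}
      (subst (_≤ y) (sym (0≤p⇒∣p∣≡p 0≤x)) x≤y) n))

  -- The square i, j < n lies inside the triangle i + j < 2n, and all products are nonnegative.
  expSum-*-≤ : ∀ x y → 0ℚ ≤ x → 0ℚ ≤ y → ∀ n → expSum x n * expSum y n ≤ expSum (x + y) (n ℕ.+ n)
  expSum-*-≤ x y 0≤x 0≤y n = subst₂ _≤_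
    (conv-expTerm-const x (expSum y n) n) (conv-expSum x y (n ℕ.+ n))
    (conv-const≤ (expSum y n) (expTerm x) (expSum y ∘ suc) n n
      (expTerm-nonNeg 0≤x) (λ i → expSum-nonNeg y 0≤y (suc i))
      λ i n≤i → expSum-mono y {n} {suc i} 0≤y (ℕ.m≤n⇒m≤1+n n≤i))

  -- The products left over in the square are dominated one by one by those for `B` and `B`, whose
  -- sum is the same difference formed at `B`.
  expSum-+-error : ∀ {B x y} → ∣ x ∣ ≤ B → ∣ y ∣ ≤ B → ∀ n →
    ∣ expSum x n * expSum y n - expSum (x + y) n ∣ ≤ expSum B n * expSum B n - expSum (B + B) n
  expSum-+-error {B} {x} {y} x≤B y≤B n = subst₂ _≤_
    (cong ∣_∣ (sym (expSum-*-expSum x y n))) (sym (expSum-*-expSum B B n))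
    (conv-abs (expTerm x) (λ i → expSum y n - expSum y (suc i))
              (expTerm B) (λ i → expSum B n - expSum B (suc i)) n
      (ExpBound.t-≤ B 0≤B x≤B)
      λ i i<n → ExpBound.expSum-tail B 0≤B y≤B (ℕ.≤⇒≤′ i<n))
    where
    0≤B : 0ℚ ≤ B
    0≤B = ≤-trans (0≤∣p∣ x) x≤B

  expSum-+-≤ : ∀ x y → 0ℚ ≤ x → 0ℚ ≤ y → ∀ n → expSum (x + y) n ≤ expSum x n * expSum y n
  expSum-+-≤ x y 0≤x 0≤y n = subst₂ _≤_ (+-identityˡ (expSum (x + y) n))
    (solve 2 (λ a b → (a :- b) :+ b := a) refl (expSum x n * expSum y n) (expSum (x + y) n))
    (+-monoˡ-≤ (expSum (x + y) n) (subst (0ℚ ≤_) (sym (expSum-*-expSum x y n))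
      -- `tail i` is known to be nonnegative only for `i < n`, too little for `conv-nonNeg`. Taking
      -- the convolution as its own majorant in `conv-abs` uses just these values.
      (≤-trans (0≤∣p∣ (conv (expTerm x) tail n)) (conv-abs (expTerm x) tail (expTerm x) tail n
        (λ i → ≤-reflexive (0≤p⇒∣p∣≡p (expTerm-nonNeg 0≤x i)))
        λ i i<n → ≤-reflexive (0≤p⇒∣p∣≡p (p≤q⇒0≤q-p _ _ (expSum-mono y {suc i} {n} 0≤y i<n)))))))
    where
    tail : ℕ → ℚ
    tail i = expSum y n - expSum y (suc i)

  -- The error is at most the increment of the series at `B + B` from `n` to `n + n` terms. The
  -- bound is uniform in `x` and `y`, as it must be when they are approximations that vary with `n`.
  expSum-+-limit : ∀ B → 0ℚ ≤ B → ∀ ε → 0ℚ < ε → ∃[ N ] (∀ n → N ℕ.≤ n → ∀ {x y} →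
    ∣ x ∣ ≤ B → ∣ y ∣ ≤ B → ∣ expSum x n * expSum y n - expSum (x + y) n ∣ < ε)
  expSum-+-limit B 0≤B ε 0<ε =
    let (N , close) = ExpBound.E-cauchy (B + B) (+-nonNeg 0≤B 0≤B) ε 0<ε
    in N , λ n N≤n {x} {y} x≤B y≤B → begin-strict
    ∣ expSum x n * expSum y n - expSum (x + y) n ∣      ≤⟨ expSum-+-error x≤B y≤B n ⟩
    expSum B n * expSum B n - expSum (B + B) n          ≤⟨ +-monoˡ-≤ (- expSum (B + B) n) (expSum-*-≤ B B 0≤B 0≤B n) ⟩
    expSum (B + B) (n ℕ.+ n) - expSum (B + B) n         ≤⟨ p≤∣p∣ _ ⟩
    ∣ expSum (B + B) (n ℕ.+ n) - expSum (B + B) n ∣     <⟨ close (n ℕ.+ n) n (ℕ.≤-trans N≤n (ℕ.m≤m+n n n)) N≤n ⟩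
    ε                                                   ∎
    where open ≤-Reasoning

  -- Exponentials of harmonic sums

  expSum-0 : ∀ n → expSum 0ℚ (suc n) ≡ 1ℚ
  expSum-0 zero    = refl
  expSum-0 (suc n) = trans (cong₂ _+_ (expSum-0 n)
    (trans (cong (expTerm 0ℚ n *_) (*-zeroˡ (inv n))) (*-zeroʳ (expTerm 0ℚ n)))) refl

  expSum-0-≤ : ∀ n → expSum 0ℚ n ≤ 1ℚ
  expSum-0-≤ zero    = <⇒≤ 0<1
  expSum-0-≤ (suc n) = ≤-reflexive (expSum-0 n)

  inv≤1 : ∀ n → inv n ≤ 1ℚ
  inv≤1 n = inv-anti {0} {n} ℕ.z≤n

  -- Each term is at most `h` times the preceding one, so `(1 - h) * expSum h n` telescopes; the
  -- next term is kept on the left to carry the induction. It amounts to exp h ≤ 1 / (1 - h).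
  expSum-geometric : ∀ {h} → 0ℚ ≤ h → ∀ n → (1ℚ - h) * expSum h n + expTerm h n ≤ 1ℚ
  expSum-geometric {h} 0≤h zero    = ≤-reflexive (cong (_+ 1ℚ) (*-zeroʳ (1ℚ - h)))
  expSum-geometric {h} 0≤h (suc n) = begin
    (1ℚ - h) * (e + t) + t * (h * inv n)
      ≤⟨ +-monoʳ-≤ ((1ℚ - h) * (e + t)) (*-monoˡ t 0≤t (*-monoˡ h 0≤h (inv≤1 n))) ⟩
    (1ℚ - h) * (e + t) + t * (h * 1ℚ)
      ≡⟨ solve 3 (λ h e t → (con 1ℚ :- h) :* (e :+ t) :+ t :* (h :* con 1ℚ) := (con 1ℚ :- h) :* e :+ t) refl h e t ⟩
    (1ℚ - h) * e + t
      ≤⟨ expSum-geometric 0≤h n ⟩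
    1ℚ ∎
    where
    open ≤-Reasoning
    e = expSum h n
    t = expTerm h n
    0≤t = expTerm-nonNeg 0≤h n

  -- At h = 1/(m+1) the geometric bound reads exp h ≤ (m+1)/m; multiplied out, it includes `m = 0`.
  expSum-inv-≤ : ∀ m n → expSum (inv m) n * fromℕℚ m ≤ fromℕℚ (suc m)
  expSum-inv-≤ m n = begin
    e * fromℕℚ m                                    ≡⟨ solve 2 (λ e f → e :* f := e :* ((con 1ℚ :+ f) :- con 1ℚ)) refl e (fromℕℚ m) ⟩
    e * ((1ℚ + fromℕℚ m) - 1ℚ)                      ≡⟨ cong₂ (λ a b → e * (a - b)) (fromℕℚ-suc m) (fromℕℚ-*-inv m) ⟨
    e * (f - f * inv m)                             ≡⟨ solve 3 (λ e f i → e :* (f :- f :* i) := f :* ((con 1ℚ :- i) :* e)) refl e f (inv m) ⟩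
    f * ((1ℚ - inv m) * e)                          ≤⟨ *-monoˡ f (fromℕℚ-nonNeg (suc m)) (p≤p+q _ (expTerm-nonNeg (inv-nonNeg m) n)) ⟩
    f * ((1ℚ - inv m) * e + expTerm (inv m) n)      ≤⟨ *-monoˡ f (fromℕℚ-nonNeg (suc m)) (expSum-geometric (inv-nonNeg m) n) ⟩
    f * 1ℚ                                          ≡⟨ *-identityʳ f ⟩
    f                                               ∎
    where
    open ≤-Reasoning
    e = expSum (inv m) n
    f = fromℕℚ (suc m)

  harmonic-+ : ∀ k a → harmonic (suc k ℕ.+ a) - harmonic a ≡ harmonic (k ℕ.+ a) - harmonic a + inv (k ℕ.+ a)
  harmonic-+ k a = solve 3 (λ p q r → p :+ r :- q := (p :- q) :+ r) refl (harmonic (k ℕ.+ a)) (harmonic a) (inv (k ℕ.+ a))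

  harmonic-nonNeg : ∀ k a → 0ℚ ≤ harmonic (k ℕ.+ a) - harmonic a
  harmonic-nonNeg zero    a = ≤-reflexive (sym (+-inverseʳ (harmonic a)))
  harmonic-nonNeg (suc k) a = subst (0ℚ ≤_) (sym (harmonic-+ k a))
    (+-nonNeg (harmonic-nonNeg k a) (inv-nonNeg (k ℕ.+ a)))

  -- The products of the bounds 1 + 1/(m+1) ≤ exp (1/(m+1)) ≤ 1 + 1/m telescope.

  expSum-harmonic-≤ : ∀ k a n → expSum (harmonic (k ℕ.+ a) - harmonic a) n * fromℕℚ a ≤ fromℕℚ (k ℕ.+ a)
  expSum-harmonic-≤ zero    a n = begin
    expSum (harmonic a - harmonic a) n * fromℕℚ a     ≡⟨ cong (λ x → expSum x n * fromℕℚ a) (+-inverseʳ (harmonic a)) ⟩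
    expSum 0ℚ n * fromℕℚ a                            ≤⟨ *-monoʳ (fromℕℚ a) (fromℕℚ-nonNeg a) (expSum-0-≤ n) ⟩
    1ℚ * fromℕℚ a                                     ≡⟨ *-identityˡ (fromℕℚ a) ⟩
    fromℕℚ a                                          ∎
    where open ≤-Reasoning
  expSum-harmonic-≤ (suc k) a n = begin
    expSum (harmonic (suc k ℕ.+ a) - harmonic a) n * fromℕℚ a     ≡⟨ cong (λ x → expSum x n * fromℕℚ a) (harmonic-+ k a) ⟩
    expSum (p + h) n * fromℕℚ a                       ≤⟨ *-monoʳ (fromℕℚ a) (fromℕℚ-nonNeg a) (expSum-+-≤ p h (harmonic-nonNeg k a) 0≤h n) ⟩
    expSum p n * expSum h n * fromℕℚ a                ≡⟨ solve 3 (λ p h f → p :* h :* f := h :* (p :* f)) refl (expSum p n) (expSum h n) (fromℕℚ a) ⟩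
    expSum h n * (expSum p n * fromℕℚ a)              ≤⟨ *-monoˡ (expSum h n) (expSum-nonNeg h 0≤h n) (expSum-harmonic-≤ k a n) ⟩
    expSum h n * fromℕℚ (k ℕ.+ a)                     ≤⟨ expSum-inv-≤ (k ℕ.+ a) n ⟩
    fromℕℚ (suc k ℕ.+ a)                              ∎
    where
    open ≤-Reasoning
    p = harmonic (k ℕ.+ a) - harmonic a
    h = inv (k ℕ.+ a)
    0≤h = inv-nonNeg (k ℕ.+ a)

  -- Two terms of the series give 1 + h = (l+2)/(l+1) at h = 1/(l+1), and these factors telescope.
  -- The number of terms is existential because each multiplication doubles it through `expSum-*-≤`.
  expSum-harmonic-≥ : ∀ k a → ∃[ n ]
    (fromℕℚ (suc (k ℕ.+ a)) ≤ expSum (harmonic (k ℕ.+ a) - harmonic a) n * fromℕℚ (suc a))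
  expSum-harmonic-≥ zero    a = 1 , ≤-reflexive (sym (*-identityˡ (fromℕℚ (suc a))))
  expSum-harmonic-≥ (suc k) a = N ℕ.+ N , (begin
    fromℕℚ (2 ℕ.+ l)                                  ≡⟨ fromℕℚ-suc (suc l) ⟩
    1ℚ + fromℕℚ (suc l)                               ≡⟨ cong (_+ fromℕℚ (suc l)) (fromℕℚ-*-inv l) ⟨
    fromℕℚ (suc l) * h + fromℕℚ (suc l)               ≡⟨ solve 2 (λ f h → f :* h :+ f := (con 1ℚ :+ con 1ℚ :* (h :* con 1ℚ)) :* f) refl (fromℕℚ (suc l)) h ⟩
    expSum h 2 * fromℕℚ (suc l)                       ≤⟨ *-monoˡ (expSum h 2) (expSum-nonNeg h 0≤h 2) le ⟩
    expSum h 2 * (expSum p n * fromℕℚ (suc a))        ≤⟨ *-mono (expSum-nonNeg h 0≤h N) 0≤pn (expSum-mono h 0≤h (ℕ.m≤n⊔m n 2))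
                                                           (*-monoʳ (fromℕℚ (suc a)) (fromℕℚ-nonNeg (suc a)) (expSum-mono p 0≤p (ℕ.m≤m⊔n n 2))) ⟩
    expSum h N * (expSum p N * fromℕℚ (suc a))        ≡⟨ solve 3 (λ p h f → h :* (p :* f) := p :* h :* f) refl (expSum p N) (expSum h N) (fromℕℚ (suc a)) ⟩
    expSum p N * expSum h N * fromℕℚ (suc a)          ≤⟨ *-monoʳ (fromℕℚ (suc a)) (fromℕℚ-nonNeg (suc a)) (expSum-*-≤ p h 0≤p 0≤h N) ⟩
    expSum (p + h) (N ℕ.+ N) * fromℕℚ (suc a)         ≡⟨ cong (λ x → expSum x (N ℕ.+ N) * fromℕℚ (suc a)) (harmonic-+ k a) ⟨
    expSum (harmonic (suc k ℕ.+ a) - harmonic a) (N ℕ.+ N) * fromℕℚ (suc a) ∎)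
    where
    open ≤-Reasoning
    l = k ℕ.+ a
    p = harmonic l - harmonic a
    h = inv l
    n = proj₁ (expSum-harmonic-≥ k a)
    le = proj₂ (expSum-harmonic-≥ k a)
    N = n ℕ.⊔ 2
    0≤h = inv-nonNeg l
    0≤p = harmonic-nonNeg k a
    0≤pn : 0ℚ ≤ expSum p n * fromℕℚ (suc a)
    0≤pn = *-nonNeg (expSum-nonNeg p 0≤p n) (fromℕℚ-nonNeg (suc a))

  lnSum-harmonic : ∀ k n → lnSum (suc k) n ≡ harmonic (suc n ℕ.* k ℕ.+ suc n) - harmonic (suc n)
  lnSum-harmonic k n = cong (λ m → harmonic m - harmonic (suc n))
    (trans (ℕ.*-suc (suc n) k) (ℕ.+-comm (suc n) (suc n ℕ.* k)))

  lnSum-nonNeg : ∀ k n → 0ℚ ≤ lnSum (suc k) n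
  lnSum-nonNeg k n = subst (0ℚ ≤_) (sym (lnSum-harmonic k n)) (harmonic-nonNeg (suc n ℕ.* k) (suc n))

  expSum-lnSum-≤ : ∀ k m n → expSum (lnSum (suc k) m) n ≤ fromℕℚ (suc k)
  expSum-lnSum-≤ k m n = *-cancelʳ-≤-pos (fromℕℚ (suc m)) {{positive (fromℕℚ-pos m)}} (begin
    expSum (lnSum (suc k) m) n * fromℕℚ (suc m)       ≡⟨ cong (λ x → expSum x n * fromℕℚ (suc m)) (lnSum-harmonic k m) ⟩
    _                                                 ≤⟨ expSum-harmonic-≤ (suc m ℕ.* k) (suc m) n ⟩
    fromℕℚ (suc m ℕ.* k ℕ.+ suc m)                    ≡⟨ cong fromℕℚ (trans (ℕ.+-comm (suc m ℕ.* k) (suc m)) (trans (sym (ℕ.*-suc (suc m) k)) (ℕ.*-comm (suc m) (suc k)))) ⟩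
    fromℕℚ (suc k ℕ.* suc m)                          ≡⟨ fromℕℚ-* (suc k) (suc m) ⟩
    fromℕℚ (suc k) * fromℕℚ (suc m)                   ∎)
    where open ≤-Reasoning

  -- The telescoped quotient is ((k+1)(m+1) + 1) / (m+2), and dropping the 1 in the numerator leaves
  -- (k+1)(1 - 1/(m+2)).
  expSum-lnSum-≥ : ∀ k m → ∃[ n ]
    (fromℕℚ (suc k) - fromℕℚ (suc k) * inv (suc m) ≤ expSum (lnSum (suc k) m) n)
  expSum-lnSum-≥ k m = n , *-cancelʳ-≤-pos (fromℕℚ (2 ℕ.+ m)) {{positive (fromℕℚ-pos (suc m))}} (begin
    (K - K * i) * f                                   ≡⟨ solve 3 (λ K i f → (K :- K :* i) :* f := K :* (f :- f :* i)) refl K i f ⟩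
    K * (f - f * i)                                   ≡⟨ cong₂ (λ a b → K * (a - b)) (fromℕℚ-suc (suc m)) (fromℕℚ-*-inv (suc m)) ⟩
    K * ((1ℚ + fromℕℚ (suc m)) - 1ℚ)                  ≡⟨ cong (K *_) (solve 1 (λ f → (con 1ℚ :+ f) :- con 1ℚ := f) refl (fromℕℚ (suc m))) ⟩
    K * fromℕℚ (suc m)                                ≡⟨ fromℕℚ-* (suc k) (suc m) ⟨
    fromℕℚ (suc k ℕ.* suc m)                          ≡⟨ cong fromℕℚ (trans (ℕ.*-comm (suc k) (suc m)) (trans (ℕ.*-suc (suc m) k) (ℕ.+-comm (suc m) (suc m ℕ.* k)))) ⟩
    fromℕℚ (suc m ℕ.* k ℕ.+ suc m)                    ≤⟨ fromℕℚ-mono {l} {suc l} (ℕ.n≤1+n l) ⟩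
    fromℕℚ (suc (suc m ℕ.* k ℕ.+ suc m))              ≤⟨ le ⟩
    _                                                 ≡⟨ cong (λ x → expSum x n * f) (lnSum-harmonic k m) ⟨
    expSum (lnSum (suc k) m) n * f                    ∎)
    where
    open ≤-Reasoning
    K = fromℕℚ (suc k)
    i = inv (suc m)
    f = fromℕℚ (2 ℕ.+ m)
    l = suc m ℕ.* k ℕ.+ suc m
    n = proj₁ (expSum-harmonic-≥ (suc m ℕ.* k) (suc m))
    le = proj₂ (expSum-harmonic-≥ (suc m ℕ.* k) (suc m))

  -- For fixed `m` the lower bound comes with an uncontrolled number `M` of terms. Monotonicity in
  -- the argument and in the number of terms carries it to every diagonal index beyond both.
  expSum-lnSum-limit : ∀ k ε → 0ℚ < ε → ∃[ N ] (∀ n → N ℕ.≤ n →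
    ∣ expSum (lnSum (suc k) n) n - fromℕℚ (suc k) ∣ < ε)
  expSum-lnSum-limit k ε 0<ε =
    let (m , small) = archimedean-* (fromℕℚ (suc k)) ε (fromℕℚ-nonNeg (suc k)) 0<ε
        (M , le)    = expSum-lnSum-≥ k m
    in m ℕ.⊔ M , λ n ≤n → let
      m≤n = ℕ.m⊔n≤o⇒m≤o m M ≤n
      M≤n = ℕ.m⊔n≤o⇒n≤o m M ≤n
      e   = expSum (lnSum (suc k) n) n
      e≤K = expSum-lnSum-≤ k n n
    in begin-strict
    ∣ e - K ∣              ≡⟨ ∣-∣-comm e K ⟩
    ∣ K - e ∣              ≡⟨ 0≤p⇒∣p∣≡p (p≤q⇒0≤q-p e K e≤K) ⟩
    K - e                  ≤⟨ +-monoʳ-≤ K (neg-antimono-≤ (begin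
      K - K * inv (suc m)                ≤⟨ le ⟩
      expSum (lnSum (suc k) m) M         ≤⟨ expSum-monoˡ (lnSum (suc k) m) (lnSum (suc k) n) (lnSum-nonNeg k m) (lnSum-mono k (ℕ.≤⇒≤′ m≤n)) M ⟩
      expSum (lnSum (suc k) n) M         ≤⟨ expSum-mono (lnSum (suc k) n) (lnSum-nonNeg k n) M≤n ⟩
      e                                  ∎)) ⟩
    K - (K - K * inv (suc m))      ≡⟨ solve 2 (λ K x → K :- (K :- x) := x) refl K (K * inv (suc m)) ⟩
    K * inv (suc m)        <⟨ small (suc m) (ℕ.n≤1+n m) ⟩
    ε                      ∎
    where
    open ≤-Reasoning
    K = fromℕℚ (suc k)

-- Families of rational functions that define continuous real functions

module Regularity where

  open import Defs using (module Cauchy)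
  open import Data.Nat.Base as ℕ using (ℕ)
  import Data.Nat.Properties as ℕ
  open import Data.Product.Base using (∃-syntax; _×_; _,_; proj₁; proj₂)
  open import Data.Rational.Base
  open import Data.Rational.Properties
  open import Data.Rational.Solver using (module +-*-Solver)
  open import Data.Sum.Base using (inj₁; inj₂)
  open import Relation.Binary.PropositionalEquality
    using (refl; sym; trans; cong; cong₂; subst; subst₂)
  open Cauchy
  open +-*-Solver using (solve; _:+_; _:*_; _:-_; _:=_)

  -- The condition under which x ↦ (n ↦ f n (seq x n)) is a well-defined,
  -- continuous function of Cauchy reals.

  record Regular (f : ℕ → ℚ → ℚ) : Set where
    field
      bound : ∀ B → ∃[ C ] (∀ n p → ∣ p ∣ ≤ B → ∣ f n p ∣ ≤ C)
      close : ∀ B ε → 0ℚ < ε → ∃[ δ ] (0ℚ < δ × ∃[ N ] (∀ m n p q → N ℕ.≤ m → N ℕ.≤ n →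
              ∣ p ∣ ≤ B → ∣ q ∣ ≤ B → ∣ p - q ∣ < δ → ∣ f m p - f n q ∣ < ε))

  open Regular public

  id-regular : Regular (λ _ p → p)
  id-regular = record
    { bound = λ B → B , λ _ _ p≤B → p≤B
    ; close = λ _ ε 0<ε → ε , 0<ε , 0 , λ _ _ _ _ _ _ _ _ p-q<ε → p-q<ε
    }

  const-regular : ∀ a → IsCauchy a → Regular (λ n _ → a n)
  const-regular a ca = record
    { bound = λ _ → let (B , _ , a≤B) = bounded a ca in B , λ n _ _ → a≤B n
    ; close = λ _ ε 0<ε → let (N , near) = ca ε 0<ε in
        1ℚ , 0<1 , N , λ m n _ _ N≤m N≤n _ _ _ → near m n N≤m N≤n
    }

  *-regular : ∀ {f g} → Regular f → Regular g → Regular (λ n p → f n p * g n p)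
  *-regular {f} {g} rf rg = record { bound = bound′ ; close = close′ }
    where
    open ≤-Reasoning
    bound′ : ∀ B → ∃[ C ] (∀ n p → ∣ p ∣ ≤ B → ∣ f n p * g n p ∣ ≤ C)
    bound′ B with bound rf B | bound rg B
    ... | C , f≤C | D , g≤D = C * D , λ n p p≤B →
      subst (_≤ C * D) (sym (∣p*q∣≡∣p∣*∣q∣ (f n p) (g n p)))
        (*-mono (≤-trans (0≤∣p∣ (f n p)) (f≤C n p p≤B)) (0≤∣p∣ (g n p)) (f≤C n p p≤B) (g≤D n p p≤B))
    close′ : ∀ B ε → 0ℚ < ε → _
    close′ B ε 0<ε with bound rf B | bound rg B
    -- `C` and `D` may be negative when `B` is, hence the absolute values. The added 1 makes the
    -- divisor positive and leaves the surplus `1ℚ * η` that makes the final estimate strict.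
    ... | C , f≤C | D , g≤D with divide (∣ C ∣ + ∣ D ∣ + 1ℚ) ε 0<K 0<ε
      where
      0<K : 0ℚ < ∣ C ∣ + ∣ D ∣ + 1ℚ
      0<K = +-mono-≤-< (+-nonNeg (0≤∣p∣ C) (0≤∣p∣ D)) 0<1
    ... | η , 0<η , Kη≡ε with close rf B η 0<η | close rg B η 0<η
    ... | δ₁ , 0<δ₁ , N₁ , near₁ | δ₂ , 0<δ₂ , N₂ , near₂ =
      δ₁ ⊓ δ₂ , ⊓-pos , N₁ ℕ.⊔ N₂ , λ m n p q N≤m N≤n p≤B q≤B p-q<δ → let
        f- = near₁ m n p q (ℕ.m⊔n≤o⇒m≤o N₁ N₂ N≤m) (ℕ.m⊔n≤o⇒m≤o N₁ N₂ N≤n) p≤B q≤B (<-≤-trans p-q<δ (p⊓q≤p δ₁ δ₂))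
        g- = near₂ m n p q (ℕ.m⊔n≤o⇒n≤o N₁ N₂ N≤m) (ℕ.m⊔n≤o⇒n≤o N₁ N₂ N≤n) p≤B q≤B (<-≤-trans p-q<δ (p⊓q≤q δ₁ δ₂))
        a = f m p ; b = g m p ; c = f n q ; d = g n q
      in begin-strict
      ∣ a * b - c * d ∣
        ≡⟨ cong ∣_∣ (solve 4 (λ a b c d → a :* b :- c :* d := a :* (b :- d) :+ (a :- c) :* d) refl a b c d) ⟩
      ∣ a * (b - d) + (a - c) * d ∣              ≤⟨ ∣p+q∣≤∣p∣+∣q∣ (a * (b - d)) ((a - c) * d) ⟩
      ∣ a * (b - d) ∣ + ∣ (a - c) * d ∣          ≡⟨ cong₂ _+_ (∣p*q∣≡∣p∣*∣q∣ a (b - d)) (∣p*q∣≡∣p∣*∣q∣ (a - c) d) ⟩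
      ∣ a ∣ * ∣ b - d ∣ + ∣ a - c ∣ * ∣ d ∣      ≤⟨ +-mono-≤
        (*-mono (0≤∣p∣ C) (0≤∣p∣ (b - d)) (≤-trans (f≤C m p p≤B) (p≤∣p∣ C)) (<⇒≤ g-))
        (*-mono (<⇒≤ 0<η) (0≤∣p∣ d) (<⇒≤ f-) (≤-trans (g≤D n q q≤B) (p≤∣p∣ D))) ⟩
      ∣ C ∣ * η + η * ∣ D ∣                      ≡⟨ +-identityʳ _ ⟨
      ∣ C ∣ * η + η * ∣ D ∣ + 0ℚ                 <⟨ +-monoʳ-< (∣ C ∣ * η + η * ∣ D ∣) (subst (0ℚ <_) (sym (*-identityˡ η)) 0<η) ⟩
      ∣ C ∣ * η + η * ∣ D ∣ + 1ℚ * η             ≡⟨ solve 4 (λ C D e u → C :* e :+ e :* D :+ u :* e := (C :+ D :+ u) :* e) refl (∣ C ∣) (∣ D ∣) η 1ℚ ⟩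
      (∣ C ∣ + ∣ D ∣ + 1ℚ) * η                   ≡⟨ Kη≡ε ⟩
      ε                                          ∎
      where
      ⊓-pos : 0ℚ < δ₁ ⊓ δ₂
      ⊓-pos with ⊓-sel δ₁ δ₂
      ... | inj₁ eq = subst (0ℚ <_) (sym eq) 0<δ₁
      ... | inj₂ eq = subst (0ℚ <_) (sym eq) 0<δ₂

  ∘-regular : ∀ {f g} → Regular f → Regular g → Regular (λ n p → f n (g n p))
  ∘-regular {f} {g} rf rg = record { bound = bound′ ; close = close′ }
    where
    bound′ : ∀ B → ∃[ C ] (∀ n p → ∣ p ∣ ≤ B → ∣ f n (g n p) ∣ ≤ C)
    bound′ B with bound rg B
    ... | C , g≤C with bound rf C
    ... | D , f≤D = D , λ n p p≤B → f≤D n (g n p) (g≤C n p p≤B)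
    close′ : ∀ B ε → 0ℚ < ε → _
    close′ B ε 0<ε with bound rg B
    ... | C , g≤C with close rf C ε 0<ε
    ... | η , 0<η , N₁ , near₁ with close rg B η 0<η
    ... | δ , 0<δ , N₂ , near₂ = δ , 0<δ , N₁ ℕ.⊔ N₂ , λ m n p q N≤m N≤n p≤B q≤B p-q<δ →
      near₁ m n (g m p) (g n q) (ℕ.m⊔n≤o⇒m≤o N₁ N₂ N≤m) (ℕ.m⊔n≤o⇒m≤o N₁ N₂ N≤n) (g≤C m p p≤B) (g≤C n q q≤B)
        (near₂ m n p q (ℕ.m⊔n≤o⇒n≤o N₁ N₂ N≤m) (ℕ.m⊔n≤o⇒n≤o N₁ N₂ N≤n) p≤B q≤B p-q<δ)

  exp-regular : Regular (λ n p → expSum p n)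
  exp-regular = record
    { bound = λ B → let open Bounded B in
        D , λ n p p≤B → ≤-trans (expSum≤E (≤-trans p≤B B≤) n) (E≤D n)
    ; close = λ B ε 0<ε → let
        open Bounded B
        (η , 0<η , η+η≡ε) = halve ε 0<ε
        (δ , 0<δ , Dδ≡η)  = divide D η 0<D 0<η
        (N , near)        = E-cauchy η 0<η
      in δ , 0<δ , N , λ m n p q N≤m N≤n p≤B q≤B p-q<δ → begin-strict
        ∣ expSum p m - expSum q n ∣                                 ≤⟨ ∣-∣-triangle (expSum p m) (expSum p n) (expSum q n) ⟩
        ∣ expSum p m - expSum p n ∣ + ∣ expSum p n - expSum q n ∣   ≤⟨ +-mono-≤ (expSum-tail′ (≤-trans p≤B B≤) m n)
                                                                         (expSum-lip (≤-trans p≤B B≤) (≤-trans q≤B B≤) n) ⟩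
        ∣ E m - E n ∣ + ∣ p - q ∣ * E n                             <⟨ +-mono-<-≤ (near m n N≤m N≤n)
                                                                         (*-mono (<⇒≤ 0<δ) (E-mono {0} {n} (ℕ.≤⇒≤′ ℕ.z≤n)) (<⇒≤ p-q<δ) (E≤D n)) ⟩
        η + δ * D                                                   ≡⟨ cong (η +_) (trans (*-comm δ D) Dδ≡η) ⟩
        η + η                                                       ≡⟨ η+η≡ε ⟩
        ε                                                           ∎
    }
    where
    open ≤-Reasoning
    module Bounded (B : ℚ) where
      -- `B` may be negative, while `ExpBound` requires a nonnegative radius.
      open ExpBound (∣ B ∣) (0≤∣p∣ B) public
      B≤ : B ≤ ∣ B ∣
      B≤ = p≤∣p∣ B
      E-bounded = bounded E E-cauchy
      D   = proj₁ E-bounded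
      0<D = proj₁ (proj₂ E-bounded)
      E≤D : ∀ n → E n ≤ D
      E≤D n = ≤-trans (p≤∣p∣ (E n)) (proj₂ (proj₂ E-bounded) n)
      expSum≤E : ∀ {p} → ∣ p ∣ ≤ ∣ B ∣ → ∀ n → ∣ expSum p n ∣ ≤ E n
      expSum≤E {p} p≤B n = subst₂ _≤_ (cong ∣_∣ (+-identityʳ (expSum p n))) (+-identityʳ (E n))
        (expSum-tail p≤B {0} {n} (ℕ.≤⇒≤′ ℕ.z≤n))

-- Rescaled summatory functions and their modulus

module Limit where

  open import Defs using (module Cauchy)
  open import Data.Integer.Base as ℤ using (+_; -[1+_])
  import Data.Integer.Properties as ℤ
  open import Data.Nat.Base as ℕ using (ℕ; zero; suc)
  import Data.Nat.DivMod as ℕ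
  import Data.Nat.Properties as ℕ
  open import Data.Nat.Tactic.RingSolver using (solve-∀)
  open import Data.Product.Base using (∃-syntax; _×_; _,_; proj₁; proj₂)
  open import Data.Rational.Base
  open import Data.Rational.Properties
  open import Data.Rational.Solver using (module +-*-Solver)
  import Data.Rational.Unnormalised.Base as ℚᵘ
  import Data.Rational.Unnormalised.Properties as ℚᵘ
  open import Data.Sum.Base using (_⊎_; inj₁; inj₂)
  open import Relation.Binary.PropositionalEquality
    using (_≡_; refl; sym; trans; cong; cong₂; subst; subst₂; module ≡-Reasoning)
  open Cauchy
  open Counting using (summatory; summatory-scale; summatory-mono; summatory-+)
  open Exponential using (fromℕℚ-+; fromℕℚ-*; fromℕℚ-mono)
  open Regularity
  open +-*-Solver using (solve; _:+_; _:*_; _:-_; _:=_; :-_)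

  fromℕℚ≃ : ∀ c → toℚᵘ (fromℕℚ c) ℚᵘ.≃ ℚᵘ.mkℚᵘ (+ c) 0
  fromℕℚ≃ c = toℚᵘ-fromℚᵘ (ℚᵘ.mkℚᵘ (+ c) 0)

  fromℕℚ≤⁻ : ∀ {c p} → fromℕℚ c ≤ p → + c ℤ.* ↧ p ℤ.≤ ↥ p
  fromℕℚ≤⁻ {c} {p@record{}} h = subst (+ c ℤ.* ↧ p ℤ.≤_) (ℤ.*-identityʳ (↥ p))
    (ℚᵘ.drop-*≤* (ℚᵘ.≤-respˡ-≃ (fromℕℚ≃ c) (toℚᵘ-mono-≤ h)))

  fromℕℚ≤⁺ : ∀ {c p} → + c ℤ.* ↧ p ℤ.≤ ↥ p → fromℕℚ c ≤ p
  fromℕℚ≤⁺ {c} {p@record{}} h = toℚᵘ-cancel-≤ (ℚᵘ.≤-respˡ-≃ (ℚᵘ.≃-sym (fromℕℚ≃ c))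
    (ℚᵘ.*≤* (subst (+ c ℤ.* ↧ p ℤ.≤_) (sym (ℤ.*-identityʳ (↥ p))) h)))

  ≤fromℕℚ⁻ : ∀ {c p} → p ≤ fromℕℚ c → ↥ p ℤ.≤ + c ℤ.* ↧ p
  ≤fromℕℚ⁻ {c} {p@record{}} h = subst (ℤ._≤ + c ℤ.* ↧ p) (ℤ.*-identityʳ (↥ p))
    (ℚᵘ.drop-*≤* (ℚᵘ.≤-respʳ-≃ (fromℕℚ≃ c) (toℚᵘ-mono-≤ h)))

  ≤fromℕℚ⁺ : ∀ {c p} → ↥ p ℤ.≤ + c ℤ.* ↧ p → p ≤ fromℕℚ c
  ≤fromℕℚ⁺ {c} {p@record{}} h = toℚᵘ-cancel-≤ (ℚᵘ.≤-respʳ-≃ (ℚᵘ.≃-sym (fromℕℚ≃ c))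
    (ℚᵘ.*≤* (subst (ℤ._≤ + c ℤ.* ↧ p) (sym (ℤ.*-identityʳ (↥ p))) h)))

  -- Negative rationals are sent to 0 to make `limit` total. The result can then exceed the
  -- argument, whence the alternative in `floorℕ-sound`.
  floorℕ : ℚ → ℕ
  floorℕ (mkℚ (+ a)    d _) = a ℕ./ suc d
  floorℕ (mkℚ -[1+ _ ] _ _) = 0

  floorℕ-greatest : ∀ {c p} → fromℕℚ c ≤ p → c ℕ.≤ floorℕ p
  floorℕ-greatest {c} {p@(mkℚ (+ a) d _)} h = subst (ℕ._≤ a ℕ./ suc d) (ℕ.m*n/n≡m c (suc d))
    (ℕ./-monoˡ-≤ (suc d) (ℤ.drop‿+≤+ (subst (ℤ._≤ + a) (sym (ℤ.pos-* c (suc d))) (fromℕℚ≤⁻ {c} {p} h))))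
  floorℕ-greatest {c} {p@(mkℚ -[1+ a ] d _)} h
    with () ← subst (ℤ._≤ -[1+ a ]) (sym (ℤ.pos-* c (suc d))) (fromℕℚ≤⁻ {c} {p} h)

  floorℕ-≤ : ∀ {c p} → p ≤ fromℕℚ c → floorℕ p ℕ.≤ c
  floorℕ-≤ {c} {p@(mkℚ (+ a) d _)} h = subst (a ℕ./ suc d ℕ.≤_) (ℕ.m*n/n≡m c (suc d))
    (ℕ./-monoˡ-≤ (suc d) (ℤ.drop‿+≤+ (subst (+ a ℤ.≤_) (sym (ℤ.pos-* c (suc d))) (≤fromℕℚ⁻ {c} {p} h))))
  floorℕ-≤ {p = mkℚ -[1+ _ ] _ _} _ = ℕ.z≤n

  ≤suc-floorℕ : ∀ p → p ≤ fromℕℚ (suc (floorℕ p))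
  ≤suc-floorℕ p@(mkℚ (+ a) d _) = ≤fromℕℚ⁺ {suc (floorℕ p)} {p}
    (subst (+ a ℤ.≤_) (ℤ.pos-* (suc (a ℕ./ suc d)) (suc d)) (ℤ.+≤+ (begin
      a                                             ≡⟨ ℕ.m≡m%n+[m/n]*n a (suc d) ⟩
      a ℕ.% suc d ℕ.+ a ℕ./ suc d ℕ.* suc d         ≤⟨ ℕ.+-monoˡ-≤ _ (ℕ.<⇒≤ (ℕ.m%n<n a (suc d))) ⟩
      suc (a ℕ./ suc d) ℕ.* suc d                   ∎)))
    where open ℕ.≤-Reasoning
  ≤suc-floorℕ p@(mkℚ -[1+ _ ] _ _) = ≤fromℕℚ⁺ {1} {p} ℤ.-≤+

  floorℕ-sound : ∀ p → floorℕ p ≡ 0 ⊎ fromℕℚ (floorℕ p) ≤ p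
  floorℕ-sound p@(mkℚ (+ a) d _) = inj₂ (fromℕℚ≤⁺ {floorℕ p} {p}
    (subst (ℤ._≤ + a) (ℤ.pos-* (a ℕ./ suc d) (suc d)) (ℤ.+≤+ (ℕ.m/n*n≤m a (suc d)))))
  floorℕ-sound (mkℚ -[1+ _ ] _ _) = inj₁ refl

  -- The power 3⁻ⁿ: `inv` is shifted, so `inv 2` is 1/3.
  3⁻ : ℕ → ℚ
  3⁻ zero    = 1ℚ
  3⁻ (suc n) = inv 2 * 3⁻ n

  3⁻-nonNeg : ∀ n → 0ℚ ≤ 3⁻ n
  3⁻-nonNeg zero    = <⇒≤ 0<1
  3⁻-nonNeg (suc n) = *-nonNeg (inv-nonNeg 2) (3⁻-nonNeg n)

  3⁻-+ : ∀ k n → fromℕℚ (3 ℕ.^ k) * 3⁻ (k ℕ.+ n) ≡ 3⁻ n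
  3⁻-+ zero    n = *-identityˡ (3⁻ n)
  3⁻-+ (suc k) n = begin
    fromℕℚ (3 ℕ.* 3 ℕ.^ k) * (inv 2 * r)              ≡⟨ cong (_* (inv 2 * r)) (fromℕℚ-* 3 (3 ℕ.^ k)) ⟩
    fromℕℚ 3 * fromℕℚ (3 ℕ.^ k) * (inv 2 * r)         ≡⟨ solve 4 (λ a b c d → a :* b :* (c :* d) := a :* c :* (b :* d)) refl (fromℕℚ 3) (fromℕℚ (3 ℕ.^ k)) (inv 2) r ⟩
    fromℕℚ 3 * inv 2 * (fromℕℚ (3 ℕ.^ k) * r)         ≡⟨ *-identityˡ _ ⟩
    fromℕℚ (3 ℕ.^ k) * r                              ≡⟨ 3⁻-+ k n ⟩
    3⁻ n                                              ∎
    where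
    open ≡-Reasoning
    r = 3⁻ (k ℕ.+ n)

  -- The geometric decay of (2/3)ⁿ is weakened to a multiple of `inv n`, the shape to which
  -- `archimedean-*` applies.
  2^n*3⁻n≤ : ∀ n → fromℕℚ (2 ℕ.^ n) * 3⁻ n ≤ fromℕℚ 2 * inv n
  2^n*3⁻n≤ n = begin
    a * r                               ≡⟨ *-identityʳ (a * r) ⟨
    a * r * 1ℚ                          ≡⟨ cong (a * r *_) (fromℕℚ-*-inv n) ⟨
    a * r * (fromℕℚ (suc n) * inv n)    ≡⟨ solve 4 (λ a r f i → a :* r :* (f :* i) := f :* a :* (r :* i)) refl a r (fromℕℚ (suc n)) (inv n) ⟩
    fromℕℚ (suc n) * a * (r * inv n)    ≡⟨ cong (_* (r * inv n)) (fromℕℚ-* (suc n) (2 ℕ.^ n)) ⟨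
    fromℕℚ (suc n ℕ.* 2 ℕ.^ n) * (r * inv n)
                                        ≤⟨ *-monoʳ (r * inv n) (*-nonNeg (3⁻-nonNeg n) (inv-nonNeg n))
                                             (fromℕℚ-mono {suc n ℕ.* 2 ℕ.^ n} {2 ℕ.* 3 ℕ.^ n} (ℕ.≤-trans (ℕ.*-monoˡ-≤ (2 ℕ.^ n) (ℕ.n≤1+n (suc n))) (grow n))) ⟩
    fromℕℚ (2 ℕ.* 3 ℕ.^ n) * (r * inv n)
                                        ≡⟨ cong (_* (r * inv n)) (fromℕℚ-* 2 (3 ℕ.^ n)) ⟩
    fromℕℚ 2 * fromℕℚ (3 ℕ.^ n) * (r * inv n)
                                        ≡⟨ solve 4 (λ t f r i → t :* f :* (r :* i) := f :* r :* (t :* i)) refl (fromℕℚ 2) (fromℕℚ (3 ℕ.^ n)) r (inv n) ⟩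
    fromℕℚ (3 ℕ.^ n) * r * (fromℕℚ 2 * inv n)
                                        ≡⟨ cong (_* (fromℕℚ 2 * inv n)) (trans (cong (λ k → fromℕℚ (3 ℕ.^ n) * 3⁻ k) (sym (ℕ.+-identityʳ n))) (3⁻-+ n 0)) ⟩
    1ℚ * (fromℕℚ 2 * inv n)             ≡⟨ *-identityˡ _ ⟩
    fromℕℚ 2 * inv n                    ∎
    where
    open ≤-Reasoning
    a = fromℕℚ (2 ℕ.^ n)
    r = 3⁻ n
    -- The factor `2 + n` rather than `1 + n` carries the induction: 2(n + 3) ≤ 3(n + 2) always
    -- holds, but 2(n + 2) ≤ 3(n + 1) fails at 0.
    grow : ∀ n → (2 ℕ.+ n) ℕ.* 2 ℕ.^ n ℕ.≤ 2 ℕ.* 3 ℕ.^ n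
    grow zero    = ℕ.≤-refl
    grow (suc n) = ℕ≤.begin
      (3 ℕ.+ n) ℕ.* (2 ℕ.* 2 ℕ.^ n)                    ℕ≤.≤⟨ ℕ.m≤m+n _ (n ℕ.* 2 ℕ.^ n) ⟩
      (3 ℕ.+ n) ℕ.* (2 ℕ.* 2 ℕ.^ n) ℕ.+ n ℕ.* 2 ℕ.^ n   ℕ≤.≡⟨ lemma n (2 ℕ.^ n) ⟩
      3 ℕ.* ((2 ℕ.+ n) ℕ.* 2 ℕ.^ n)                    ℕ≤.≤⟨ ℕ.*-monoʳ-≤ 3 (grow n) ⟩
      3 ℕ.* (2 ℕ.* 3 ℕ.^ n)                            ℕ≤.≡⟨ lemma′ (3 ℕ.^ n) ⟩
      2 ℕ.* (3 ℕ.* 3 ℕ.^ n)                            ℕ≤.∎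
      where
      module ℕ≤ = ℕ.≤-Reasoning
      lemma : ∀ n p → (3 ℕ.+ n) ℕ.* (2 ℕ.* p) ℕ.+ n ℕ.* p ≡ 3 ℕ.* ((2 ℕ.+ n) ℕ.* p)
      lemma = solve-∀
      lemma′ : ∀ p → 3 ℕ.* (2 ℕ.* p) ≡ 2 ℕ.* (3 ℕ.* p)
      lemma′ = solve-∀

  -- limit n p approximates the continuous function F with F m = summatory m
  -- and F (2 y) = 3 F y.

  limit : ℕ → ℚ → ℚ
  limit n p = fromℕℚ (summatory (floorℕ (fromℕℚ (2 ℕ.^ n) * p))) * 3⁻ n

  scaled : ℕ → ℚ → ℚ
  scaled n p = fromℕℚ (2 ℕ.^ n) * p

  scaled-+ : ∀ k n p → scaled (k ℕ.+ n) p ≡ scaled n p * fromℕℚ (2 ℕ.^ k)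
  scaled-+ k n p = begin
    fromℕℚ (2 ℕ.^ (k ℕ.+ n)) * p                    ≡⟨ cong (λ m → fromℕℚ m * p) (ℕ.^-distribˡ-+-* 2 k n) ⟩
    fromℕℚ (2 ℕ.^ k ℕ.* 2 ℕ.^ n) * p                ≡⟨ cong (_* p) (fromℕℚ-* (2 ℕ.^ k) (2 ℕ.^ n)) ⟩
    fromℕℚ (2 ℕ.^ k) * fromℕℚ (2 ℕ.^ n) * p         ≡⟨ solve 3 (λ a b p → a :* b :* p := b :* p :* a) refl (fromℕℚ (2 ℕ.^ k)) (fromℕℚ (2 ℕ.^ n)) p ⟩
    scaled n p * fromℕℚ (2 ℕ.^ k)                   ∎
    where open ≡-Reasoning

  -- The dyadic point c / 2ⁿ has the same value at level `n` as at every finer level `k + n`.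
  rescale : ∀ c k n → fromℕℚ (summatory c) * 3⁻ n ≡ fromℕℚ (summatory (c ℕ.* 2 ℕ.^ k)) * 3⁻ (k ℕ.+ n)
  rescale c k n = begin
    fromℕℚ A * 3⁻ n                                             ≡⟨ cong (fromℕℚ A *_) (3⁻-+ k n) ⟨
    fromℕℚ A * (fromℕℚ (3 ℕ.^ k) * 3⁻ (k ℕ.+ n))                ≡⟨ *-assoc (fromℕℚ A) (fromℕℚ (3 ℕ.^ k)) (3⁻ (k ℕ.+ n)) ⟨
    fromℕℚ A * fromℕℚ (3 ℕ.^ k) * 3⁻ (k ℕ.+ n)                  ≡⟨ cong (_* 3⁻ (k ℕ.+ n)) (fromℕℚ-* A (3 ℕ.^ k)) ⟨
    fromℕℚ (A ℕ.* 3 ℕ.^ k) * 3⁻ (k ℕ.+ n)                       ≡⟨ cong (λ m → fromℕℚ m * 3⁻ (k ℕ.+ n)) (summatory-scale k c) ⟨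
    fromℕℚ (summatory (c ℕ.* 2 ℕ.^ k)) * 3⁻ (k ℕ.+ n)           ∎
    where
    open ≡-Reasoning
    A = summatory c

  *3⁻-mono : ∀ {a b} n → a ℕ.≤ b → fromℕℚ a * 3⁻ n ≤ fromℕℚ b * 3⁻ n
  *3⁻-mono {a} {b} n a≤b = *-monoʳ (3⁻ n) (3⁻-nonNeg n) (fromℕℚ-mono {a} {b} a≤b)

  -- A dyadic point of level `n` below `p` is also one of level `m`, with the same value, and
  -- `summatory` is monotone. The alternative `c ≡ 0` covers negative `p`.
  limit-lower : ∀ {c} n m p → n ℕ.≤ m → c ≡ 0 ⊎ fromℕℚ c ≤ scaled n p →
                fromℕℚ (summatory c) * 3⁻ n ≤ limit m p
  limit-lower {c} n m p n≤m h = subst (λ m → fromℕℚ (summatory c) * 3⁻ n ≤ limit m p) (ℕ.m∸n+n≡m n≤m)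
    (subst (_≤ limit (k ℕ.+ n) p) (sym (rescale c k n)) (*3⁻-mono (k ℕ.+ n) (summatory-mono (le h))))
    where
    k = m ℕ.∸ n
    le : c ≡ 0 ⊎ fromℕℚ c ≤ scaled n p → c ℕ.* 2 ℕ.^ k ℕ.≤ floorℕ (scaled (k ℕ.+ n) p)
    le (inj₁ refl) = ℕ.z≤n
    le (inj₂ h)    = floorℕ-greatest {c ℕ.* 2 ℕ.^ k} (subst₂ _≤_ (sym (fromℕℚ-* c (2 ℕ.^ k))) (sym (scaled-+ k n p))
      (*-monoʳ (fromℕℚ (2 ℕ.^ k)) (fromℕℚ-nonNeg (2 ℕ.^ k)) h))

  limit-upper : ∀ {c} n m p → n ℕ.≤ m → scaled n p ≤ fromℕℚ c →
                limit m p ≤ fromℕℚ (summatory c) * 3⁻ n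
  limit-upper {c} n m p n≤m h = subst (λ m → limit m p ≤ fromℕℚ (summatory c) * 3⁻ n) (ℕ.m∸n+n≡m n≤m)
    (subst (limit (k ℕ.+ n) p ≤_) (sym (rescale c k n)) (*3⁻-mono (k ℕ.+ n) (summatory-mono
      (floorℕ-≤ {c ℕ.* 2 ℕ.^ k} (subst₂ _≤_ (sym (scaled-+ k n p)) (sym (fromℕℚ-* c (2 ℕ.^ k)))
        (*-monoʳ (fromℕℚ (2 ℕ.^ k)) (fromℕℚ-nonNeg (2 ℕ.^ k)) h))))))
    where
    k = m ℕ.∸ n

  -- A natural number is a dyadic point of level 0, bounding itself from both sides; hence equality
  -- at every index and not only in the limit.
  limit-fromℕℚ : ∀ m n → limit n (fromℕℚ m) ≡ fromℕℚ (summatory m)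
  limit-fromℕℚ m n = ≤-antisym
    (subst (limit n (fromℕℚ m) ≤_) (*-identityʳ (fromℕℚ (summatory m)))
      (limit-upper {m} 0 n (fromℕℚ m) ℕ.z≤n (≤-reflexive (*-identityˡ (fromℕℚ m)))))
    (subst (_≤ limit n (fromℕℚ m)) (*-identityʳ (fromℕℚ (summatory m)))
      (limit-lower {m} 0 n (fromℕℚ m) ℕ.z≤n (inj₂ (≤-reflexive (sym (*-identityˡ (fromℕℚ m)))))))

  limit-double : ∀ n p → limit n (p * fromℕℚ 2) ≡ fromℕℚ 3 * limit (suc n) p
  limit-double n p = begin
    fromℕℚ (summatory (floorℕ (scaled n (p * fromℕℚ 2)))) * 3⁻ n
      ≡⟨ cong₂ (λ q r → fromℕℚ (summatory (floorℕ q)) * r)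
           (trans (sym (*-assoc (fromℕℚ (2 ℕ.^ n)) p (fromℕℚ 2))) (sym (scaled-+ 1 n p))) (sym (3⁻-+ 1 n)) ⟩
    A * (fromℕℚ 3 * 3⁻ (suc n))
      ≡⟨ solve 3 (λ a t r → a :* (t :* r) := t :* (a :* r)) refl A (fromℕℚ 3) (3⁻ (suc n)) ⟩
    fromℕℚ 3 * limit (suc n) p ∎
    where
    open ≡-Reasoning
    A = fromℕℚ (summatory (floorℕ (scaled (suc n) p)))

  limit-nonNeg : ∀ n p → 0ℚ ≤ limit n p
  limit-nonNeg n p = *-nonNeg (fromℕℚ-nonNeg (summatory (floorℕ (scaled n p)))) (3⁻-nonNeg n)

  abs-between : ∀ {a b p q} → a ≤ p → p ≤ b → a ≤ q → q ≤ b → ∣ p - q ∣ ≤ b - a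
  abs-between {a} {b} {p} {q} a≤p p≤b a≤q q≤b = ∣p∣≤ (+-mono-≤ p≤b (neg-antimono-≤ a≤q))
    (subst (_≤ b - a) (solve 2 (λ p q → q :- p := :- (p :- q)) refl p q)
      (+-mono-≤ q≤b (neg-antimono-≤ a≤p)))

  -- The scaled points differ by at most 1, and for nonnegative `p` the scaled `p` lies between `a`
  -- and a + 1; so the scaled `q` lies between a - 1 and a + 2.
  limit-nearby : ∀ n m p q → n ℕ.≤ m → scaled n ∣ p - q ∣ ≤ 1ℚ → let a = floorℕ (scaled n p) in
    fromℕℚ (summatory (a ℕ.∸ 1)) * 3⁻ n ≤ limit m q × limit m q ≤ fromℕℚ (summatory (2 ℕ.+ a)) * 3⁻ n
  limit-nearby n m p q n≤m close =
    limit-lower {a ℕ.∸ 1} n m q n≤m (lower a (floorℕ-sound (scaled n p))) ,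
    limit-upper {2 ℕ.+ a} n m q n≤m upper
    where
    open ≤-Reasoning
    a = floorℕ (scaled n p)
    two = fromℕℚ (2 ℕ.^ n)
    0≤two = fromℕℚ-nonNeg (2 ℕ.^ n)
    p≤q+1 : scaled n p ≤ 1ℚ + scaled n q
    p≤q+1 = begin
      scaled n p                       ≤⟨ *-monoˡ two 0≤two (p≤∣p-q∣+q p q) ⟩
      two * (∣ p - q ∣ + q)            ≡⟨ *-distribˡ-+ two ∣ p - q ∣ q ⟩
      scaled n ∣ p - q ∣ + scaled n q  ≤⟨ +-monoˡ-≤ (scaled n q) close ⟩
      1ℚ + scaled n q                  ∎
      where
      p≤∣p-q∣+q : ∀ p q → p ≤ ∣ p - q ∣ + q
      p≤∣p-q∣+q p q = subst (_≤ ∣ p - q ∣ + q) (solve 2 (λ p q → (p :- q) :+ q := p) refl p q)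
        (+-monoˡ-≤ q (p≤∣p∣ (p - q)))
    lower : ∀ a → a ≡ 0 ⊎ fromℕℚ a ≤ scaled n p → a ℕ.∸ 1 ≡ 0 ⊎ fromℕℚ (a ℕ.∸ 1) ≤ scaled n q
    lower a       (inj₁ refl) = inj₁ refl
    lower zero    (inj₂ _)    = inj₁ refl
    lower (suc c) (inj₂ h)    = inj₂ (subst₂ _≤_
      (solve 2 (λ u c → (u :+ c) :- u := c) refl 1ℚ (fromℕℚ c))
      (solve 2 (λ u c → (u :+ c) :- u := c) refl 1ℚ (scaled n q))
      (+-monoˡ-≤ (- 1ℚ) (≤-trans (subst (_≤ scaled n p) (fromℕℚ-suc c) h) p≤q+1)))
    upper : scaled n q ≤ fromℕℚ (2 ℕ.+ a)
    upper = begin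
      scaled n q                        ≤⟨ *-monoˡ two 0≤two q≤ ⟩
      two * (∣ p - q ∣ + p)             ≡⟨ *-distribˡ-+ two ∣ p - q ∣ p ⟩
      scaled n ∣ p - q ∣ + scaled n p   ≤⟨ +-mono-≤ close (≤suc-floorℕ (scaled n p)) ⟩
      1ℚ + fromℕℚ (suc a)               ≡⟨ fromℕℚ-suc (suc a) ⟨
      fromℕℚ (2 ℕ.+ a)                  ∎
      where
      q≤ : q ≤ ∣ p - q ∣ + p
      q≤ = subst₂ _≤_ (solve 2 (λ p q → (q :- p) :+ p := q) refl p q) (cong (_+ p) (∣-∣-comm q p))
        (+-monoˡ-≤ p (p≤∣p∣ (q - p)))

  limit-modulus : ∀ b n m k p q → n ℕ.≤ m → n ℕ.≤ k → p ≤ fromℕℚ b → scaled n ∣ p - q ∣ ≤ 1ℚ →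
    ∣ limit m p - limit k q ∣ ≤ fromℕℚ (3 ℕ.* (3 ℕ.+ b)) * fromℕℚ 2 * inv n
  limit-modulus b n m k p q n≤m n≤k p≤b close = begin
    ∣ limit m p - limit k q ∣                         ≤⟨ abs-between (proj₁ near-p) (proj₂ near-p) (proj₁ near-q) (proj₂ near-q) ⟩
    fromℕℚ (summatory (2 ℕ.+ a)) * r - fromℕℚ S * r   ≤⟨ p≤q+r⇒p-q≤r _ (fromℕℚ S * r) (begin
      fromℕℚ (summatory (2 ℕ.+ a)) * r                  ≤⟨ *3⁻-mono {summatory (2 ℕ.+ a)} {S ℕ.+ D ℕ.* 2^n} n growth ⟩
      fromℕℚ (S ℕ.+ D ℕ.* 2^n) * r                      ≡⟨ cong (_* r) (fromℕℚ-+ S (D ℕ.* 2^n)) ⟩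
      (fromℕℚ S + fromℕℚ (D ℕ.* 2^n)) * r               ≡⟨ *-distribʳ-+ r (fromℕℚ S) (fromℕℚ (D ℕ.* 2^n)) ⟩
      fromℕℚ S * r + fromℕℚ (D ℕ.* 2^n) * r             ∎) ⟩
    fromℕℚ (D ℕ.* 2^n) * r                            ≡⟨ cong (_* r) (fromℕℚ-* D 2^n) ⟩
    fromℕℚ D * fromℕℚ 2^n * r                         ≡⟨ *-assoc (fromℕℚ D) (fromℕℚ 2^n) r ⟩
    fromℕℚ D * (fromℕℚ 2^n * r)                       ≤⟨ *-monoˡ (fromℕℚ D) (fromℕℚ-nonNeg D) (2^n*3⁻n≤ n) ⟩
    fromℕℚ D * (fromℕℚ 2 * inv n)                     ≡⟨ *-assoc (fromℕℚ D) (fromℕℚ 2) (inv n) ⟨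
    fromℕℚ D * fromℕℚ 2 * inv n                       ∎
    where
    open ≤-Reasoning
    a = floorℕ (scaled n p)
    r = 3⁻ n
    S = summatory (a ℕ.∸ 1)
    -- Three terms are added to `S`, each at most 3 + (a - 1) ≤ (3 + b) 2ⁿ, or 3 when `a` is 0.
    D = 3 ℕ.* (3 ℕ.+ b)
    2^n = 2 ℕ.^ n
    -- Taking `q = p` here confines both values to the same interval, determined by `a`.
    near-p = limit-nearby n m p p n≤m (subst (_≤ 1ℚ)
      (sym (trans (cong (λ t → scaled n ∣ t ∣) (+-inverseʳ p)) (*-zeroʳ (fromℕℚ 2^n)))) (<⇒≤ 0<1))
    near-q = limit-nearby n k p q n≤k close
    a≤ : a ℕ.≤ 2^n ℕ.* b
    a≤ = floorℕ-≤ {2^n ℕ.* b} (subst (scaled n p ≤_) (sym (fromℕℚ-* 2^n b))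
      (*-monoˡ (fromℕℚ 2^n) (fromℕℚ-nonNeg 2^n) p≤b))
    2+a≤ : ∀ a → 2 ℕ.+ a ℕ.≤ 3 ℕ.+ (a ℕ.∸ 1)
    2+a≤ zero    = ℕ.n≤1+n 2
    2+a≤ (suc a) = ℕ.≤-refl
    growth : summatory (2 ℕ.+ a) ℕ.≤ S ℕ.+ D ℕ.* 2^n
    growth = ℕ≤.begin
      summatory (2 ℕ.+ a)                   ℕ≤.≤⟨ summatory-mono (2+a≤ a) ⟩
      summatory (3 ℕ.+ c)                   ℕ≤.≤⟨ summatory-+ c 3 ⟩
      S ℕ.+ 3 ℕ.* (3 ℕ.+ c)                 ℕ≤.≤⟨ ℕ.+-monoʳ-≤ S (ℕ.*-monoʳ-≤ 3 (ℕ.+-mono-≤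
                                                    (ℕ.*-monoʳ-≤ 3 (ℕ.m^n>0 2 n)) (ℕ.≤-trans (ℕ.m∸n≤m a 1) a≤))) ⟩
      S ℕ.+ 3 ℕ.* (3 ℕ.* 2^n ℕ.+ 2^n ℕ.* b) ℕ≤.≡⟨ cong (S ℕ.+_) (lemma b 2^n) ⟩
      S ℕ.+ D ℕ.* 2^n                       ℕ≤.∎
      where
      module ℕ≤ = ℕ.≤-Reasoning
      c = a ℕ.∸ 1
      lemma : ∀ b t → 3 ℕ.* (3 ℕ.* t ℕ.+ t ℕ.* b) ≡ 3 ℕ.* (3 ℕ.+ b) ℕ.* t
      lemma = solve-∀

  -- A single level `n` fixes everything: the radius is its mesh 2⁻ⁿ, and the estimate holds from
  -- index `n` on.
  limit-regular : Regular limit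
  limit-regular = record
    { bound = λ B → let b = suc (floorℕ B) in fromℕℚ (summatory b) * 1ℚ , λ n p p≤B →
        subst (_≤ fromℕℚ (summatory b) * 1ℚ) (sym (0≤p⇒∣p∣≡p (limit-nonNeg n p)))
          (limit-upper {b} 0 n p ℕ.z≤n (subst (_≤ fromℕℚ b) (sym (*-identityˡ p)) (≤ceiling B p≤B)))
    ; close = λ B ε 0<ε → let
        b = suc (floorℕ B)
        K = fromℕℚ (3 ℕ.* (3 ℕ.+ b)) * fromℕℚ 2
        (n , small) = archimedean-* K ε (*-nonNeg (fromℕℚ-nonNeg (3 ℕ.* (3 ℕ.+ b))) (fromℕℚ-nonNeg 2)) 0<ε
        (δ , 0<δ , 2^nδ≡1) = divide (fromℕℚ (2 ℕ.^ n)) 1ℚ (0<2^ n) 0<1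
      in δ , 0<δ , n , λ m k p q n≤m n≤k p≤B _ p-q<δ → ≤-<-trans
        (limit-modulus b n m k p q n≤m n≤k (≤ceiling B p≤B)
          (subst (scaled n ∣ p - q ∣ ≤_) 2^nδ≡1 (*-monoˡ (fromℕℚ (2 ℕ.^ n)) (<⇒≤ (0<2^ n)) (<⇒≤ p-q<δ))))
        (small n ℕ.≤-refl)
    }
    where
    ≤ceiling : ∀ B {p} → ∣ p ∣ ≤ B → p ≤ fromℕℚ (suc (floorℕ B))
    ≤ceiling B {p} p≤B = ≤-trans (p≤∣p∣ p) (≤-trans p≤B (≤suc-floorℕ B))
    0<2^ : ∀ n → 0ℚ < fromℕℚ (2 ℕ.^ n)
    0<2^ n = <-≤-trans 0<1 (fromℕℚ-mono {1} {2 ℕ.^ n} (ℕ.m^n>0 2 n))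

open import Defs
open import Data.Nat.Base as ℕ using (ℕ; suc; NonZero)
import Data.Nat.Properties as ℕ
open import Data.Nat.ListAction using (sum)
open import Data.List.Base using (map; upTo)
open import Data.Product.Base using (Σ-syntax; ∃-syntax; _×_; _,_)
open import Data.Rational.Base as ℚ using (ℚ; 0ℚ; 1ℚ)
import Data.Rational.Properties as ℚ
open import Data.Rational.Solver using (module +-*-Solver)
open import Data.Sum.Base using (inj₁; inj₂)
open import Function.Bundles using (Func)
open import Relation.Binary.PropositionalEquality using (_≡_; refl; sym; trans; cong; subst)
import Relation.Binary.Reasoning.Setoid ℝ-setoid as ≈-Reasoning
open +-*-Solver using (solve; _:+_; _:*_; _:=_; :-_; con)
open Cauchy using (fromℕℚ)
open Counting using (summatory)
open Exponential using (expSum-+-limit; expSum-0; expSum-lnSum-limit)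
open Regularity
open Limit using (limit; limit-regular; limit-fromℕℚ; limit-double)
open Func using (to)

-- Real functions from regular families

apply : ∀ {f} → Regular f → ℝ → ℝ
apply {f} rf x = mkℝ (λ n → f n (seq x n)) λ ε 0<ε →
  let (B , _ , x≤B)        = Cauchy.bounded (seq x) (cauchy x)
      (δ , 0<δ , M , near) = close rf B ε 0<ε
      (N , x-close)        = cauchy x δ 0<δ
  in M ℕ.⊔ N , λ m n ≤m ≤n →
    near m n (seq x m) (seq x n) (ℕ.m⊔n≤o⇒m≤o M N ≤m) (ℕ.m⊔n≤o⇒m≤o M N ≤n) (x≤B m) (x≤B n)
      (x-close m n (ℕ.m⊔n≤o⇒n≤o M N ≤m) (ℕ.m⊔n≤o⇒n≤o M N ≤n))

apply-cong : ∀ {f} (rf : Regular f) x y → x ≈ y → apply rf x ≈ apply rf y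
apply-cong rf x y x≈y ε 0<ε =
  let (B , 0<B , x≤B)      = Cauchy.bounded (seq x) (cauchy x)
      (C , 0<C , y≤C)      = Cauchy.bounded (seq y) (cauchy y)
      (δ , 0<δ , M , near) = close rf (B ℚ.+ C) ε 0<ε
      (N , x-y<δ)          = x≈y δ 0<δ
  in M ℕ.⊔ N , λ n ≤n → let M≤n = ℕ.m⊔n≤o⇒m≤o M N ≤n in
    near n n (seq x n) (seq y n) M≤n M≤n
      (ℚ.≤-trans (x≤B n) (Cauchy.p≤p+q B (ℚ.<⇒≤ 0<C)))
      (ℚ.≤-trans (y≤C n) (Cauchy.p≤q+p C (ℚ.<⇒≤ 0<B)))
      (x-y<δ n (ℕ.m⊔n≤o⇒n≤o M N ≤n))

apply-continuous : ∀ {f} (rf : Regular f) → Continuous (apply rf)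
apply-continuous {f} rf x ε (c , 0<c , N₀ , c≤ε) =
  -- Strict order of reals requires a rational gap: one half of `c` bounds the difference of values,
  -- the other half is the gap below `ε`.
  let (η , 0<η , η+η≡c)      = Cauchy.halve c 0<c
      (B , 0<B , x≤B)        = Cauchy.bounded (seq x) (cauchy x)
      (δ , 0<δ , N₁ , near)  = close rf (B ℚ.+ 1ℚ) η 0<η
      -- Capping the radius at 1 keeps the approximations of `y` within `B + 1` wherever `near` is
      -- used.
      0<δ⊓1                  = ⊓-pos δ 0<δ
  in fromℚ (δ ℚ.⊓ 1ℚ) , (δ ℚ.⊓ 1ℚ , 0<δ⊓1 , 0 , λ _ _ → ℚ.≤-reflexive (ℚ.+-identityˡ (δ ℚ.⊓ 1ℚ))) ,
    λ y (γ , 0<γ , N₂ , y-x) → η , 0<η , N₀ ℕ.⊔ (N₁ ℕ.⊔ N₂) , λ n ≤n → let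
      N₀≤n = ℕ.m⊔n≤o⇒m≤o N₀ (N₁ ℕ.⊔ N₂) ≤n
      ≤n′  = ℕ.m⊔n≤o⇒n≤o N₀ (N₁ ℕ.⊔ N₂) ≤n
      N₁≤n = ℕ.m⊔n≤o⇒m≤o N₁ N₂ ≤n′
      d    = ℚ.∣ seq y n ℚ.- seq x n ∣
      d<   : d ℚ.< δ ℚ.⊓ 1ℚ
      d<   = ℚ.<-≤-trans (subst (ℚ._< d ℚ.+ γ) (ℚ.+-identityʳ d) (ℚ.+-monoʳ-< d 0<γ))
               (y-x n (ℕ.m⊔n≤o⇒n≤o N₁ N₂ ≤n′))
      y≤B+1 : ℚ.∣ seq y n ∣ ℚ.≤ B ℚ.+ 1ℚ
      y≤B+1 = ℚ.≤-trans (Cauchy.∣p∣≤∣q∣+∣p-q∣ (seq y n) (seq x n))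
                (ℚ.+-mono-≤ (x≤B n) (ℚ.<⇒≤ (ℚ.<-≤-trans d< (ℚ.p⊓q≤q δ 1ℚ))))
      f-<η : ℚ.∣ f n (seq y n) ℚ.- f n (seq x n) ∣ ℚ.< η
      f-<η = near n n (seq y n) (seq x n) N₁≤n N₁≤n y≤B+1
               (ℚ.≤-trans (x≤B n) (Cauchy.p≤p+q B (ℚ.<⇒≤ Cauchy.0<1)))
               (ℚ.<-≤-trans d< (ℚ.p⊓q≤p δ 1ℚ))
    in ℚ.≤-trans (ℚ.+-monoˡ-≤ η (ℚ.<⇒≤ f-<η))
         (ℚ.≤-trans (ℚ.≤-reflexive (trans η+η≡c (sym (ℚ.+-identityˡ c)))) (c≤ε n N₀≤n))
  where
  ⊓-pos : ∀ δ → 0ℚ ℚ.< δ → 0ℚ ℚ.< δ ℚ.⊓ 1ℚ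
  ⊓-pos δ 0<δ with ℚ.⊓-sel δ 1ℚ
  ... | inj₁ eq = subst (0ℚ ℚ.<_) (sym eq) 0<δ
  ... | inj₂ eq = subst (0ℚ ℚ.<_) (sym eq) Cauchy.0<1

eventually-≡⇒≈ : ∀ x y N → (∀ n → N ℕ.≤ n → seq x n ≡ seq y n) → x ≈ y
eventually-≡⇒≈ x y N x≡y ε 0<ε = N , λ n N≤n →
  subst (λ r → ℚ.∣ r ∣ ℚ.< ε) (sym (trans (cong (ℚ._- seq y n) (x≡y n N≤n)) (ℚ.+-inverseʳ (seq y n)))) 0<ε

≡⇒≈ : ∀ x y → (∀ n → seq x n ≡ seq y n) → x ≈ y
≡⇒≈ x y x≡y = eventually-≡⇒≈ x y 0 λ n _ → x≡y n

-- `_≈_` inspects only `seq`, and multiplication by a fixed real has the sequence of an `apply`, so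
-- this is an instance of `apply-cong`.
*-congʳ : ∀ x {y z} → y ≈ z → x * y ≈ x * z
*-congʳ x {y} {z} = apply-cong (*-regular (const-regular (seq x) (cauchy x)) id-regular) y z

*-congˡ : ∀ {x y} z → x ≈ y → x * z ≈ y * z
*-congˡ {x} {y} z = apply-cong (*-regular id-regular (const-regular (seq z) (cauchy z))) x y

*-cong : ∀ {x y u v} → x ≈ y → u ≈ v → x * u ≈ y * v
*-cong {x} {y} {u} {v} x≈y u≈v =
  ≈-trans {x * u} {y * u} {y * v} (*-congˡ {x} {y} u x≈y) (*-congʳ y {u} {v} u≈v)

exp-cong : ∀ x y → x ≈ y → exp x ≈ exp y
exp-cong = apply-cong exp-regular

exp-+ : ∀ x y → exp (x + y) ≈ exp x * exp y
exp-+ x y = ≈-sym {exp x * exp y} {exp (x + y)} λ ε 0<ε →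
  let (B , 0<B , x≤B) = Cauchy.bounded (seq x) (cauchy x)
      (C , 0<C , y≤C) = Cauchy.bounded (seq y) (cauchy y)
      (N , small)     = expSum-+-limit (B ℚ.+ C) (ℚ.<⇒≤ (Cauchy.+-pos 0<B 0<C)) ε 0<ε
  in N , λ n N≤n → small n N≤n {seq x n} {seq y n}
       (ℚ.≤-trans (x≤B n) (Cauchy.p≤p+q B (ℚ.<⇒≤ 0<C)))
       (ℚ.≤-trans (y≤C n) (Cauchy.p≤q+p C (ℚ.<⇒≤ 0<B)))

exp-0 : exp 0ℝ ≈ 1ℝ
exp-0 = eventually-≡⇒≈ (exp 0ℝ) 1ℝ 1 λ { (suc n) _ → expSum-0 n }

exp-*-exp-neg : ∀ x y → x + y ≈ 0ℝ → exp x * exp y ≈ 1ℝ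
exp-*-exp-neg x y x+y≈0 = begin
  exp x * exp y     ≈⟨ exp-+ x y ⟨
  exp (x + y)       ≈⟨ exp-cong (x + y) 0ℝ x+y≈0 ⟩
  exp 0ℝ            ≈⟨ exp-0 ⟩
  1ℝ                ∎
  where open ≈-Reasoning

exp-ln : ∀ N .{{_ : NonZero N}} → exp (ln N) ≈ fromℕ N
exp-ln (suc k) = expSum-lnSum-limit k

-- From the index `N` on, the maximum with `c` inside `recip⊔` has no effect and the identity is
-- exact.
÷-* : ∀ x y (0<y : 0ℝ < y) → x ÷ y [ 0<y ] * y ≈ x
÷-* x y 0<y@(c , 0<c , N , c≤y) = eventually-≡⇒≈ (x ÷ y [ 0<y ] * y) x N λ n N≤n → let
    p = seq x n
    q = seq y n
    c⊔q≡q : c ℚ.⊔ q ≡ q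
    c⊔q≡q = ℚ.p≤q⇒p⊔q≡q (subst (ℚ._≤ q) (ℚ.+-identityˡ c) (c≤y n N≤n))
    r = recip⊔ c 0<c q
    q*r≡1 : q ℚ.* r ≡ 1ℚ
    q*r≡1 = trans (cong (ℚ._* r) (sym c⊔q≡q)) (Cauchy.*-recipℚ (c ℚ.⊔ q) (Cauchy.Reciprocal.c⊔-pos c 0<c q))
  in trans (solve 3 (λ p r q → p :* r :* q := p :* (q :* r)) refl p r q)
       (trans (cong (p ℚ.*_) q*r≡1) (ℚ.*-identityʳ p))

-- The limit function and its periodic normalisation

F : ℝ → ℝ
F = apply limit-regular

F-cong : ∀ x y → x ≈ y → F x ≈ F y
F-cong = apply-cong limit-regular

F-fromℕ : ∀ n → F (fromℕ n) ≈ fromℕ (summatory n)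
F-fromℕ n = ≡⇒≈ (F (fromℕ n)) (fromℕ (summatory n)) (limit-fromℕℚ n)

-- `limit-double` advances the level to `suc n` but leaves the argument at `seq x n`, so `shifted`
-- is not a subsequence of `F x`. The two agree because regularity makes different levels close at
-- the same argument.
F-double : ∀ x → F (x * fromℕ 2) ≈ fromℕ 3 * F x
F-double x = ≈-trans {F (x * fromℕ 2)} {fromℕ 3 * shifted} {fromℕ 3 * F x}
  (≡⇒≈ (F (x * fromℕ 2)) (fromℕ 3 * shifted) λ n → limit-double n (seq x n))
  (*-congʳ (fromℕ 3) {shifted} {F x} shifted≈)
  where
  near : ∀ ε → 0ℚ ℚ.< ε → ∃[ N ] (∀ m n → N ℕ.≤ m → N ℕ.≤ n →
         ℚ.∣ limit m (seq x n) ℚ.- limit n (seq x n) ∣ ℚ.< ε)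
  near ε 0<ε =
    let (B , _ , x≤B)         = Cauchy.bounded (seq x) (cauchy x)
        (δ , 0<δ , N , near)  = close limit-regular B ε 0<ε
    in N , λ m n N≤m N≤n → near m n (seq x n) (seq x n) N≤m N≤n (x≤B n) (x≤B n)
         (subst (λ r → ℚ.∣ r ∣ ℚ.< δ) (sym (ℚ.+-inverseʳ (seq x n))) 0<δ)
  limit-suc : Regular (λ n → limit (suc n))
  limit-suc = record
    { bound = λ B → let (C , ≤C) = bound limit-regular B in C , λ n → ≤C (suc n)
    ; close = λ B ε 0<ε → let (δ , 0<δ , N , near) = close limit-regular B ε 0<ε in
        δ , 0<δ , N , λ m n p q N≤m N≤n → near (suc m) (suc n) p q (ℕ.m≤n⇒m≤1+n N≤m) (ℕ.m≤n⇒m≤1+n N≤n)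
    }
  shifted : ℝ
  shifted = apply limit-suc x
  shifted≈ : shifted ≈ F x
  shifted≈ ε 0<ε = let (N , close) = near ε 0<ε in
    N , λ n N≤n → close (suc n) n (ℕ.m≤n⇒m≤1+n N≤n) N≤n

-- x ↦ F (2ˣ) 3⁻ˣ

h-regular : Regular _
h-regular = *-regular
  (∘-regular limit-regular (∘-regular exp-regular (*-regular id-regular (const-regular (seq (ln 2)) (cauchy (ln 2))))))
  (∘-regular exp-regular (*-regular id-regular (const-regular (seq (- ln 3)) (cauchy (- ln 3)))))

𝓗 : Func ℝ-setoid ℝ-setoid
𝓗 = record { to = apply h-regular ; cong = λ {x} {y} → apply-cong h-regular x y }

𝓗-unfold : ∀ x → to 𝓗 x ≈ F (exp (x * ln 2)) * exp (x * - ln 3)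
𝓗-unfold x = ≡⇒≈ (to 𝓗 x) (F (exp (x * ln 2)) * exp (x * - ln 3)) λ _ → refl

exp-shift : ∀ x c → exp ((x + 1ℝ) * c) ≈ exp (x * c) * exp c
exp-shift x c = begin
  exp ((x + 1ℝ) * c)        ≈⟨ exp-cong ((x + 1ℝ) * c) (x * c + c) (≡⇒≈ ((x + 1ℝ) * c) (x * c + c)
                                 λ n → solve 2 (λ x c → (x :+ con 1ℚ) :* c := x :* c :+ c) refl (seq x n) (seq c n)) ⟩
  exp (x * c + c)           ≈⟨ exp-+ (x * c) c ⟩
  exp (x * c) * exp c       ∎
  where open ≈-Reasoning

F-exp-shift : ∀ x → F (exp ((x + 1ℝ) * ln 2)) ≈ fromℕ 3 * F (exp (x * ln 2))
F-exp-shift x = begin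
  F (exp ((x + 1ℝ) * ln 2))         ≈⟨ F-cong (exp ((x + 1ℝ) * ln 2)) (exp (x * ln 2) * exp (ln 2)) (exp-shift x (ln 2)) ⟩
  F (exp (x * ln 2) * exp (ln 2))   ≈⟨ F-cong (exp (x * ln 2) * exp (ln 2)) (exp (x * ln 2) * fromℕ 2)
                                         (*-congʳ (exp (x * ln 2)) {exp (ln 2)} {fromℕ 2} (exp-ln 2)) ⟩
  F (exp (x * ln 2) * fromℕ 2)      ≈⟨ F-double (exp (x * ln 2)) ⟩
  fromℕ 3 * F (exp (x * ln 2))      ∎
  where open ≈-Reasoning

3*exp-neg-ln3 : fromℕ 3 * exp (- ln 3) ≈ 1ℝ
3*exp-neg-ln3 = begin
  fromℕ 3 * exp (- ln 3)          ≈⟨ *-congˡ {exp (ln 3)} {fromℕ 3} (exp (- ln 3)) (exp-ln 3) ⟨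
  exp (ln 3) * exp (- ln 3)       ≈⟨ exp-*-exp-neg (ln 3) (- ln 3) (≡⇒≈ (ln 3 + - ln 3) 0ℝ λ n → ℚ.+-inverseʳ (seq (ln 3) n)) ⟩
  1ℝ                              ∎
  where open ≈-Reasoning

-- A shift by 1 doubles 2ˣ and so multiplies the factor `F` by 3, which the factor 1/3 gained by 3⁻ˣ
-- cancels.
𝓗-periodic : Periodic (to 𝓗) 1ℝ
𝓗-periodic x = begin
  to 𝓗 (x + 1ℝ)                                                   ≈⟨ 𝓗-unfold (x + 1ℝ) ⟩
  F (exp ((x + 1ℝ) * ln 2)) * exp ((x + 1ℝ) * - ln 3)             ≈⟨ *-cong {F (exp ((x + 1ℝ) * ln 2))} {fromℕ 3 * w}
                                                                       {exp ((x + 1ℝ) * - ln 3)} {z * e}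
                                                                       (F-exp-shift x) (exp-shift x (- ln 3)) ⟩
  (fromℕ 3 * w) * (z * e)                                         ≈⟨ ≡⇒≈ ((fromℕ 3 * w) * (z * e)) ((w * z) * (fromℕ 3 * e)) (λ n →
                                                                       solve 4 (λ t w z e → (t :* w) :* (z :* e) := (w :* z) :* (t :* e)) refl
                                                                         (fromℕℚ 3) (seq w n) (seq z n) (seq e n)) ⟩
  (w * z) * (fromℕ 3 * e)                                         ≈⟨ *-congʳ (w * z) {fromℕ 3 * e} {1ℝ} 3*exp-neg-ln3 ⟩
  (w * z) * 1ℝ                                                    ≈⟨ ≡⇒≈ ((w * z) * 1ℝ) (w * z) (λ n → ℚ.*-identityʳ _) ⟩
  w * z                                                           ≈⟨ 𝓗-unfold x ⟨
  to 𝓗 x                                                          ∎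
  where
  open ≈-Reasoning
  w = F (exp (x * ln 2))
  z = exp (x * - ln 3)
  e = exp (- ln 3)

-- The argument of `F` at log₂ N is exp (ln N) = N, and the normalising factor 3⁻ˣ cancels against
-- the power of 3 in front.
𝓗-log₂ : ∀ N .{{_ : NonZero N}} → fromℕ (summatory N) ≈ (3 ^ log₂ N) * to 𝓗 (log₂ N)
𝓗-log₂ N = begin
  fromℕ (summatory N)           ≈⟨ F-fromℕ N ⟨
  F (fromℕ N)                   ≈⟨ F-cong (exp (ln N)) (fromℕ N) (exp-ln N) ⟨
  F (exp (ln N))                ≈⟨ F-cong (exp (L * ln 2)) (exp (ln N)) (exp-cong (L * ln 2) (ln N) (÷-* (ln N) (ln 2) 0<ln2)) ⟨
  w                             ≈⟨ ≡⇒≈ (1ℝ * w) w (λ n → ℚ.*-identityˡ (seq w n)) ⟨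
  1ℝ * w                        ≈⟨ *-congˡ {u * v} {1ℝ} w (exp-*-exp-neg (L * ln 3) (L * - ln 3) (≡⇒≈ (L * ln 3 + L * - ln 3) 0ℝ λ n →
                                     solve 2 (λ l c → l :* c :+ l :* (:- c) := con 0ℚ) refl (seq L n) (seq (ln 3) n))) ⟨
  (u * v) * w                   ≈⟨ ≡⇒≈ ((u * v) * w) (u * (w * v)) (λ n →
                                     solve 3 (λ u v w → (u :* v) :* w := u :* (w :* v)) refl (seq u n) (seq v n) (seq w n)) ⟩
  u * (w * v)                   ≈⟨ *-congʳ u {to 𝓗 L} {w * v} (𝓗-unfold L) ⟨
  (3 ^ L) * to 𝓗 L              ∎
  where
  open ≈-Reasoning
  L = log₂ N
  u = 3 ^ L
  v = exp (L * - ln 3)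
  w = F (exp (L * ln 2))

theorem1 : Σ[ H ∈ Func ℝ-setoid ℝ-setoid ]
    ( Continuous (to H)
    × Periodic (to H) 1ℝ
    × (∀ (N : ℕ) → .{{_ : NonZero N}} →
    fromℕ (sum (map s (upTo (suc N)))) ≈ (3 ^ log₂ N) * to H (log₂ N)) )
theorem1 = 𝓗 , apply-continuous h-regular , 𝓗-periodic , λ N → 𝓗-log₂ N
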